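{- There exists a constant $c>0$ such that for every $k \in \mathbb{N}$ there exists a constant $c_k>0$ such that for all $n \in \mathbb{N}$ there exist integers $a_1, \dots, a_k$ with $1 \leq a_1, \dots, a_k \leq n$ and $$ 0 < \left\| \sqrt{a_1} + \dots + \sqrt{a_k} \right\| \leq c_k \cdot n^{ -c \cdot k^{1/3}}.$$
   Context: $\mathbb{N}$ denotes the positive integers. For a real number $x$, $\|x\| = \min_{m \in \mathbb{Z}} |x-m|$ denotes the distance from $x$ to the nearest integer.
   Formalization: The claim is proved for all n ≥ 2; for n = 1 it is false, since all a_i must equal 1, so the sum is the integer k and its distance to the nearest integer is 0. -}

module Defs where

open import Data.Empty using (⊥-elim)
open import Data.Fin using (Fin)
open import Data.Integer as ℤ using (ℤ; +_; -[1+_])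
import Data.Integer.DivMod as ℤ
import Data.Integer.Properties as ℤ
import Data.Integer.Solver as ℤSolver
open import Data.Nat as ℕ using (ℕ; zero; suc; NonZero; z≤n; s≤s)
import Data.Nat.Properties as ℕ
import Data.Nat.Solver as ℕSolver
open import Data.Product using (∃-syntax; _×_; _,_)
open import Data.Rational as ℚ using (ℚ; mkℚ; 0ℚ; 1ℚ; ½; ↥_; ↧ₙ_)
import Data.Rational.Properties as ℚ
import Data.Rational.Solver as ℚSolver
open import Data.Rational.Unnormalised as ℚᵘ using (mkℚᵘ)
import Data.Rational.Unnormalised.Properties as ℚᵘ
open import Data.Sum using (inj₁; inj₂)
open import Data.Vec.Functional using (foldr)
open import Function using (_∘_)
open import Relation.Binary.PropositionalEquality
open import Relation.Nullary using (yes; no)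
open import Relation.Unary using (Decidable)

fromℤ : ℤ → ℚ
fromℤ i = i ℚ./ 1

≤⇒0≤- : ∀ {p q} → p ℚ.≤ q → 0ℚ ℚ.≤ q ℚ.- p
≤⇒0≤- {p} {q} p≤q =
  subst (ℚ._≤ q ℚ.- p) (ℚ.+-inverseʳ p) (ℚ.+-monoˡ-≤ (ℚ.- p) p≤q)

p≤∣p∣ : ∀ p → p ℚ.≤ ℚ.∣ p ∣
p≤∣p∣ p with ℚ.≤-total 0ℚ p
... | inj₁ 0≤p = ℚ.≤-reflexive (sym (ℚ.0≤p⇒∣p∣≡p 0≤p))
... | inj₂ p≤0 = ℚ.≤-trans p≤0 (ℚ.0≤∣p∣ p)

-p≤∣p∣ : ∀ p → ℚ.- p ℚ.≤ ℚ.∣ p ∣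
-p≤∣p∣ p = subst (ℚ.- p ℚ.≤_) (ℚ.∣-p∣≡∣p∣ p) (p≤∣p∣ (ℚ.- p))

∣p∣≤ : ∀ {p q} → p ℚ.≤ q → ℚ.- p ℚ.≤ q → ℚ.∣ p ∣ ℚ.≤ q
∣p∣≤ {p} {q} p≤q -p≤q with ℚ.∣p∣≡p∨∣p∣≡-p p
... | inj₁ eq = subst (ℚ._≤ q) (sym eq) p≤q
... | inj₂ eq = subst (ℚ._≤ q) (sym eq) -p≤q

p≤q+r⇒p-q≤r : ∀ {p q r} → p ℚ.≤ q ℚ.+ r → p ℚ.- q ℚ.≤ r
p≤q+r⇒p-q≤r {p} {q} {r} h =
  subst (p ℚ.- q ℚ.≤_)
    (solve 2 (λ q r → (q :+ r) :- q := r) refl q r)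
    (ℚ.+-monoˡ-≤ (ℚ.- q) h)
  where open ℚSolver.+-*-Solver

p-q≤r⇒p≤q+r : ∀ {p q r} → p ℚ.- q ℚ.≤ r → p ℚ.≤ q ℚ.+ r
p-q≤r⇒p≤q+r {p} {q} {r} h =
  subst₂ ℚ._≤_
    (solve 2 (λ p q → (p :- q) :+ q := p) refl p q) (ℚ.+-comm r q)
    (ℚ.+-monoˡ-≤ q h)
  where open ℚSolver.+-*-Solver

∣p-q∣-comm : ∀ p q → ℚ.∣ p ℚ.- q ∣ ≡ ℚ.∣ q ℚ.- p ∣
∣p-q∣-comm p q = trans (sym (ℚ.∣-p∣≡∣p∣ (p ℚ.- q)))
  (cong ℚ.∣_∣ (solve 2 (λ p q → :- (p :- q) := q :- p) refl p q))
  where open ℚSolver.+-*-Solver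

half+half : ∀ ε → ε ℚ.* ½ ℚ.+ ε ℚ.* ½ ≡ ε
half+half ε = trans (sym (ℚ.*-distribˡ-+ ε ½ ½)) (ℚ.*-identityʳ ε)

*-pos : ∀ {p q} → 0ℚ ℚ.< p → 0ℚ ℚ.< q → 0ℚ ℚ.< p ℚ.* q
*-pos {p} {q} 0<p 0<q =
  ℚ.positive⁻¹ _ {{ℚ.pos*pos⇒pos p {{ℚ.positive 0<p}} q {{ℚ.positive 0<q}}}}

half-pos : ∀ {ε} → 0ℚ ℚ.< ε → 0ℚ ℚ.< ε ℚ.* ½
half-pos 0<ε = *-pos 0<ε (ℚ.positive⁻¹ ½)

/-pos : ∀ i n → 0ℚ ℚ.< + suc i ℚ./ suc n
/-pos i n = ℚ.positive⁻¹ _ {{ℚ.normalize-pos (suc i) (suc n)}}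

*-mono-≤-nonNeg : ∀ {p q r s} → 0ℚ ℚ.≤ p → 0ℚ ℚ.≤ s → p ℚ.≤ q → r ℚ.≤ s →
                  p ℚ.* r ℚ.≤ q ℚ.* s
*-mono-≤-nonNeg {p} {q} {r} {s} 0≤p 0≤s p≤q r≤s = ℚ.≤-trans
  (ℚ.*-monoˡ-≤-nonNeg p {{ℚ.nonNegative 0≤p}} r≤s)
  (ℚ.*-monoʳ-≤-nonNeg s {{ℚ.nonNegative 0≤s}} p≤q)

/-≤ᵘ : ∀ a l q → + a ℤ.* ℚᵘ.↧ q ℤ.≤ ℚᵘ.↥ q ℤ.* + suc l →
       + a ℚ./ suc l ℚ.≤ ℚ.fromℚᵘ q
/-≤ᵘ a l q h = ℚ.toℚᵘ-cancel-≤
  (ℚᵘ.≤-respˡ-≃ (ℚᵘ.≃-sym (ℚ.toℚᵘ-fromℚᵘ (mkℚᵘ (+ a) l)))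
    (ℚᵘ.≤-respʳ-≃ (ℚᵘ.≃-sym (ℚ.toℚᵘ-fromℚᵘ q)) (ℚᵘ.*≤* h)))

/-mono-≤ : ∀ a l b m → a ℕ.* suc m ℕ.≤ b ℕ.* suc l →
           + a ℚ./ suc l ℚ.≤ + b ℚ./ suc m
/-mono-≤ a l b m h = /-≤ᵘ a l (mkℚᵘ (+ b) m)
  (subst₂ ℤ._≤_ (ℤ.pos-* a (suc m)) (ℤ.pos-* b (suc l)) (ℤ.+≤+ h))

fromℚᵘ-+ : ∀ p q → ℚ.fromℚᵘ (p ℚᵘ.+ q) ≡ ℚ.fromℚᵘ p ℚ.+ ℚ.fromℚᵘ q
fromℚᵘ-+ p q = ℚ.toℚᵘ-injective (begin
  ℚ.toℚᵘ (ℚ.fromℚᵘ (p ℚᵘ.+ q))                       ≈⟨ ℚ.toℚᵘ-fromℚᵘ _ ⟩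
  p ℚᵘ.+ q                                           ≈⟨ ℚᵘ.+-cong (ℚ.toℚᵘ-fromℚᵘ p) (ℚ.toℚᵘ-fromℚᵘ q) ⟨
  ℚ.toℚᵘ (ℚ.fromℚᵘ p) ℚᵘ.+ ℚ.toℚᵘ (ℚ.fromℚᵘ q)       ≈⟨ ℚ.toℚᵘ-homo-+ (ℚ.fromℚᵘ p) (ℚ.fromℚᵘ q) ⟨
  ℚ.toℚᵘ (ℚ.fromℚᵘ p ℚ.+ ℚ.fromℚᵘ q)                 ∎)
  where open ℚᵘ.≃-Reasoning

/-≤-sum : ∀ a l b m k t →
          a ℕ.* (suc m ℕ.* suc t) ℕ.≤ (b ℕ.* suc t ℕ.+ k ℕ.* suc m) ℕ.* suc l →
          + a ℚ./ suc l ℚ.≤ + b ℚ./ suc m ℚ.+ + k ℚ./ suc t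
/-≤-sum a l b m k t h =
  subst (+ a ℚ./ suc l ℚ.≤_) (fromℚᵘ-+ (mkℚᵘ (+ b) m) (mkℚᵘ (+ k) t))
    (/-≤ᵘ a l (mkℚᵘ (+ b) m ℚᵘ.+ mkℚᵘ (+ k) t)
      (subst₂ ℤ._≤_ (ℤ.pos-* a (suc m ℕ.* suc t))
        (trans (ℤ.pos-* (b ℕ.* suc t ℕ.+ k ℕ.* suc m) (suc l))
          (cong (ℤ._* + suc l) (cong₂ ℤ._+_ (ℤ.pos-* b (suc t)) (ℤ.pos-* k (suc m)))))
        (ℤ.+≤+ h)))

suc/-split : ∀ b m → + suc b ℚ./ suc m ℚ.≤ + b ℚ./ suc m ℚ.+ + 1 ℚ./ suc m
suc/-split b m = /-≤-sum (suc b) m b m 1 m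
  (ℕ.≤-reflexive (solve 2 (λ b m → (con 1 :+ b) :* (m :* m)
    := (b :* m :+ con 1 :* m) :* m) refl b (suc m)))
  where open ℕSolver.+-*-Solver

archimedean : ∀ (K : ℕ) {ε} → 0ℚ ℚ.< ε → ∃[ t ] + K ℚ./ suc t ℚ.≤ ε
archimedean K {ε@(mkℚ (+ zero) d _)} 0<ε =
  ⊥-elim (ℤ.<-irrefl refl (ℚ.drop-*<* 0<ε))
archimedean K {ε@(mkℚ -[1+ a ] d _)} 0<ε with ℚ.drop-*<* 0<ε
... | ()
archimedean K {ε@(mkℚ (+ suc a) d _)} 0<ε = K ℕ.* suc d ,
  subst (+ K ℚ./ suc (K ℕ.* suc d) ℚ.≤_) (ℚ.↥p/↧p≡p ε)
    (/-mono-≤ K (K ℕ.* suc d) (suc a) d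
      (ℕ.≤-trans (ℕ.n≤1+n _) (ℕ.m≤m+n (suc (K ℕ.* suc d)) _)))

p≤∣↥p∣ : ∀ p → p ℚ.≤ fromℤ (+ ℤ.∣ ↥ p ∣)
p≤∣↥p∣ p@(mkℚ i d _) = subst (ℚ._≤ fromℤ (+ ℤ.∣ i ∣)) (ℚ.↥p/↧p≡p p)
  (ℚ.≤-trans (lemma i) (/-mono-≤ ℤ.∣ i ∣ d ℤ.∣ i ∣ 0
    (ℕ.*-monoʳ-≤ ℤ.∣ i ∣ (s≤s z≤n))))
  where
  lemma : ∀ i → i ℚ./ suc d ℚ.≤ + ℤ.∣ i ∣ ℚ./ suc d
  lemma (+ n)    = ℚ.≤-refl
  lemma -[1+ n ] = ℚ.≤-trans (ℚ.neg-antimono-≤ (ℚ.<⇒≤ (/-pos n d))) (ℚ.<⇒≤ (/-pos n d))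

-- Real numbers as Cauchy sequences of rationals.  Two sequences with the
-- same limit are not identified; _<ᵣ_ and _≤ᵣ_ depend on the limits only.

Cauchy : (ℕ → ℚ) → Set
Cauchy x = ∀ {ε} → 0ℚ ℚ.< ε →
  ∃[ N ] (∀ {m n} → N ℕ.≤ m → N ℕ.≤ n → ℚ.∣ x m ℚ.- x n ∣ ℚ.≤ ε)

record ℝ : Set where
  constructor mkℝ
  field
    approx : ℕ → ℚ
    cauchy : Cauchy approx
open ℝ public

infix 4 _<ᵣ_ _≤ᵣ_

_<ᵣ_ : ℝ → ℝ → Set
x <ᵣ y = ∃[ ε ] 0ℚ ℚ.< ε ×
  ∃[ N ] (∀ {m} → N ℕ.≤ m → approx x m ℚ.+ ε ℚ.≤ approx y m)

_≤ᵣ_ : ℝ → ℝ → Set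
x ≤ᵣ y = ∀ {ε} → 0ℚ ℚ.< ε →
  ∃[ N ] (∀ {m} → N ℕ.≤ m → approx x m ℚ.≤ approx y m ℚ.+ ε)

oneSided : ∀ {x} →
  (∀ {ε} → 0ℚ ℚ.< ε → ∃[ N ] (∀ {m n} → N ℕ.≤ m → N ℕ.≤ n → x m ℚ.≤ x n ℚ.+ ε)) →
  Cauchy x
oneSided {x} h 0<ε with h 0<ε
... | N , f = N , λ {m} {n} N≤m N≤n → ∣p∣≤ (p≤q+r⇒p-q≤r (f N≤m N≤n))
  (subst (ℚ._≤ _) (solve 2 (λ p q → q :- p := :- (p :- q)) refl (x m) (x n))
    (p≤q+r⇒p-q≤r (f N≤n N≤m)))
  where open ℚSolver.+-*-Solver

fromℚ : ℚ → ℝ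
fromℚ q = mkℝ (λ _ → q) (λ {ε} 0<ε → 0 , λ _ _ →
  subst (λ d → ℚ.∣ d ∣ ℚ.≤ ε) (sym (ℚ.+-inverseʳ q)) (ℚ.<⇒≤ 0<ε))

0ᵣ : ℝ
0ᵣ = fromℚ 0ℚ

infixl 6 _+ᵣ_
infixl 7 _*ᵣ_
infix  8 -ᵣ_

_+ᵣ_ : ℝ → ℝ → ℝ
x +ᵣ y = mkℝ (λ m → approx x m ℚ.+ approx y m) λ {ε} 0<ε →
  let N₁ , f = cauchy x (half-pos 0<ε)
      N₂ , g = cauchy y (half-pos 0<ε)
  in N₁ ℕ.⊔ N₂ , λ {m} {n} N≤m N≤n →
    let a = approx x m ; b = approx y m ; c = approx x n ; d = approx y n in begin
    ℚ.∣ (a ℚ.+ b) ℚ.- (c ℚ.+ d) ∣            ≡⟨ cong ℚ.∣_∣ (solve 4 (λ a b c d →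
                                                (a :+ b) :- (c :+ d) := (a :- c) :+ (b :- d)) refl a b c d) ⟩
    ℚ.∣ (a ℚ.- c) ℚ.+ (b ℚ.- d) ∣            ≤⟨ ℚ.∣p+q∣≤∣p∣+∣q∣ (a ℚ.- c) (b ℚ.- d) ⟩
    ℚ.∣ a ℚ.- c ∣ ℚ.+ ℚ.∣ b ℚ.- d ∣          ≤⟨ ℚ.+-mono-≤
                                                (f (ℕ.m⊔n≤o⇒m≤o N₁ N₂ N≤m) (ℕ.m⊔n≤o⇒m≤o N₁ N₂ N≤n))
                                                (g (ℕ.m⊔n≤o⇒n≤o N₁ N₂ N≤m) (ℕ.m⊔n≤o⇒n≤o N₁ N₂ N≤n)) ⟩
    ε ℚ.* ½ ℚ.+ ε ℚ.* ½                      ≡⟨ half+half ε ⟩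
    ε                                        ∎
  where open ℚ.≤-Reasoning
        open ℚSolver.+-*-Solver using (solve; _:+_; _:-_; _:=_)

-ᵣ_ : ℝ → ℝ
-ᵣ x = mkℝ (λ m → ℚ.- approx x m) λ {ε} 0<ε →
  let N , f = cauchy x 0<ε in N , λ {m} {n} N≤m N≤n →
  subst (ℚ._≤ ε) (trans (∣p-q∣-comm (approx x m) (approx x n))
      (cong ℚ.∣_∣ (solve 2 (λ p q → q :- p := (:- p) :- (:- q)) refl (approx x m) (approx x n))))
    (f N≤m N≤n)
  where open ℚSolver.+-*-Solver

eventuallyBounded : ∀ x → ∃[ K ] ∃[ N ] (∀ {m} → N ℕ.≤ m →
                    ℚ.∣ approx x m ∣ ℚ.≤ fromℤ (+ suc K))
eventuallyBounded x with cauchy x (ℚ.positive⁻¹ 1ℚ)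
... | N , f = ℤ.∣ ↥ b ∣ , N , λ {m} N≤m → begin
  ℚ.∣ approx x m ∣                                   ≡⟨ cong ℚ.∣_∣ (solve 2 (λ p q → p := (p :- q) :+ q) refl (approx x m) (approx x N)) ⟩
  ℚ.∣ (approx x m ℚ.- approx x N) ℚ.+ approx x N ∣   ≤⟨ ℚ.∣p+q∣≤∣p∣+∣q∣ (approx x m ℚ.- approx x N) (approx x N) ⟩
  ℚ.∣ approx x m ℚ.- approx x N ∣ ℚ.+ ℚ.∣ approx x N ∣ ≤⟨ ℚ.+-monoˡ-≤ ℚ.∣ approx x N ∣ (f N≤m ℕ.≤-refl) ⟩
  b                                                  ≤⟨ p≤∣↥p∣ b ⟩
  fromℤ (+ ℤ.∣ ↥ b ∣)                                ≤⟨ /-mono-≤ ℤ.∣ ↥ b ∣ 0 (suc ℤ.∣ ↥ b ∣) 0 (ℕ.*-monoˡ-≤ 1 (ℕ.n≤1+n ℤ.∣ ↥ b ∣)) ⟩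
  fromℤ (+ suc ℤ.∣ ↥ b ∣)                            ∎
  where
  b = 1ℚ ℚ.+ ℚ.∣ approx x N ∣
  open ℚ.≤-Reasoning
  open ℚSolver.+-*-Solver using (solve; _:+_; _:-_; _:=_)

_*ᵣ_ : ℝ → ℝ → ℝ
x *ᵣ y = mkℝ (λ m → approx x m ℚ.* approx y m) λ {ε} 0<ε →
  let K , N₁ , bx = eventuallyBounded x
      L , N₂ , by = eventuallyBounded y
      k = fromℤ (+ suc K)
      l = fromℤ (+ suc L)
      δx = ε ℚ.* ½ ℚ.* (+ 1 ℚ./ suc L)
      δy = ε ℚ.* ½ ℚ.* (+ 1 ℚ./ suc K)
      N₃ , f = cauchy x {δx} (*-pos (half-pos 0<ε) (/-pos 0 L))
      N₄ , g = cauchy y {δy} (*-pos (half-pos 0<ε) (/-pos 0 K))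
  in (N₁ ℕ.⊔ N₂) ℕ.⊔ (N₃ ℕ.⊔ N₄) , λ {m} {n} N≤m N≤n →
    let a = approx x m ; b = approx y m ; c = approx x n ; d = approx y n
        left : ∀ {o} → (N₁ ℕ.⊔ N₂) ℕ.⊔ (N₃ ℕ.⊔ N₄) ℕ.≤ o → N₁ ℕ.⊔ N₂ ℕ.≤ o
        left = ℕ.m⊔n≤o⇒m≤o (N₁ ℕ.⊔ N₂) (N₃ ℕ.⊔ N₄)
        right : ∀ {o} → (N₁ ℕ.⊔ N₂) ℕ.⊔ (N₃ ℕ.⊔ N₄) ℕ.≤ o → N₃ ℕ.⊔ N₄ ℕ.≤ o
        right = ℕ.m⊔n≤o⇒n≤o (N₁ ℕ.⊔ N₂) (N₃ ℕ.⊔ N₄)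
    in begin
    ℚ.∣ a ℚ.* b ℚ.- c ℚ.* d ∣                                ≡⟨ cong ℚ.∣_∣ (solve 4 (λ a b c d →
        a :* b :- c :* d := a :* (b :- d) :+ d :* (a :- c)) refl a b c d) ⟩
    ℚ.∣ a ℚ.* (b ℚ.- d) ℚ.+ d ℚ.* (a ℚ.- c) ∣                ≤⟨ ℚ.∣p+q∣≤∣p∣+∣q∣ (a ℚ.* (b ℚ.- d)) (d ℚ.* (a ℚ.- c)) ⟩
    ℚ.∣ a ℚ.* (b ℚ.- d) ∣ ℚ.+ ℚ.∣ d ℚ.* (a ℚ.- c) ∣          ≡⟨ cong₂ ℚ._+_ (ℚ.∣p*q∣≡∣p∣*∣q∣ a (b ℚ.- d)) (ℚ.∣p*q∣≡∣p∣*∣q∣ d (a ℚ.- c)) ⟩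
    ℚ.∣ a ∣ ℚ.* ℚ.∣ b ℚ.- d ∣ ℚ.+ ℚ.∣ d ∣ ℚ.* ℚ.∣ a ℚ.- c ∣  ≤⟨ ℚ.+-mono-≤
        (*-mono-≤-nonNeg (ℚ.0≤∣p∣ a)
          (ℚ.<⇒≤ (*-pos (half-pos 0<ε) (/-pos 0 K)))
          (bx (ℕ.m⊔n≤o⇒m≤o N₁ N₂ (left N≤m)))
          (g (ℕ.m⊔n≤o⇒n≤o N₃ N₄ (right N≤m)) (ℕ.m⊔n≤o⇒n≤o N₃ N₄ (right N≤n))))
        (*-mono-≤-nonNeg (ℚ.0≤∣p∣ d)
          (ℚ.<⇒≤ (*-pos (half-pos 0<ε) (/-pos 0 L)))
          (by (ℕ.m⊔n≤o⇒n≤o N₁ N₂ (left N≤n)))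
          (f (ℕ.m⊔n≤o⇒m≤o N₃ N₄ (right N≤m)) (ℕ.m⊔n≤o⇒m≤o N₃ N₄ (right N≤n)))) ⟩
    k ℚ.* δy ℚ.+ l ℚ.* δx                                    ≡⟨ cong₂ ℚ._+_ (cancel K (ε ℚ.* ½)) (cancel L (ε ℚ.* ½)) ⟩
    ε ℚ.* ½ ℚ.+ ε ℚ.* ½                                      ≡⟨ half+half ε ⟩
    ε                                                        ∎
  where
  open ℚ.≤-Reasoning
  open ℚSolver.+-*-Solver using (solve; _:+_; _:-_; _:*_; _:=_)
  unit : ∀ K → fromℤ (+ suc K) ℚ.* (+ 1 ℚ./ suc K) ≡ 1ℚ
  unit K = ℚ.toℚᵘ-injective
    (ℚᵘ.≃-trans (ℚ.toℚᵘ-homo-* (fromℤ (+ suc K)) (+ 1 ℚ./ suc K))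
    (ℚᵘ.≃-trans (ℚᵘ.*-cong (ℚ.toℚᵘ-fromℚᵘ (mkℚᵘ (+ suc K) 0)) (ℚ.toℚᵘ-fromℚᵘ (mkℚᵘ (+ 1) K)))
      (ℚᵘ.*≡* (cong +_ (swap K)))))
    where
    swap : ∀ K → suc K ℕ.* 1 ℕ.* 1 ≡ 1 ℕ.* (1 ℕ.* suc K)
    swap K = trans (ℕ.*-identityʳ (suc K ℕ.* 1)) (trans (ℕ.*-identityʳ (suc K))
      (sym (trans (ℕ.*-identityˡ (1 ℕ.* suc K)) (ℕ.*-identityˡ (suc K)))))
  cancel : ∀ K p → fromℤ (+ suc K) ℚ.* (p ℚ.* (+ 1 ℚ./ suc K)) ≡ p
  cancel K p = trans
    (solve 3 (λ k p i → k :* (p :* i) := p :* (k :* i)) refl (fromℤ (+ suc K)) p (+ 1 ℚ./ suc K))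
    (trans (cong (p ℚ.*_) (unit K)) (ℚ.*-identityʳ p))

Σᵣ : ∀ {k} → (Fin k → ℝ) → ℝ
Σᵣ = foldr _+ᵣ_ 0ᵣ

-- Distance to the nearest integer.  On ℚ the nearest integer is one of
-- ⌊q⌋ and ⌊q⌋ + 1; ‖_‖ℚ≤ shows that no integer is closer.

‖_‖ℚ : ℚ → ℚ
‖ q ‖ℚ = ℚ.∣ q ℚ.- fromℤ (ℚ.floor q) ∣ ℚ.⊓ ℚ.∣ q ℚ.- fromℤ (ℤ.suc (ℚ.floor q)) ∣

fromℤ-mono-≤ : ∀ {i j} → i ℤ.≤ j → fromℤ i ℚ.≤ fromℤ j
fromℤ-mono-≤ {i} {j} i≤j = ℚ.toℚᵘ-cancel-≤
  (ℚᵘ.≤-respˡ-≃ (ℚᵘ.≃-sym (ℚ.toℚᵘ-fromℚᵘ (mkℚᵘ i 0)))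
    (ℚᵘ.≤-respʳ-≃ (ℚᵘ.≃-sym (ℚ.toℚᵘ-fromℚᵘ (mkℚᵘ j 0)))
      (ℚᵘ.*≤* (ℤ.*-monoʳ-≤-nonNeg (+ 1) i≤j))))

floor-≤ : ∀ q → fromℤ (ℚ.floor q) ℚ.≤ q
floor-≤ q@(mkℚ i d _) = ℚ.toℚᵘ-cancel-≤
  (ℚᵘ.≤-respˡ-≃ (ℚᵘ.≃-sym (ℚ.toℚᵘ-fromℚᵘ (mkℚᵘ (ℚ.floor q) 0)))
    (ℚᵘ.*≤* (subst (ℚ.floor q ℤ.* + suc d ℤ.≤_) (sym (ℤ.*-identityʳ i))
      (ℤ.[n/d]*d≤n i (+ suc d)))))

≤-floor+1 : ∀ q → q ℚ.≤ fromℤ (ℤ.suc (ℚ.floor q))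
≤-floor+1 q@(mkℚ i d _) = ℚ.toℚᵘ-cancel-≤
  (ℚᵘ.≤-respʳ-≃ (ℚᵘ.≃-sym (ℚ.toℚᵘ-fromℚᵘ (mkℚᵘ (ℤ.suc (ℚ.floor q)) 0)))
    (ℚᵘ.*≤* (subst (ℤ._≤ ℤ.suc (ℚ.floor q) ℤ.* + suc d) (sym (ℤ.*-identityʳ i))
      (subst (λ f → i ℤ.≤ ℤ.suc f ℤ.* + suc d) (sym (ℤ.div-pos-is-/ℕ i (suc d)))
        (ℤ.<⇒≤ (ℤ.n<s[n/ℕd]*d i (suc d)))))))

‖_‖ℚ≤ : ∀ q (i : ℤ) → ‖ q ‖ℚ ℚ.≤ ℚ.∣ q ℚ.- fromℤ i ∣
‖ q ‖ℚ≤ i with ℤ.≤-total i (ℚ.floor q)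
... | inj₁ i≤f = ℚ.≤-trans
  (ℚ.p⊓q≤p ℚ.∣ q ℚ.- fromℤ (ℚ.floor q) ∣ ℚ.∣ q ℚ.- fromℤ (ℤ.suc (ℚ.floor q)) ∣)
  (ℚ.≤-trans (ℚ.≤-reflexive (ℚ.0≤p⇒∣p∣≡p (≤⇒0≤- (floor-≤ q))))
    (ℚ.≤-trans (ℚ.+-monoʳ-≤ q (ℚ.neg-antimono-≤ (fromℤ-mono-≤ i≤f)))
      (p≤∣p∣ (q ℚ.- fromℤ i))))
... | inj₂ f≤i with i ℤ.≟ ℚ.floor q
...   | yes refl = ℚ.p⊓q≤p ℚ.∣ q ℚ.- fromℤ (ℚ.floor q) ∣ ℚ.∣ q ℚ.- fromℤ (ℤ.suc (ℚ.floor q)) ∣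
...   | no i≢f = ℚ.≤-trans
  (ℚ.p⊓q≤q ℚ.∣ q ℚ.- fromℤ (ℚ.floor q) ∣ ℚ.∣ q ℚ.- fromℤ (ℤ.suc (ℚ.floor q)) ∣)
  (subst₂ ℚ._≤_ (∣p-q∣-comm f+1 q) (∣p-q∣-comm (fromℤ i) q)
    (ℚ.≤-trans (ℚ.≤-reflexive (ℚ.0≤p⇒∣p∣≡p (≤⇒0≤- (≤-floor+1 q))))
      (ℚ.≤-trans (ℚ.+-monoˡ-≤ (ℚ.- q) (fromℤ-mono-≤ (ℤ.i<j⇒suc[i]≤j (ℤ.≤∧≢⇒< f≤i (i≢f ∘ sym)))))
        (p≤∣p∣ (fromℤ i ℚ.- q)))))
  where f+1 = fromℤ (ℤ.suc (ℚ.floor q))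

‖_‖ℚ-attained : ∀ q → ∃[ i ] ‖ q ‖ℚ ≡ ℚ.∣ q ℚ.- fromℤ i ∣
‖ q ‖ℚ-attained with ℚ.⊓-sel ℚ.∣ q ℚ.- fromℤ (ℚ.floor q) ∣ ℚ.∣ q ℚ.- fromℤ (ℤ.suc (ℚ.floor q)) ∣
... | inj₁ eq = ℚ.floor q , eq
... | inj₂ eq = ℤ.suc (ℚ.floor q) , eq

‖_‖ℚ-lipschitz : ∀ p q → ‖ p ‖ℚ ℚ.≤ ‖ q ‖ℚ ℚ.+ ℚ.∣ p ℚ.- q ∣
‖ p ‖ℚ-lipschitz q with ‖ q ‖ℚ-attained
... | i , eq = begin
  ‖ p ‖ℚ                                      ≤⟨ ‖ p ‖ℚ≤ i ⟩
  ℚ.∣ p ℚ.- fromℤ i ∣                          ≡⟨ cong ℚ.∣_∣ (solve 3 (λ p q i → p :- i := (q :- i) :+ (p :- q)) refl p q (fromℤ i)) ⟩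
  ℚ.∣ (q ℚ.- fromℤ i) ℚ.+ (p ℚ.- q) ∣          ≤⟨ ℚ.∣p+q∣≤∣p∣+∣q∣ (q ℚ.- fromℤ i) (p ℚ.- q) ⟩
  ℚ.∣ q ℚ.- fromℤ i ∣ ℚ.+ ℚ.∣ p ℚ.- q ∣        ≡⟨ cong (ℚ._+ ℚ.∣ p ℚ.- q ∣) eq ⟨
  ‖ q ‖ℚ ℚ.+ ℚ.∣ p ℚ.- q ∣                    ∎
  where open ℚ.≤-Reasoning
        open ℚSolver.+-*-Solver using (solve; _:+_; _:-_; _:=_)

-- ‖_‖ℚ is 1-Lipschitz, so it extends to ℝ termwise.

‖_‖ : ℝ → ℝ
‖ x ‖ = mkℝ (λ m → ‖ approx x m ‖ℚ) (oneSided λ 0<ε →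
  let N , f = cauchy x 0<ε in N , λ {m} {n} N≤m N≤n →
  ℚ.≤-trans (‖ approx x m ‖ℚ-lipschitz (approx x n)) (ℚ.+-monoʳ-≤ ‖ approx x n ‖ℚ (f N≤m N≤n)))

∣_∣ᵣ : ℝ → ℝ
∣ x ∣ᵣ = mkℝ (λ m → ℚ.∣ approx x m ∣) (oneSided λ 0<ε →
  let N , f = cauchy x 0<ε in N , λ {m} {n} N≤m N≤n →
  ℚ.≤-trans (shift (approx x m) (approx x n)) (ℚ.+-monoʳ-≤ ℚ.∣ approx x n ∣ (f N≤m N≤n)))
  where
  open ℚSolver.+-*-Solver
  shift : ∀ p q → ℚ.∣ p ∣ ℚ.≤ ℚ.∣ q ∣ ℚ.+ ℚ.∣ p ℚ.- q ∣
  shift p q = subst (λ z → ℚ.∣ z ∣ ℚ.≤ ℚ.∣ q ∣ ℚ.+ ℚ.∣ p ℚ.- q ∣)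
    (solve 2 (λ p q → q :+ (p :- q) := p) refl p q) (ℚ.∣p+q∣≤∣p∣+∣q∣ q (p ℚ.- q))

fromℤᵣ : ℤ → ℝ
fromℤᵣ i = fromℚ (fromℤ i)

-- ‖ x ‖ is the infimum of ∣ x - i ∣ over the integers i.  Attainment of the
-- minimum is not stated: which of two nearly equidistant integers is the
-- nearer one cannot be decided from approximations.

‖_‖-lower : ∀ x i → ‖ x ‖ ≤ᵣ ∣ x +ᵣ -ᵣ fromℤᵣ i ∣ᵣ
‖ x ‖-lower i {ε} 0<ε = 0 , λ {m} _ → ℚ.≤-trans (‖ approx x m ‖ℚ≤ i)
  (subst (ℚ._≤ d m ℚ.+ ε) (ℚ.+-identityʳ (d m)) (ℚ.+-monoʳ-≤ (d m) (ℚ.<⇒≤ 0<ε)))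
  where d = λ m → ℚ.∣ approx x m ℚ.- fromℤ i ∣

‖_‖-greatest : ∀ x {ε} → 0ℚ ℚ.< ε → ∃[ i ] ∣ x +ᵣ -ᵣ fromℤᵣ i ∣ᵣ ≤ᵣ ‖ x ‖ +ᵣ fromℚ ε
‖ x ‖-greatest {ε} 0<ε with cauchy x (half-pos 0<ε)
... | N , f with ‖ approx x N ‖ℚ-attained
...   | i , eq = i , λ {δ} 0<δ → N , λ {m} N≤m →
  let p = approx x m ; q = approx x N in begin
  ℚ.∣ p ℚ.- fromℤ i ∣                                  ≡⟨ cong ℚ.∣_∣ (solve 3 (λ p q i → p :- i := (q :- i) :+ (p :- q)) refl p q (fromℤ i)) ⟩
  ℚ.∣ (q ℚ.- fromℤ i) ℚ.+ (p ℚ.- q) ∣                  ≤⟨ ℚ.∣p+q∣≤∣p∣+∣q∣ (q ℚ.- fromℤ i) (p ℚ.- q) ⟩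
  ℚ.∣ q ℚ.- fromℤ i ∣ ℚ.+ ℚ.∣ p ℚ.- q ∣                ≡⟨ cong (ℚ._+ ℚ.∣ p ℚ.- q ∣) eq ⟨
  ‖ q ‖ℚ ℚ.+ ℚ.∣ p ℚ.- q ∣                             ≤⟨ ℚ.+-mono-≤ (‖ q ‖ℚ-lipschitz p) (f N≤m ℕ.≤-refl) ⟩
  (‖ p ‖ℚ ℚ.+ ℚ.∣ q ℚ.- p ∣) ℚ.+ ε ℚ.* ½               ≤⟨ ℚ.+-monoˡ-≤ (ε ℚ.* ½) (ℚ.+-monoʳ-≤ ‖ p ‖ℚ (f ℕ.≤-refl N≤m)) ⟩
  (‖ p ‖ℚ ℚ.+ ε ℚ.* ½) ℚ.+ ε ℚ.* ½                     ≡⟨ trans (ℚ.+-assoc ‖ p ‖ℚ (ε ℚ.* ½) (ε ℚ.* ½)) (cong (‖ p ‖ℚ ℚ.+_) (half+half ε)) ⟩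
  ‖ p ‖ℚ ℚ.+ ε                                         ≡⟨ ℚ.+-identityʳ (‖ p ‖ℚ ℚ.+ ε) ⟨
  (‖ p ‖ℚ ℚ.+ ε) ℚ.+ 0ℚ                                ≤⟨ ℚ.+-monoʳ-≤ (‖ p ‖ℚ ℚ.+ ε) (ℚ.<⇒≤ 0<δ) ⟩
  (‖ p ‖ℚ ℚ.+ ε) ℚ.+ δ                                 ∎
  where open ℚ.≤-Reasoning
        open ℚSolver.+-*-Solver using (solve; _:+_; _:-_; _:=_)

-- floorRoot q u v is the largest j with j ^ q * v ≤ u, that is,
-- ⌊ (u / v) ^ (1 / q) ⌋, for positive q and v.

largest : ∀ {P : ℕ → Set} → Decidable P → ℕ → ℕ
largest P? zero = zero
largest P? (suc b) with P? (suc b)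
... | yes _ = suc b
... | no  _ = largest P? b

largest-sat : ∀ {P : ℕ → Set} (P? : Decidable P) b → P 0 → P (largest P? b)
largest-sat P? zero p0 = p0
largest-sat P? (suc b) p0 with P? (suc b)
... | yes p = p
... | no  _ = largest-sat P? b p0

largest-max : ∀ {P : ℕ → Set} (P? : Decidable P) b {j} → j ℕ.≤ b → P j → j ℕ.≤ largest P? b
largest-max P? zero j≤b _ = j≤b
largest-max P? (suc b) {j} j≤b pj with P? (suc b)
... | yes _ = j≤b
... | no ¬p with j ℕ.≟ suc b
...   | yes refl = ⊥-elim (¬p pj)
...   | no j≢ = largest-max P? b (ℕ.≤-pred (ℕ.≤∧≢⇒< j≤b j≢)) pj

floorRoot : (q u v : ℕ) → ℕ
floorRoot q u v = largest (λ j → j ℕ.^ q ℕ.* v ℕ.≤? u) u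

floorRoot-lower : ∀ q .{{_ : NonZero q}} u v → floorRoot q u v ℕ.^ q ℕ.* v ℕ.≤ u
floorRoot-lower (suc q) u v = largest-sat (λ j → j ℕ.^ suc q ℕ.* v ℕ.≤? u) u z≤n

m≤m^q : ∀ m q .{{_ : NonZero q}} → m ℕ.≤ m ℕ.^ q
m≤m^q zero q = z≤n
m≤m^q (suc m) (suc q) = ℕ.m≤m*n (suc m) (suc m ℕ.^ q) {{ℕ.m^n≢0 (suc m) q}}

floorRoot-upper : ∀ q .{{_ : NonZero q}} u v .{{_ : NonZero v}} →
                  u ℕ.< suc (floorRoot q u v) ℕ.^ q ℕ.* v
floorRoot-upper q u v = ℕ.≰⇒> λ h → ℕ.<-irrefl refl
  (largest-max (λ j → j ℕ.^ q ℕ.* v ℕ.≤? u) u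
    (ℕ.≤-trans (m≤m^q (suc (floorRoot q u v)) q) (ℕ.≤-trans (ℕ.m≤m*n _ v) h)) h)

^-distribʳ-* : ∀ q m n → (m ℕ.* n) ℕ.^ q ≡ m ℕ.^ q ℕ.* n ℕ.^ q
^-distribʳ-* zero m n = refl
^-distribʳ-* (suc q) m n = trans (cong (m ℕ.* n ℕ.*_) (^-distribʳ-* q m n))
  (ℕ.[m*n]*[o*p]≡[m*o]*[n*p] m n (m ℕ.^ q) (n ℕ.^ q))

^-cancel-≤ : ∀ q .{{_ : NonZero q}} {m n} → m ℕ.^ q ℕ.≤ n ℕ.^ q → m ℕ.≤ n
^-cancel-≤ q {m} {n} h with m ℕ.≤? n
... | yes m≤n = m≤n
... | no m≰n = ⊥-elim (ℕ.<-irrefl refl (ℕ.<-≤-trans (ℕ.^-monoˡ-< q (ℕ.≰⇒> m≰n)) h))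

-- q-th roots of natural numbers: the m-th approximation is
-- ⌊ a ^ (1 / q) * M ⌋ / M with M = m + 1.

module _ (q : ℕ) .{{_ : NonZero q}} (a : ℕ) where

  rootNumerator : ℕ → ℕ
  rootNumerator m = floorRoot q (a ℕ.* suc m ℕ.^ q) 1

  rootNumerator-≤ : ∀ m n → rootNumerator m ℕ.* suc n ℕ.≤ suc (rootNumerator n) ℕ.* suc m
  rootNumerator-≤ m n = ^-cancel-≤ q (begin
    (rootNumerator m ℕ.* suc n) ℕ.^ q          ≡⟨ ^-distribʳ-* q (rootNumerator m) (suc n) ⟩
    rootNumerator m ℕ.^ q ℕ.* suc n ℕ.^ q      ≤⟨ ℕ.*-monoˡ-≤ (suc n ℕ.^ q) lower ⟩
    a ℕ.* suc m ℕ.^ q ℕ.* suc n ℕ.^ q          ≡⟨ solve 3 (λ a m n → a :* m :* n := (a :* n) :* m) refl a (suc m ℕ.^ q) (suc n ℕ.^ q) ⟩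
    a ℕ.* suc n ℕ.^ q ℕ.* suc m ℕ.^ q          ≤⟨ ℕ.*-monoˡ-≤ (suc m ℕ.^ q) upper ⟩
    suc (rootNumerator n) ℕ.^ q ℕ.* suc m ℕ.^ q ≡⟨ ^-distribʳ-* q (suc (rootNumerator n)) (suc m) ⟨
    (suc (rootNumerator n) ℕ.* suc m) ℕ.^ q    ∎)
    where
    open ℕ.≤-Reasoning
    open ℕSolver.+-*-Solver using (solve; _:*_; _:=_)
    lower : rootNumerator m ℕ.^ q ℕ.≤ a ℕ.* suc m ℕ.^ q
    lower = subst (ℕ._≤ a ℕ.* suc m ℕ.^ q) (ℕ.*-identityʳ _)
      (floorRoot-lower q (a ℕ.* suc m ℕ.^ q) 1)
    upper : a ℕ.* suc n ℕ.^ q ℕ.≤ suc (rootNumerator n) ℕ.^ q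
    upper = ℕ.<⇒≤ (subst (a ℕ.* suc n ℕ.^ q ℕ.<_) (ℕ.*-identityʳ _)
      (floorRoot-upper q (a ℕ.* suc n ℕ.^ q) 1))

  root : ℝ
  root = mkℝ (λ m → + rootNumerator m ℚ./ suc m) (oneSided λ {ε} 0<ε →
    let t , h = archimedean 1 0<ε in t , λ {m} {n} _ t≤n →
    ℚ.≤-trans (/-mono-≤ (rootNumerator m) m (suc (rootNumerator n)) n (rootNumerator-≤ m n))
      (ℚ.≤-trans (suc/-split (rootNumerator n) n)
        (ℚ.+-monoʳ-≤ (+ rootNumerator n ℚ./ suc n)
          (ℚ.≤-trans (/-mono-≤ 1 n 1 t (ℕ.*-monoʳ-≤ 1 (s≤s t≤n))) h))))

√ : ℕ → ℝ
√ = root 2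

∛ : ℕ → ℝ
∛ = root 3

posPart negPart : ℤ → ℕ
posPart (+ n)    = n
posPart -[1+ n ] = 0
negPart (+ n)    = 0
negPart -[1+ n ] = suc n

posPart-negPart : ∀ i → i ≡ + posPart i ℤ.- + negPart i
posPart-negPart (+ n)    = sym (ℤ.+-identityʳ (+ n))
posPart-negPart -[1+ n ] = refl

-- ⌊ n ^ r * M ⌋ with M = m + 1, where n ^ r is the positive q-th root of
-- n ^ p for r = p / q; a negative p is moved to the denominator v.

powNumerator : ℕ → ℚ → ℕ → ℕ
powNumerator n r m =
  floorRoot (↧ₙ r) (n ℕ.^ posPart (↥ r) ℕ.* suc m ℕ.^ ↧ₙ r) (n ℕ.^ negPart (↥ r))

bernoulli : ∀ n t s → (s ℕ.* n ℕ.+ t) ℕ.* t ℕ.^ s ℕ.≤ t ℕ.* (t ℕ.+ n) ℕ.^ s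
bernoulli n t zero = ℕ.≤-refl
bernoulli n t (suc s) = begin
  (suc s ℕ.* n ℕ.+ t) ℕ.* (t ℕ.* t ℕ.^ s)                        ≤⟨ ℕ.m≤m+n _ (s ℕ.* n ℕ.* n ℕ.* t ℕ.^ s) ⟩
  (suc s ℕ.* n ℕ.+ t) ℕ.* (t ℕ.* t ℕ.^ s) ℕ.+ s ℕ.* n ℕ.* n ℕ.* t ℕ.^ s
    ≡⟨ solve 4 (λ s n t p → ((con 1 :+ s) :* n :+ t) :* (t :* p) :+ s :* n :* n :* p
         := (t :+ n) :* ((s :* n :+ t) :* p)) refl s n t (t ℕ.^ s) ⟩
  (t ℕ.+ n) ℕ.* ((s ℕ.* n ℕ.+ t) ℕ.* t ℕ.^ s)                    ≤⟨ ℕ.*-monoʳ-≤ (t ℕ.+ n) (bernoulli n t s) ⟩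
  (t ℕ.+ n) ℕ.* (t ℕ.* (t ℕ.+ n) ℕ.^ s)                          ≡⟨ solve 3 (λ a t p → a :* (t :* p) := t :* (a :* p)) refl (t ℕ.+ n) t ((t ℕ.+ n) ℕ.^ s) ⟩
  t ℕ.* ((t ℕ.+ n) ℕ.* (t ℕ.+ n) ℕ.^ s)                          ∎
  where open ℕ.≤-Reasoning
        open ℕSolver.+-*-Solver using (solve; con; _:+_; _:*_; _:=_)

-- n ^ (1 / t) ≤ (t + n) / t.

root-≤ : ∀ n t .{{_ : NonZero t}} → n ℕ.* t ℕ.^ t ℕ.≤ (t ℕ.+ n) ℕ.^ t
root-≤ n t = ℕ.*-cancelˡ-≤ t (begin
  t ℕ.* (n ℕ.* t ℕ.^ t)               ≡⟨ ℕ.*-assoc t n (t ℕ.^ t) ⟨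
  t ℕ.* n ℕ.* t ℕ.^ t                 ≤⟨ ℕ.*-monoˡ-≤ (t ℕ.^ t) (ℕ.m≤m+n (t ℕ.* n) t) ⟩
  (t ℕ.* n ℕ.+ t) ℕ.* t ℕ.^ t         ≤⟨ bernoulli n t t ⟩
  t ℕ.* (t ℕ.+ n) ℕ.^ t               ∎)
  where open ℕ.≤-Reasoning

-- If (a₂ - b₂) / q₂ ≤ (a₁ - b₁) / q₁ + 1 / t then
-- n ^ ((a₂ - b₂) / q₂) ≤ n ^ ((a₁ - b₁) / q₁) * (t + n) / t, for j / M in
-- place of the left-hand power and k / L in place of the right-hand one.

pow-compare : ∀ n .{{_ : NonZero n}} t .{{_ : NonZero t}}
  {a₁ b₁ a₂ b₂} q₁ .{{_ : NonZero q₁}} q₂ .{{_ : NonZero q₂}} {j k M L} →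
  j ℕ.^ q₂ ℕ.* n ℕ.^ b₂ ℕ.≤ n ℕ.^ a₂ ℕ.* M ℕ.^ q₂ →
  n ℕ.^ a₁ ℕ.* L ℕ.^ q₁ ℕ.≤ k ℕ.^ q₁ ℕ.* n ℕ.^ b₁ →
  a₂ ℕ.* (q₁ ℕ.* t) ℕ.+ b₁ ℕ.* (q₂ ℕ.* t) ℕ.≤
    a₁ ℕ.* (q₂ ℕ.* t) ℕ.+ b₂ ℕ.* (q₁ ℕ.* t) ℕ.+ q₁ ℕ.* q₂ →
  j ℕ.* L ℕ.* t ℕ.≤ k ℕ.* M ℕ.* (t ℕ.+ n)
pow-compare n t {a₁} {b₁} {a₂} {b₂} q₁ q₂ {j} {k} {M} {L} hj hk hexp =
  ^-cancel-≤ N {{ℕ.m*n≢0 (q₁ ℕ.* q₂) t {{ℕ.m*n≢0 q₁ q₂}}}}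
    (ℕ.*-cancelʳ-≤ _ _ W {{W≢0}} (begin
    (j ℕ.* L ℕ.* t) ℕ.^ N ℕ.* W
      ≡⟨ cong (ℕ._* W) (cube j L t) ⟩
    j ℕ.^ N ℕ.* L ℕ.^ N ℕ.* t ℕ.^ N ℕ.* W
      ≡⟨ solve 5 (λ j l t x y → j :* l :* t :* (x :* y) := (j :* x) :* (l :* y) :* t) refl
           (j ℕ.^ N) (L ℕ.^ N) (t ℕ.^ N) (n ℕ.^ (b₂ ℕ.* e₁)) (n ℕ.^ (b₁ ℕ.* e₂)) ⟩
    (j ℕ.^ N ℕ.* n ℕ.^ (b₂ ℕ.* e₁)) ℕ.* (L ℕ.^ N ℕ.* n ℕ.^ (b₁ ℕ.* e₂)) ℕ.* t ℕ.^ N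
      ≡⟨ cong (λ z → z ℕ.* (L ℕ.^ N ℕ.* n ℕ.^ (b₁ ℕ.* e₂)) ℕ.* t ℕ.^ N) (split₁ j b₂) ⟨
    (j ℕ.^ q₂ ℕ.* n ℕ.^ b₂) ℕ.^ e₁ ℕ.* (L ℕ.^ N ℕ.* n ℕ.^ (b₁ ℕ.* e₂)) ℕ.* t ℕ.^ N
      ≤⟨ ℕ.*-monoˡ-≤ (t ℕ.^ N) (ℕ.*-monoˡ-≤ (L ℕ.^ N ℕ.* n ℕ.^ (b₁ ℕ.* e₂)) (ℕ.^-monoˡ-≤ e₁ hj)) ⟩
    (n ℕ.^ a₂ ℕ.* M ℕ.^ q₂) ℕ.^ e₁ ℕ.* (L ℕ.^ N ℕ.* n ℕ.^ (b₁ ℕ.* e₂)) ℕ.* t ℕ.^ N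
      ≡⟨ cong (λ z → z ℕ.* (L ℕ.^ N ℕ.* n ℕ.^ (b₁ ℕ.* e₂)) ℕ.* t ℕ.^ N)
           (trans (cong (ℕ._^ e₁) (ℕ.*-comm (n ℕ.^ a₂) (M ℕ.^ q₂))) (split₁ M a₂)) ⟩
    (M ℕ.^ N ℕ.* n ℕ.^ (a₂ ℕ.* e₁)) ℕ.* (L ℕ.^ N ℕ.* n ℕ.^ (b₁ ℕ.* e₂)) ℕ.* t ℕ.^ N
      ≡⟨ solve 5 (λ m x l y t → (m :* x) :* (l :* y) :* t := (x :* y) :* (m :* l :* t)) refl
           (M ℕ.^ N) (n ℕ.^ (a₂ ℕ.* e₁)) (L ℕ.^ N) (n ℕ.^ (b₁ ℕ.* e₂)) (t ℕ.^ N) ⟩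
    (n ℕ.^ (a₂ ℕ.* e₁) ℕ.* n ℕ.^ (b₁ ℕ.* e₂)) ℕ.* rest
      ≡⟨ cong (ℕ._* rest) (ℕ.^-distribˡ-+-* n (a₂ ℕ.* e₁) (b₁ ℕ.* e₂)) ⟨
    n ℕ.^ (a₂ ℕ.* e₁ ℕ.+ b₁ ℕ.* e₂) ℕ.* rest
      ≤⟨ ℕ.*-monoˡ-≤ rest (ℕ.^-monoʳ-≤ n hexp) ⟩
    n ℕ.^ (a₁ ℕ.* e₂ ℕ.+ b₂ ℕ.* e₁ ℕ.+ e₃) ℕ.* rest
      ≡⟨ cong (ℕ._* rest) (trans (ℕ.^-distribˡ-+-* n (a₁ ℕ.* e₂ ℕ.+ b₂ ℕ.* e₁) e₃)
           (cong (ℕ._* n ℕ.^ e₃) (ℕ.^-distribˡ-+-* n (a₁ ℕ.* e₂) (b₂ ℕ.* e₁)))) ⟩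
    (n ℕ.^ (a₁ ℕ.* e₂) ℕ.* n ℕ.^ (b₂ ℕ.* e₁) ℕ.* n ℕ.^ e₃) ℕ.* rest
      ≡⟨ solve 6 (λ x y z m l t → (x :* y :* z) :* (m :* l :* t) := (l :* x) :* (m :* y) :* (z :* t)) refl
           (n ℕ.^ (a₁ ℕ.* e₂)) (n ℕ.^ (b₂ ℕ.* e₁)) (n ℕ.^ e₃) (M ℕ.^ N) (L ℕ.^ N) (t ℕ.^ N) ⟩
    (L ℕ.^ N ℕ.* n ℕ.^ (a₁ ℕ.* e₂)) ℕ.* (M ℕ.^ N ℕ.* n ℕ.^ (b₂ ℕ.* e₁)) ℕ.* (n ℕ.^ e₃ ℕ.* t ℕ.^ N)
      ≤⟨ ℕ.*-mono-≤ (ℕ.*-monoˡ-≤ (M ℕ.^ N ℕ.* n ℕ.^ (b₂ ℕ.* e₁)) kstep) tstep ⟩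
    (k ℕ.^ N ℕ.* n ℕ.^ (b₁ ℕ.* e₂)) ℕ.* (M ℕ.^ N ℕ.* n ℕ.^ (b₂ ℕ.* e₁)) ℕ.* (t ℕ.+ n) ℕ.^ N
      ≡⟨ solve 5 (λ k x m y t → (k :* x) :* (m :* y) :* t := k :* m :* t :* (y :* x)) refl
           (k ℕ.^ N) (n ℕ.^ (b₁ ℕ.* e₂)) (M ℕ.^ N) (n ℕ.^ (b₂ ℕ.* e₁)) ((t ℕ.+ n) ℕ.^ N) ⟩
    k ℕ.^ N ℕ.* M ℕ.^ N ℕ.* (t ℕ.+ n) ℕ.^ N ℕ.* W
      ≡⟨ cong (ℕ._* W) (cube k M (t ℕ.+ n)) ⟨
    (k ℕ.* M ℕ.* (t ℕ.+ n)) ℕ.^ N ℕ.* W ∎))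
  where
  open ℕ.≤-Reasoning
  open ℕSolver.+-*-Solver using (solve; _:+_; _:*_; _:=_)
  e₁ = q₁ ℕ.* t
  e₂ = q₂ ℕ.* t
  e₃ = q₁ ℕ.* q₂
  N = q₁ ℕ.* q₂ ℕ.* t
  W = n ℕ.^ (b₂ ℕ.* e₁) ℕ.* n ℕ.^ (b₁ ℕ.* e₂)
  rest = M ℕ.^ N ℕ.* L ℕ.^ N ℕ.* t ℕ.^ N
  W≢0 : NonZero W
  W≢0 = ℕ.m*n≢0 _ _ {{ℕ.m^n≢0 n (b₂ ℕ.* e₁)}} {{ℕ.m^n≢0 n (b₁ ℕ.* e₂)}}
  cube : ∀ x y z → (x ℕ.* y ℕ.* z) ℕ.^ N ≡ x ℕ.^ N ℕ.* y ℕ.^ N ℕ.* z ℕ.^ N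
  cube x y z = trans (^-distribʳ-* N (x ℕ.* y) z) (cong (ℕ._* z ℕ.^ N) (^-distribʳ-* N x y))
  split : ∀ q e → q ℕ.* e ≡ N → ∀ x b →
          (x ℕ.^ q ℕ.* n ℕ.^ b) ℕ.^ e ≡ x ℕ.^ N ℕ.* n ℕ.^ (b ℕ.* e)
  split q e qe x b = trans (^-distribʳ-* e (x ℕ.^ q) (n ℕ.^ b))
    (cong₂ ℕ._*_ (trans (ℕ.^-*-assoc x q e) (cong (x ℕ.^_) qe)) (ℕ.^-*-assoc n b e))
  split₁ = split q₂ e₁ (solve 3 (λ p q t → q :* (p :* t) := p :* q :* t) refl q₁ q₂ t)
  split₂ = split q₁ e₂ (sym (ℕ.*-assoc q₁ q₂ t))
  kstep : L ℕ.^ N ℕ.* n ℕ.^ (a₁ ℕ.* e₂) ℕ.≤ k ℕ.^ N ℕ.* n ℕ.^ (b₁ ℕ.* e₂)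
  kstep = subst₂ ℕ._≤_
    (trans (cong (ℕ._^ e₂) (ℕ.*-comm (n ℕ.^ a₁) (L ℕ.^ q₁))) (split₂ L a₁)) (split₂ k b₁)
    (ℕ.^-monoˡ-≤ e₂ hk)
  tstep : n ℕ.^ e₃ ℕ.* t ℕ.^ N ℕ.≤ (t ℕ.+ n) ℕ.^ N
  tstep = subst₂ ℕ._≤_
    (trans (^-distribʳ-* e₃ n (t ℕ.^ t)) (cong (n ℕ.^ e₃ ℕ.*_) (tpow t))) (tpow (t ℕ.+ n))
    (ℕ.^-monoˡ-≤ e₃ (root-≤ n t))
    where
    tpow : ∀ x → (x ℕ.^ t) ℕ.^ e₃ ≡ x ℕ.^ N
    tpow x = trans (ℕ.^-*-assoc x t e₃) (cong (x ℕ.^_) (ℕ.*-comm t e₃))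

exponent-≤ : ∀ r₁ r₂ t → r₂ ℚ.≤ r₁ ℚ.+ + 1 ℚ./ suc t →
  posPart (↥ r₂) ℕ.* (↧ₙ r₁ ℕ.* suc t) ℕ.+ negPart (↥ r₁) ℕ.* (↧ₙ r₂ ℕ.* suc t) ℕ.≤
  posPart (↥ r₁) ℕ.* (↧ₙ r₂ ℕ.* suc t) ℕ.+ negPart (↥ r₂) ℕ.* (↧ₙ r₁ ℕ.* suc t)
    ℕ.+ ↧ₙ r₁ ℕ.* ↧ₙ r₂
exponent-≤ r₁@(mkℚ i₁ d₁ _) r₂@(mkℚ i₂ d₂ _) t h = ℤ.drop‿+≤+ (subst₂ ℤ._≤_ lhs rhs
    (ℤ.+-monoˡ-≤ (b₂ ℤ.* (q₁ ℤ.* T) ℤ.+ b₁ ℤ.* (q₂ ℤ.* T)) cross))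
  where
  open ℤSolver.+-*-Solver
  a₁ = + posPart i₁
  b₁ = + negPart i₁
  a₂ = + posPart i₂
  b₂ = + negPart i₂
  q₁ = + suc d₁
  q₂ = + suc d₂
  T = + suc t
  cross : i₂ ℤ.* (q₁ ℤ.* T) ℤ.≤ (i₁ ℤ.* T ℤ.+ + 1 ℤ.* q₁) ℤ.* q₂
  cross = subst (λ z → i₂ ℤ.* z ℤ.≤ (i₁ ℤ.* T ℤ.+ + 1 ℤ.* q₁) ℤ.* q₂) (ℤ.pos-* (suc d₁) (suc t))
    (ℚᵘ.drop-*≤* (ℚᵘ.≤-respʳ-≃
      (ℚᵘ.≃-trans (ℚ.toℚᵘ-homo-+ r₁ (+ 1 ℚ./ suc t))
        (ℚᵘ.+-congʳ (mkℚᵘ i₁ d₁) (ℚ.toℚᵘ-fromℚᵘ (mkℚᵘ (+ 1) t))))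
      (ℚ.toℚᵘ-mono-≤ h)))
  pos-*-* : ∀ x y z → + (x ℕ.* (y ℕ.* z)) ≡ + x ℤ.* (+ y ℤ.* + z)
  pos-*-* x y z = trans (ℤ.pos-* x (y ℕ.* z)) (cong (+ x ℤ.*_) (ℤ.pos-* y z))
  lhs : i₂ ℤ.* (q₁ ℤ.* T) ℤ.+ (b₂ ℤ.* (q₁ ℤ.* T) ℤ.+ b₁ ℤ.* (q₂ ℤ.* T)) ≡
        + (posPart i₂ ℕ.* (suc d₁ ℕ.* suc t) ℕ.+ negPart i₁ ℕ.* (suc d₂ ℕ.* suc t))
  lhs = trans (cong (λ i → i ℤ.* (q₁ ℤ.* T) ℤ.+ (b₂ ℤ.* (q₁ ℤ.* T) ℤ.+ b₁ ℤ.* (q₂ ℤ.* T)))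
                (posPart-negPart i₂))
    (trans (solve 5 (λ a b x c y → (a :- b) :* x :+ (b :* x :+ c :* y) := a :* x :+ c :* y) refl
             a₂ b₂ (q₁ ℤ.* T) b₁ (q₂ ℤ.* T))
      (sym (cong₂ ℤ._+_ (pos-*-* (posPart i₂) (suc d₁) (suc t)) (pos-*-* (negPart i₁) (suc d₂) (suc t)))))
  rhs : (i₁ ℤ.* T ℤ.+ + 1 ℤ.* q₁) ℤ.* q₂ ℤ.+ (b₂ ℤ.* (q₁ ℤ.* T) ℤ.+ b₁ ℤ.* (q₂ ℤ.* T)) ≡
        + (posPart i₁ ℕ.* (suc d₂ ℕ.* suc t) ℕ.+ negPart i₂ ℕ.* (suc d₁ ℕ.* suc t)
           ℕ.+ suc d₁ ℕ.* suc d₂)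
  rhs = trans (cong (λ i → (i ℤ.* T ℤ.+ + 1 ℤ.* q₁) ℤ.* q₂ ℤ.+
                           (b₂ ℤ.* (q₁ ℤ.* T) ℤ.+ b₁ ℤ.* (q₂ ℤ.* T))) (posPart-negPart i₁))
    (trans (solve 6 (λ a b q p T c →
             ((a :- b) :* T :+ con (+ 1) :* q) :* p :+ (c :* (q :* T) :+ b :* (p :* T))
             := a :* (p :* T) :+ c :* (q :* T) :+ q :* p) refl a₁ b₁ q₁ q₂ T b₂)
      (sym (cong₂ ℤ._+_
        (cong₂ ℤ._+_ (pos-*-* (posPart i₁) (suc d₂) (suc t)) (pos-*-* (negPart i₂) (suc d₁) (suc t)))
        (ℤ.pos-* (suc d₁) (suc d₂)))))

posPart-≤ : ∀ r B → r ℚ.≤ fromℤ (+ B) → posPart (↥ r) ℕ.≤ B ℕ.* ↧ₙ r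
posPart-≤ (mkℚ -[1+ n ] d _) B h = z≤n
posPart-≤ (mkℚ (+ n) d _) B h = ℤ.drop‿+≤+ (subst₂ ℤ._≤_ (ℤ.*-identityʳ (+ n)) (sym (ℤ.pos-* B (suc d)))
  (ℚᵘ.drop-*≤* (ℚᵘ.≤-respʳ-≃ (ℚ.toℚᵘ-fromℚᵘ (mkℚᵘ (+ B) 0)) (ℚ.toℚᵘ-mono-≤ h))))

module _ (n : ℕ) .{{_ : NonZero n}} where

  powNumerator-bound : ∀ r B m → r ℚ.≤ fromℤ (+ B) → powNumerator n r m ℕ.≤ n ℕ.^ B ℕ.* suc m
  powNumerator-bound r B m r≤B = ^-cancel-≤ (↧ₙ r) (begin
    j ℕ.^ ↧ₙ r                                        ≤⟨ ℕ.m≤m*n (j ℕ.^ ↧ₙ r) v {{ℕ.m^n≢0 n (negPart (↥ r))}} ⟩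
    j ℕ.^ ↧ₙ r ℕ.* v                                  ≤⟨ floorRoot-lower (↧ₙ r) _ v ⟩
    n ℕ.^ posPart (↥ r) ℕ.* suc m ℕ.^ ↧ₙ r            ≤⟨ ℕ.*-monoˡ-≤ (suc m ℕ.^ ↧ₙ r) (ℕ.^-monoʳ-≤ n (posPart-≤ r B r≤B)) ⟩
    n ℕ.^ (B ℕ.* ↧ₙ r) ℕ.* suc m ℕ.^ ↧ₙ r             ≡⟨ cong (ℕ._* suc m ℕ.^ ↧ₙ r) (ℕ.^-*-assoc n B (↧ₙ r)) ⟨
    (n ℕ.^ B) ℕ.^ ↧ₙ r ℕ.* suc m ℕ.^ ↧ₙ r             ≡⟨ ^-distribʳ-* (↧ₙ r) (n ℕ.^ B) (suc m) ⟨
    (n ℕ.^ B ℕ.* suc m) ℕ.^ ↧ₙ r                      ∎)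
    where
    open ℕ.≤-Reasoning
    j = powNumerator n r m
    v = n ℕ.^ negPart (↥ r)

  powNumerator-≤ : ∀ r₁ r₂ B t l m → r₂ ℚ.≤ r₁ ℚ.+ + 1 ℚ./ suc t → r₁ ℚ.≤ fromℤ (+ B) →
    + powNumerator n r₂ m ℚ./ suc m ℚ.≤
    + suc (powNumerator n r₁ l) ℚ./ suc l ℚ.+ + (suc (n ℕ.^ B) ℕ.* n) ℚ./ suc t
  powNumerator-≤ r₁ r₂ B t l m r₂≤ r₁≤B = /-≤-sum j m (suc k) l (suc (n ℕ.^ B) ℕ.* n) t (begin
    j ℕ.* (suc l ℕ.* suc t)                                 ≡⟨ ℕ.*-assoc j (suc l) (suc t) ⟨
    j ℕ.* suc l ℕ.* suc t                                   ≤⟨ pow-compare n (suc t) {a₁} {b₁} {a₂} {b₂} (↧ₙ r₁) (↧ₙ r₂)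
                                                                 {j} {suc k} {suc m} {suc l}
                                                                 (floorRoot-lower (↧ₙ r₂) (n ℕ.^ a₂ ℕ.* suc m ℕ.^ ↧ₙ r₂) (n ℕ.^ b₂))
                                                                 (ℕ.<⇒≤ (floorRoot-upper (↧ₙ r₁) (n ℕ.^ a₁ ℕ.* suc l ℕ.^ ↧ₙ r₁) (n ℕ.^ b₁) {{ℕ.m^n≢0 n b₁}}))
                                                                 (exponent-≤ r₁ r₂ t r₂≤) ⟩
    suc k ℕ.* suc m ℕ.* (suc t ℕ.+ n)                       ≡⟨ solve 4 (λ k m t n → k :* m :* (t :+ n) := (k :* t :+ k :* n) :* m) refl (suc k) (suc m) (suc t) n ⟩
    (suc k ℕ.* suc t ℕ.+ suc k ℕ.* n) ℕ.* suc m             ≤⟨ ℕ.*-monoˡ-≤ (suc m) (ℕ.+-monoʳ-≤ (suc k ℕ.* suc t) (ℕ.*-monoˡ-≤ n suck≤)) ⟩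
    (suc k ℕ.* suc t ℕ.+ suc (n ℕ.^ B) ℕ.* suc l ℕ.* n) ℕ.* suc m ≡⟨ cong (λ z → (suc k ℕ.* suc t ℕ.+ z) ℕ.* suc m)
                                                                 (solve 3 (λ p l n → p :* l :* n := p :* n :* l) refl (suc (n ℕ.^ B)) (suc l) n) ⟩
    (suc k ℕ.* suc t ℕ.+ suc (n ℕ.^ B) ℕ.* n ℕ.* suc l) ℕ.* suc m ∎)
    where
    open ℕ.≤-Reasoning
    open ℕSolver.+-*-Solver using (solve; _:+_; _:*_; _:=_)
    j = powNumerator n r₂ m
    k = powNumerator n r₁ l
    a₁ = posPart (↥ r₁)
    b₁ = negPart (↥ r₁)
    a₂ = posPart (↥ r₂)
    b₂ = negPart (↥ r₂)
    suck≤ : suc k ℕ.≤ suc (n ℕ.^ B) ℕ.* suc l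
    suck≤ = ℕ.+-mono-≤ {1} {suc l} (s≤s z≤n) (powNumerator-bound r₁ B l r₁≤B)

-- The m-th approximation to n ^ y is n ^ yₘ rounded down to a multiple of
-- 1 / (m + 1).

infixr 8 _^ᵣ_

_^ᵣ_ : (n : ℕ) .{{_ : NonZero n}} → ℝ → ℝ
n ^ᵣ y = mkℝ (λ m → + powNumerator n (approx y m) m ℚ./ suc m) (oneSided λ {ε} 0<ε →
  let K , N₁ , bound = eventuallyBounded y
      t₁ , h₁ = archimedean (suc (n ℕ.^ suc K) ℕ.* n) (half-pos 0<ε)
      N₂ , f = cauchy y (/-pos 0 t₁)
      t₂ , h₂ = archimedean 1 (half-pos 0<ε)
  in (N₁ ℕ.⊔ N₂) ℕ.⊔ t₂ , λ {m} {l} N≤m N≤l →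
    let N≤m′ = ℕ.m⊔n≤o⇒m≤o (N₁ ℕ.⊔ N₂) t₂ N≤m
        N≤l′ = ℕ.m⊔n≤o⇒m≤o (N₁ ℕ.⊔ N₂) t₂ N≤l
        t₂≤l = ℕ.m⊔n≤o⇒n≤o (N₁ ℕ.⊔ N₂) t₂ N≤l
        r = approx y m
        s = approx y l
        k = powNumerator n s l
    in begin
    + powNumerator n r m ℚ./ suc m
      ≤⟨ powNumerator-≤ n s r (suc K) t₁ l m
           (p-q≤r⇒p≤q+r (ℚ.≤-trans (p≤∣p∣ (r ℚ.- s))
             (f (ℕ.m⊔n≤o⇒n≤o N₁ N₂ N≤m′) (ℕ.m⊔n≤o⇒n≤o N₁ N₂ N≤l′))))
           (ℚ.≤-trans (p≤∣p∣ s) (bound (ℕ.m⊔n≤o⇒m≤o N₁ N₂ N≤l′))) ⟩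
    + suc k ℚ./ suc l ℚ.+ + (suc (n ℕ.^ suc K) ℕ.* n) ℚ./ suc t₁
      ≤⟨ ℚ.+-mono-≤ (ℚ.≤-trans (suc/-split k l)
           (ℚ.+-monoʳ-≤ (+ k ℚ./ suc l) (ℚ.≤-trans (/-mono-≤ 1 l 1 t₂ (ℕ.*-monoʳ-≤ 1 (s≤s t₂≤l))) h₂))) h₁ ⟩
    (+ k ℚ./ suc l ℚ.+ ε ℚ.* ½) ℚ.+ ε ℚ.* ½
      ≡⟨ ℚ.+-assoc (+ k ℚ./ suc l) (ε ℚ.* ½) (ε ℚ.* ½) ⟩
    + k ℚ./ suc l ℚ.+ (ε ℚ.* ½ ℚ.+ ε ℚ.* ½)
      ≡⟨ cong (+ k ℚ./ suc l ℚ.+_) (half+half ε) ⟩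
    + k ℚ./ suc l ℚ.+ ε ∎)
  where open ℚ.≤-Reasoning

{-# OPTIONS --safe #-}
module Submission where

-- For fixed t and large m, the root √((m - t)² ± 1) is an integer plus a power series
-- in 1 / m whose coefficient at m⁻ᵖ⁻¹ behaves like ± tᵖ / 2 for large t.  By this growth,
-- 2e such roots of both signs, with rapidly increasing t, have coefficient vectors at
-- m⁻¹, …, m⁻ᵉ that span ℚᵉ with nonnegative weights.  Adding one more root, some
-- nonnegative combination of 2e + 1 roots has zero coefficients there and a positive
-- one at m⁻ᵉ⁻¹.  The weights may be taken integral, and ω √a = √(ω² a), so this is
-- a sum of k = 2e + 1 roots of integers of size O(m²) that exceeds an integer by
-- κ m⁻ᵉ⁻¹ + O(m⁻ᵉ⁻²).  With m of order √n the distance has order n^(-(k + 1) / 4), and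
-- k^(1/3) ≤ k.  As the leading term is positive, the sum is not an integer.

open import Defs
open import Algebra.Bundles using (CommutativeRing)
open import Data.Empty using (⊥-elim)
open import Data.Fin using (Fin; zero; suc)
open import Data.Integer as ℤ using (ℤ)
import Data.Integer.Properties as ℤ
open import Data.List using (List; []; _∷_)
open import Data.Nat as ℕ using (ℕ; zero; suc; NonZero)
import Data.Nat.Properties as ℕ
import Data.Nat.Solver as ℕSolver
open import Data.Product using (∃-syntax; Σ-syntax; _×_; _,_; proj₁; proj₂)
open import Data.Rational as ℚ using (ℚ; mkℚ; 0ℚ; 1ℚ; ½; ∣_∣)
import Data.Rational.Properties as ℚ
import Data.Rational.Solver as ℚSolver
open import Data.Rational.Unnormalised as ℚᵘ using (mkℚᵘ)
import Data.Rational.Unnormalised.Properties as ℚᵘ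
open import Data.Sign using (Sign)
open import Data.Sum using (inj₁; inj₂)
open import Data.Vec.Functional using () renaming (_∷_ to _∷ᶠ_; [] to []ᶠ)
open import Function using (_∘_)
open import Relation.Binary.PropositionalEquality
open import Relation.Nullary using (Dec; yes; no)
open import Relation.Nullary.Decidable using (from-yes)

-- A sum of roots offers no subtraction, so a linear dependence between coefficient vectors is
-- useless unless its weights are nonnegative. The vectors therefore have to span positively: this
-- is why radicands with both signs occur and why each cancelled coordinate costs two roots. With k
-- roots the surviving power is about m^(-k/2), that is n^(-k/4), which is where c = 1/4 comes from.
--
-- No infinite series is formed. Truncations are polynomials with an exact polynomial residue, and
-- they are compared with √a by comparing squares. All bounds on these polynomials are uniform in δ
-- = ± 1/t² with |δ| ≤ 1. Hence they are known before t is chosen, and so is the bound `A` on the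
-- correction that each new root must outweigh.
--
-- At n = 1 every sum equals k, so n starts at 2. The remaining n below the threshold where the
-- expansion takes over are absorbed into the constant for k.

module SquareRootSums where

  open import Data.Rational using (_+_; _*_; _-_; _≤_; _<_)
  open import Algebra.Properties.CommutativeSemiring.Exp
    (CommutativeRing.commutativeSemiring ℚ.+-*-commutativeRing) using (_^_; ^-distrib-*)
  open import Algebra.Properties.Semiring.Sum
    (CommutativeRing.semiring ℚ.+-*-commutativeRing)
    using (sum; sum-cong-≗; *-distribˡ-sum; ∑-distrib-+)
  open ℚSolver.+-*-Solver using (solve; con; _:+_; _:-_; _:*_; :-_; _:=_)

  -- Inequalities between rationals, natural numbers and their reciprocals as rationals

  ¼ : ℚ
  ¼ = ½ * ½

  +-nonNeg : ∀ {p q} → 0ℚ ≤ p → 0ℚ ≤ q → 0ℚ ≤ p + q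
  +-nonNeg 0≤p 0≤q = ℚ.+-mono-≤ 0≤p 0≤q

  *-nonNeg : ∀ {p q} → 0ℚ ≤ p → 0ℚ ≤ q → 0ℚ ≤ p * q
  *-nonNeg {p} {q} 0≤p 0≤q =
    subst (_≤ p * q) (ℚ.*-zeroʳ p) (ℚ.*-monoˡ-≤-nonNeg p {{ℚ.nonNegative 0≤p}} 0≤q)

  ≤-by : ∀ {p q d} → 0ℚ ≤ d → q ≡ p + d → p ≤ q
  ≤-by {p} {q} {d} 0≤d eq =
    subst₂ _≤_ (ℚ.+-identityʳ p) (sym eq) (ℚ.+-monoʳ-≤ p 0≤d)

  <-by : ∀ {p q d} → 0ℚ < d → q ≡ p + d → p < q
  <-by {p} {q} {d} 0<d eq =
    subst₂ _<_ (ℚ.+-identityʳ p) (sym eq) (ℚ.+-monoʳ-< p 0<d)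

  *-monoˡ : ∀ {p q} r → 0ℚ ≤ r → p ≤ q → r * p ≤ r * q
  *-monoˡ r 0≤r = ℚ.*-monoˡ-≤-nonNeg r {{ℚ.nonNegative 0≤r}}

  *-monoʳ : ∀ {p q} r → 0ℚ ≤ r → p ≤ q → p * r ≤ q * r
  *-monoʳ r 0≤r = ℚ.*-monoʳ-≤-nonNeg r {{ℚ.nonNegative 0≤r}}

  0≤½ : 0ℚ ≤ ½
  0≤½ = ℚ.<⇒≤ (ℚ.positive⁻¹ ½)

  0<1 : 0ℚ < 1ℚ
  0<1 = ℚ.positive⁻¹ 1ℚ

  0≤1 : 0ℚ ≤ 1ℚ
  0≤1 = ℚ.<⇒≤ 0<1

  ∣+∣≤ : ∀ {p q a b} → ∣ p ∣ ≤ a → ∣ q ∣ ≤ b → ∣ p + q ∣ ≤ a + b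
  ∣+∣≤ {p} {q} h₁ h₂ = ℚ.≤-trans (ℚ.∣p+q∣≤∣p∣+∣q∣ p q) (ℚ.+-mono-≤ h₁ h₂)

  ∣*∣≤ : ∀ {p q a b} → ∣ p ∣ ≤ a → ∣ q ∣ ≤ b → ∣ p * q ∣ ≤ a * b
  ∣*∣≤ {p} {q} {a} {b} h₁ h₂ = subst (_≤ a * b) (sym (ℚ.∣p*q∣≡∣p∣*∣q∣ p q))
    (*-mono-≤-nonNeg (ℚ.0≤∣p∣ p) (ℚ.≤-trans (ℚ.0≤∣p∣ q) h₂) h₁ h₂)

  ∣-∣≤ : ∀ {p q a b} → ∣ p ∣ ≤ a → ∣ q ∣ ≤ b → ∣ p - q ∣ ≤ a + b
  ∣-∣≤ {p} {q} {a} {b} h₁ h₂ = ∣+∣≤ h₁ (subst (_≤ b) (sym (ℚ.∣-p∣≡∣p∣ q)) h₂)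

  ∣-∣-split : ∀ {p q a} → p ≤ q + a → q ≤ p + a → ∣ p - q ∣ ≤ a
  ∣-∣-split {p} {q} {a} h₁ h₂ = ∣p∣≤ (p≤q+r⇒p-q≤r {p} {q} {a} h₁)
    (subst (_≤ a) (solve 2 (λ p q → q :- p := :- (p :- q)) refl p q) (p≤q+r⇒p-q≤r {q} {p} {a} h₂))

  ∣-∣-upper : ∀ {p q a} → ∣ p - q ∣ ≤ a → p ≤ q + a
  ∣-∣-upper {p} {q} h = p-q≤r⇒p≤q+r (ℚ.≤-trans (p≤∣p∣ (p - q)) h)

  ∣-∣-lower : ∀ {p q a} → ∣ p - q ∣ ≤ a → q - a ≤ p
  ∣-∣-lower {p} {q} {a} h = subst (q - a ≤_) (solve 2 (λ p a → (p :+ a) :- a := p) refl p a)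
    (ℚ.+-monoˡ-≤ (ℚ.- a) (∣-∣-upper {q} {p} (subst (_≤ a) (∣p-q∣-comm p q) h)))

  -- Abstract because normalising fractions of open terms is costly.
  abstract
    ι : ℕ → ℚ
    ι n = fromℤ (ℤ.+ n)

    ι≡ : ∀ n → ι n ≡ fromℤ (ℤ.+ n)
    ι≡ n = refl

    inv : ℕ → ℚ
    inv m = ℤ.+ 1 ℚ./ suc m

    inv≡ : ∀ m → inv m ≡ ℤ.+ 1 ℚ./ suc m
    inv≡ m = refl

  fromℚᵘ-* : ∀ p q → ℚ.fromℚᵘ (p ℚᵘ.* q) ≡ ℚ.fromℚᵘ p * ℚ.fromℚᵘ q
  fromℚᵘ-* p q = ℚ.toℚᵘ-injective (begin
    ℚ.toℚᵘ (ℚ.fromℚᵘ (p ℚᵘ.* q))                       ≈⟨ ℚ.toℚᵘ-fromℚᵘ _ ⟩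
    p ℚᵘ.* q                                           ≈⟨ ℚᵘ.*-cong (ℚ.toℚᵘ-fromℚᵘ p) (ℚ.toℚᵘ-fromℚᵘ q) ⟨
    ℚ.toℚᵘ (ℚ.fromℚᵘ p) ℚᵘ.* ℚ.toℚᵘ (ℚ.fromℚᵘ q)       ≈⟨ ℚ.toℚᵘ-homo-* (ℚ.fromℚᵘ p) (ℚ.fromℚᵘ q) ⟨
    ℚ.toℚᵘ (ℚ.fromℚᵘ p * ℚ.fromℚᵘ q)                   ∎)
    where open ℚᵘ.≃-Reasoning

  /-* : ∀ a l b m {c n} → a ℤ.* b ℤ.* ℤ.+ suc n ≡ c ℤ.* (ℤ.+ suc l ℤ.* ℤ.+ suc m) →
        (a ℚ./ suc l) * (b ℚ./ suc m) ≡ c ℚ./ suc n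
  /-* a l b m {c} {n} eq = trans (sym (fromℚᵘ-* (mkℚᵘ a l) (mkℚᵘ b m)))
    (ℚ.fromℚᵘ-cong {mkℚᵘ a l ℚᵘ.* mkℚᵘ b m} {mkℚᵘ c n} (ℚᵘ.*≡* eq))

  fromℤ-* : ∀ i j → fromℤ (i ℤ.* j) ≡ fromℤ i * fromℤ j
  fromℤ-* i j = sym (/-* i 0 j 0 {i ℤ.* j} {0} refl)

  fromℤ-+ : ∀ i j → fromℤ (i ℤ.+ j) ≡ fromℤ i + fromℤ j
  fromℤ-+ i j = trans
    (ℚ.fromℚᵘ-cong {mkℚᵘ (i ℤ.+ j) 0} {mkℚᵘ i 0 ℚᵘ.+ mkℚᵘ j 0} (ℚᵘ.*≡*
      (cong (ℤ._* ℤ.+ 1) (cong₂ ℤ._+_ (sym (ℤ.*-identityʳ i)) (sym (ℤ.*-identityʳ j))))))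
    (fromℚᵘ-+ (mkℚᵘ i 0) (mkℚᵘ j 0))

  abstract
    ι-+ : ∀ m n → ι (m ℕ.+ n) ≡ ι m + ι n
    ι-+ m n = fromℤ-+ (ℤ.+ m) (ℤ.+ n)

    ι-* : ∀ m n → ι (m ℕ.* n) ≡ ι m * ι n
    ι-* m n = trans (cong fromℤ (ℤ.pos-* m n)) (fromℤ-* (ℤ.+ m) (ℤ.+ n))

    ι-mono : ∀ {m n} → m ℕ.≤ n → ι m ≤ ι n
    ι-mono m≤n = fromℤ-mono-≤ (ℤ.+≤+ m≤n)

    ι-0 : ι 0 ≡ 0ℚ
    ι-0 = refl

    ι-1 : ι 1 ≡ 1ℚ
    ι-1 = refl

    inv-pos : ∀ m → 0ℚ < inv m
    inv-pos m = /-pos 0 m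

    inv-mono : ∀ {m n} → m ℕ.≤ n → inv n ≤ inv m
    inv-mono {m} {n} m≤n = /-mono-≤ 1 n 1 m (ℕ.*-monoʳ-≤ 1 (ℕ.s≤s m≤n))

    /≡ι*inv : ∀ a m → ℤ.+ a ℚ./ suc m ≡ ι a * inv m
    /≡ι*inv a m = sym (/-* (ℤ.+ a) 0 (ℤ.+ 1) m {ℤ.+ a} {m}
      (cong₂ ℤ._*_ (ℤ.*-identityʳ (ℤ.+ a)) (sym (ℤ.*-identityˡ (ℤ.+ suc m)))))

    ι*inv : ∀ m → ι (suc m) * inv m ≡ 1ℚ
    ι*inv m = /-* (ℤ.+ suc m) 0 (ℤ.+ 1) m {ℤ.+ 1} {0}
      (trans (ℤ.*-identityʳ (ℤ.+ suc m ℤ.* ℤ.+ 1)) (trans (ℤ.*-identityʳ (ℤ.+ suc m))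
        (sym (trans (ℤ.*-identityˡ (ℤ.+ 1 ℤ.* ℤ.+ suc m)) (ℤ.*-identityˡ (ℤ.+ suc m))))))

    archimedean-ι : ∀ p → ∃[ n ] p ≤ ι n
    archimedean-ι p = ℤ.∣ ℚ.↥ p ∣ , p≤∣↥p∣ p

  ι-nonNeg : ∀ n → 0ℚ ≤ ι n
  ι-nonNeg n = subst (_≤ ι n) ι-0 (ι-mono ℕ.z≤n)

  ι-suc : ∀ n → ι (suc n) ≡ 1ℚ + ι n
  ι-suc n = trans (ι-+ 1 n) (cong (_+ ι n) ι-1)

  ι-≥1 : ∀ {n} → 1 ℕ.≤ n → 1ℚ ≤ ι n
  ι-≥1 {n} h = subst (_≤ ι n) ι-1 (ι-mono h)

  inv-nonNeg : ∀ m → 0ℚ ≤ inv m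
  inv-nonNeg m = ℚ.<⇒≤ (inv-pos m)

  archimedean-inv : ∀ K {ε} → 0ℚ ≤ K → 0ℚ < ε → ∃[ N ] (∀ {m} → N ℕ.≤ m → K * inv m ≤ ε)
  archimedean-inv K {ε} 0≤K 0<ε with archimedean-ι K
  ... | k , K≤k with archimedean k 0<ε
  ...   | t , h = t , λ {m} t≤m → ℚ.≤-trans (*-mono-≤-nonNeg 0≤K (inv-nonNeg t) K≤k (inv-mono t≤m))
    (subst (_≤ ε) (/≡ι*inv k t) h)

  -- Polynomials over ℚ and their coefficient norm

  Poly : Set
  Poly = List ℚ

  eval : Poly → ℚ → ℚ
  eval []      x = 0ℚ
  eval (a ∷ p) x = a + x * eval p x

  infixl 6 _⊕_

  _⊕_ : Poly → Poly → Poly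
  []      ⊕ q       = q
  (a ∷ p) ⊕ []      = a ∷ p
  (a ∷ p) ⊕ (b ∷ q) = (a + b) ∷ (p ⊕ q)

  scale : ℚ → Poly → Poly
  scale c []      = []
  scale c (a ∷ p) = c * a ∷ scale c p

  monomial : ℚ → ℕ → Poly
  monomial c zero    = c ∷ []
  monomial c (suc n) = 0ℚ ∷ monomial c n

  coeff₀ : Poly → ℚ
  coeff₀ []      = 0ℚ
  coeff₀ (a ∷ _) = a

  shift : Poly → Poly
  shift []      = []
  shift (_ ∷ p) = p

  eval-⊕ : ∀ p q x → eval (p ⊕ q) x ≡ eval p x + eval q x
  eval-⊕ []      q       x = sym (ℚ.+-identityˡ _)
  eval-⊕ (a ∷ p) []      x = sym (ℚ.+-identityʳ _)
  eval-⊕ (a ∷ p) (b ∷ q) x = trans (cong (λ e → a + b + x * e) (eval-⊕ p q x))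
    (solve 5 (λ a b x p q → a :+ b :+ x :* (p :+ q) := (a :+ x :* p) :+ (b :+ x :* q)) refl
      a b x (eval p x) (eval q x))

  eval-scale : ∀ c p x → eval (scale c p) x ≡ c * eval p x
  eval-scale c []      x = sym (ℚ.*-zeroʳ c)
  eval-scale c (a ∷ p) x = trans (cong (λ e → c * a + x * e) (eval-scale c p x))
    (solve 4 (λ c a x p → c :* a :+ x :* (c :* p) := c :* (a :+ x :* p)) refl c a x (eval p x))

  eval-monomial : ∀ c n x → eval (monomial c n) x ≡ c * x ^ n
  eval-monomial c zero    x = solve 2 (λ c x → c :+ x :* con 0ℚ := c :* con 1ℚ) refl c x
  eval-monomial c (suc n) x = trans (cong (λ e → 0ℚ + x * e) (eval-monomial c n x))
    (solve 3 (λ c x y → con 0ℚ :+ x :* (c :* y) := c :* (x :* y)) refl c x (x ^ n))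

  eval-shift : ∀ p x → eval p x ≡ coeff₀ p + x * eval (shift p) x
  eval-shift []      x = solve 1 (λ x → con 0ℚ := con 0ℚ :+ x :* con 0ℚ) refl x
  eval-shift (a ∷ p) x = refl

  norm : Poly → ℚ
  norm []      = 0ℚ
  norm (a ∷ p) = ∣ a ∣ + norm p

  norm-nonNeg : ∀ p → 0ℚ ≤ norm p
  norm-nonNeg []      = ℚ.≤-refl
  norm-nonNeg (a ∷ p) = +-nonNeg (ℚ.0≤∣p∣ a) (norm-nonNeg p)

  norm-⊕ : ∀ p q → norm (p ⊕ q) ≤ norm p + norm q
  norm-⊕ []      q       = ℚ.≤-reflexive (sym (ℚ.+-identityˡ _))
  norm-⊕ (a ∷ p) []      = ℚ.≤-reflexive (sym (ℚ.+-identityʳ _))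
  norm-⊕ (a ∷ p) (b ∷ q) = ℚ.≤-trans (ℚ.+-mono-≤ (ℚ.∣p+q∣≤∣p∣+∣q∣ a b) (norm-⊕ p q))
    (ℚ.≤-reflexive (solve 4 (λ a b p q → a :+ b :+ (p :+ q) := (a :+ p) :+ (b :+ q)) refl
      ∣ a ∣ ∣ b ∣ (norm p) (norm q)))

  norm-scale : ∀ c p → norm (scale c p) ≡ ∣ c ∣ * norm p
  norm-scale c []      = sym (ℚ.*-zeroʳ ∣ c ∣)
  norm-scale c (a ∷ p) = trans (cong₂ _+_ (ℚ.∣p*q∣≡∣p∣*∣q∣ c a) (norm-scale c p))
    (sym (ℚ.*-distribˡ-+ ∣ c ∣ ∣ a ∣ (norm p)))

  norm-monomial : ∀ c n → norm (monomial c n) ≡ ∣ c ∣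
  norm-monomial c zero    = ℚ.+-identityʳ ∣ c ∣
  norm-monomial c (suc n) = trans (ℚ.+-identityˡ _) (norm-monomial c n)

  norm-coeff₀ : ∀ p → ∣ coeff₀ p ∣ ≤ norm p
  norm-coeff₀ []      = ℚ.≤-refl
  norm-coeff₀ (a ∷ p) = ≤-by (norm-nonNeg p) refl

  norm-shift : ∀ p → norm (shift p) ≤ norm p
  norm-shift []      = ℚ.≤-refl
  norm-shift (a ∷ p) = ≤-by (ℚ.0≤∣p∣ a) (ℚ.+-comm ∣ a ∣ (norm p))

  eval-bound : ∀ p {x} → ∣ x ∣ ≤ 1ℚ → ∣ eval p x ∣ ≤ norm p
  eval-bound []      h = ℚ.≤-refl
  eval-bound (a ∷ p) {x} h = ∣+∣≤ (ℚ.≤-refl {∣ a ∣})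
    (subst (∣ x * eval p x ∣ ≤_) (ℚ.*-identityˡ (norm p)) (∣*∣≤ h (eval-bound p h)))

  -- The truncated expansion and its exact residue

  -- √((1 - x)² + δ x²) = 1 - x + δ x² / 2 · (g₀ + g₁ x + …): the numbers gₚ are the
  -- coefficients of the root h of 1 = (1 - x) h + δ x² h² / 4.  The partial sum
  -- h≈ δ p leaves the residue xᵖ (1 + δ r≈ δ p), and gₚ is that residue's leading coefficient.

  module _ (δ : ℚ) where

    mutual
      h≈ r≈ : ℕ → Poly
      h≈ zero    = []
      h≈ (suc p) = h≈ p ⊕ monomial (g p) p
      r≈ zero    = []
      r≈ (suc p) = shift (r≈ p) ⊕ (coeff₀ (r≈ p) ∷ []) ⊕
                   scale (ℚ.- (¼ * g p)) (0ℚ ∷ (h≈ p ⊕ h≈ (suc p)))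

      g : ℕ → ℚ
      g p = 1ℚ + δ * coeff₀ (r≈ p)

    eval-h≈ : ∀ p x → eval (h≈ (suc p)) x ≡ eval (h≈ p) x + g p * x ^ p
    eval-h≈ p x = trans (eval-⊕ (h≈ p) _ x) (cong (eval (h≈ p) x +_) (eval-monomial (g p) p x))

    eval-r≈ : ∀ p x → eval (r≈ (suc p)) x ≡ eval (shift (r≈ p)) x + coeff₀ (r≈ p)
              - ¼ * g p * x * (eval (h≈ p) x + eval (h≈ (suc p)) x)
    eval-r≈ p x = begin
      eval (r≈ (suc p)) x                               ≡⟨ eval-⊕ (s ⊕ (b ∷ [])) _ x ⟩
      eval (s ⊕ (b ∷ [])) x + eval (scale c (0ℚ ∷ k)) x ≡⟨ cong₂ _+_ (eval-⊕ s (b ∷ []) x) (eval-scale c (0ℚ ∷ k) x) ⟩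
      eval s x + (b + x * 0ℚ) + c * (0ℚ + x * eval k x) ≡⟨ cong (λ e → eval s x + (b + x * 0ℚ) + c * (0ℚ + x * e)) (eval-⊕ (h≈ p) (h≈ (suc p)) x) ⟩
      eval s x + (b + x * 0ℚ) + c * (0ℚ + x * (eval (h≈ p) x + eval (h≈ (suc p)) x))
        ≡⟨ solve 5 (λ s b x d e → s :+ (b :+ x :* con 0ℚ) :+ (:- d) :* (con 0ℚ :+ x :* e)
                   := s :+ b :- d :* x :* e) refl (eval s x) b x (¼ * g p) (eval (h≈ p) x + eval (h≈ (suc p)) x) ⟩
      eval s x + b - ¼ * g p * x * (eval (h≈ p) x + eval (h≈ (suc p)) x) ∎
      where
      open ≡-Reasoning
      s = shift (r≈ p)
      b = coeff₀ (r≈ p)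
      c = ℚ.- (¼ * g p)
      k = h≈ p ⊕ h≈ (suc p)

    -- Adding g xᵖ to h removes the leading coefficient g = 1 + δ b of the residue xᵖ (1 + δ (b + x
    -- s)). The factor 1 - x returns g xᵖ⁺¹, whose part δ b is the summand `coeff₀` of the next
    -- `r≈`. The quadratic term changes by a difference of squares, g xᵖ (h + h′), which gives the
    -- remaining summand.
    h≈-residue : ∀ p x → 1ℚ ≡ (1ℚ - x) * eval (h≈ p) x
      + ¼ * δ * (x * x) * (eval (h≈ p) x * eval (h≈ p) x) + x ^ p * (1ℚ + δ * eval (r≈ p) x)
    h≈-residue zero x = solve 3 (λ x q d → con 1ℚ := (con 1ℚ :- x) :* con 0ℚ
      :+ q :* d :* (x :* x) :* (con 0ℚ :* con 0ℚ) :+ con 1ℚ :* (con 1ℚ :+ d :* con 0ℚ)) refl x ¼ δ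
    h≈-residue (suc p) x = trans (h≈-residue p x) (begin
      F h (x ^ p) (eval (r≈ p) x)                 ≡⟨ cong (F h (x ^ p)) (eval-shift (r≈ p) x) ⟩
      F h (x ^ p) (b + x * s)
        ≡⟨ solve 7 (λ x h y q d b s → let
              one = con 1ℚ
              g = one :+ d :* b
              h′ = h :+ g :* y
            in (one :- x) :* h :+ q :* d :* (x :* x) :* (h :* h) :+ y :* (one :+ d :* (b :+ x :* s))
            := (one :- x) :* h′ :+ q :* d :* (x :* x) :* (h′ :* h′)
               :+ (x :* y) :* (one :+ d :* (s :+ b :- q :* g :* x :* (h :+ h′)))) refl
            x h (x ^ p) ¼ δ b s ⟩
      F (h + g p * x ^ p) (x * x ^ p) (s + b - ¼ * g p * x * (h + (h + g p * x ^ p)))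
        ≡⟨ cong (λ k → F k (x * x ^ p) (s + b - ¼ * g p * x * (h + k))) (eval-h≈ p x) ⟨
      F h′ (x * x ^ p) (s + b - ¼ * g p * x * (h + h′))
        ≡⟨ cong (F h′ (x * x ^ p)) (eval-r≈ p x) ⟨
      F h′ (x * x ^ p) (eval (r≈ (suc p)) x)      ∎)
      where
      open ≡-Reasoning
      h = eval (h≈ p) x
      h′ = eval (h≈ (suc p)) x
      b = coeff₀ (r≈ p)
      s = eval (shift (r≈ p)) x
      F : ℚ → ℚ → ℚ → ℚ
      F h y r = (1ℚ - x) * h + ¼ * δ * (x * x) * (h * h) + y * (1ℚ + δ * r)

  ¼≤1 : ∣ ¼ ∣ ≤ 1ℚ
  ¼≤1 = ≤-by {d = ½ + ¼} (+-nonNeg 0≤½ (*-nonNeg 0≤½ 0≤½)) refl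

  -- One bound serves all δ in [-1, 1]: each step only adds and multiplies quantities that are
  -- already bounded uniformly. The uniformity allows t to be chosen after the bound.
  h≈-r≈-bound : ∀ p → ∃[ K ] 0ℚ ≤ K × (∀ {δ} → ∣ δ ∣ ≤ 1ℚ → norm (h≈ δ p) ≤ K × norm (r≈ δ p) ≤ K)
  h≈-r≈-bound zero = 0ℚ , ℚ.≤-refl , λ _ → ℚ.≤-refl , ℚ.≤-refl
  h≈-r≈-bound (suc p) with h≈-r≈-bound p
  ... | K , 0≤K , bound = L + M , +-nonNeg 0≤L 0≤M , λ {δ} δ≤1 →
    let hK , rK = bound δ≤1
        gL : ∣ g δ p ∣ ≤ 1ℚ + K
        gL = ∣+∣≤ {1ℚ} ℚ.≤-refl (subst (∣ δ * coeff₀ (r≈ δ p) ∣ ≤_) (ℚ.*-identityˡ K)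
               (∣*∣≤ δ≤1 (ℚ.≤-trans (norm-coeff₀ (r≈ δ p)) rK)))
        hL : norm (h≈ δ (suc p)) ≤ L
        hL = ℚ.≤-trans (norm-⊕ (h≈ δ p) _) (ℚ.+-mono-≤ hK
               (subst (_≤ 1ℚ + K) (sym (norm-monomial (g δ p) p)) gL))
        cL : ∣ ℚ.- (¼ * g δ p) ∣ ≤ 1ℚ * (1ℚ + K)
        cL = subst (_≤ 1ℚ * (1ℚ + K)) (sym (ℚ.∣-p∣≡∣p∣ (¼ * g δ p))) (∣*∣≤ ¼≤1 gL)
        kL : norm (0ℚ ∷ (h≈ δ p ⊕ h≈ δ (suc p))) ≤ K + L
        kL = ℚ.≤-trans (ℚ.≤-reflexive (ℚ.+-identityˡ _))
               (ℚ.≤-trans (norm-⊕ (h≈ δ p) (h≈ δ (suc p))) (ℚ.+-mono-≤ hK hL))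
        rM : norm (r≈ δ (suc p)) ≤ M
        rM = ℚ.≤-trans (norm-⊕ (shift (r≈ δ p) ⊕ (coeff₀ (r≈ δ p) ∷ [])) _) (ℚ.+-mono-≤
               (ℚ.≤-trans (norm-⊕ (shift (r≈ δ p)) _) (ℚ.+-mono-≤ (ℚ.≤-trans (norm-shift (r≈ δ p)) rK)
                 (ℚ.≤-trans (ℚ.≤-reflexive (ℚ.+-identityʳ _)) (ℚ.≤-trans (norm-coeff₀ (r≈ δ p)) rK))))
               (subst (_≤ 1ℚ * (1ℚ + K) * (K + L)) (sym (norm-scale (ℚ.- (¼ * g δ p)) (0ℚ ∷ (h≈ δ p ⊕ h≈ δ (suc p)))))
                 (*-mono-≤-nonNeg (ℚ.0≤∣p∣ _) (+-nonNeg 0≤K 0≤L) cL kL)))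
    in ℚ.≤-trans hL (≤-by 0≤M refl) , ℚ.≤-trans rM (≤-by 0≤L (ℚ.+-comm L M))
    where
    L M : ℚ
    L = K + (1ℚ + K)
    M = K + K + 1ℚ * (1ℚ + K) * (K + L)
    0≤1+K = +-nonNeg 0≤1 0≤K
    0≤L = +-nonNeg 0≤K 0≤1+K
    0≤M = +-nonNeg (+-nonNeg 0≤K 0≤K) (*-nonNeg (*-nonNeg 0≤1 0≤1+K) (+-nonNeg 0≤K 0≤L))

  -- As δ = ± 1/t², this is the growth statement: for large t the coefficient vector of a root
  -- approaches ± (1, t, t², ...) in ratio, coordinate by coordinate.
  g-near-1 : ∀ p → ∃[ K ] 0ℚ ≤ K × (∀ {δ} → ∣ δ ∣ ≤ 1ℚ → ∣ g δ p - 1ℚ ∣ ≤ ∣ δ ∣ * K)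
  g-near-1 p with h≈-r≈-bound p
  ... | K , 0≤K , bound = K , 0≤K , λ {δ} δ≤1 →
    subst (λ e → ∣ e ∣ ≤ ∣ δ ∣ * K)
      (solve 2 (λ d r → d :* r := (con 1ℚ :+ d :* r) :- con 1ℚ) refl δ (coeff₀ (r≈ δ p)))
      (∣*∣≤ (ℚ.≤-refl {∣ δ ∣}) (ℚ.≤-trans (norm-coeff₀ (r≈ δ p)) (proj₂ (bound δ≤1))))

  -- Roots and their coefficient vectors

  σ : Sign → ℚ
  σ Sign.+ = 1ℚ
  σ Sign.- = ℚ.- 1ℚ

  σ*σ : ∀ s → σ s * σ s ≡ 1ℚ
  σ*σ Sign.+ = refl
  σ*σ Sign.- = refl

  ∣σ∣ : ∀ s → ∣ σ s ∣ ≡ 1ℚ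
  ∣σ∣ Sign.+ = refl
  ∣σ∣ Sign.- = refl

  ^-nonNeg : ∀ {x} → 0ℚ ≤ x → ∀ p → 0ℚ ≤ x ^ p
  ^-nonNeg 0≤x zero    = 0≤1
  ^-nonNeg 0≤x (suc p) = *-nonNeg 0≤x (^-nonNeg 0≤x p)

  ^-pos : ∀ {x} → 0ℚ < x → ∀ p → 0ℚ < x ^ p
  ^-pos 0<x zero    = 0<1
  ^-pos 0<x (suc p) = *-pos 0<x (^-pos 0<x p)

  1^ : ∀ p → 1ℚ ^ p ≡ 1ℚ
  1^ zero    = refl
  1^ (suc p) = trans (ℚ.*-identityˡ _) (1^ p)

  ^-monoʳ : ∀ {x p q} → 1ℚ ≤ x → p ℕ.≤ q → x ^ p ≤ x ^ q
  ^-monoʳ {x} {q = zero}  1≤x ℕ.z≤n = ℚ.≤-refl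
  ^-monoʳ {x} {q = suc q} 1≤x ℕ.z≤n = ℚ.≤-trans (^-monoʳ {x} {zero} {q} 1≤x ℕ.z≤n)
    (subst (_≤ x * x ^ q) (ℚ.*-identityˡ (x ^ q)) (*-monoʳ (x ^ q) (^-nonNeg (ℚ.≤-trans 0≤1 1≤x) q) 1≤x))
  ^-monoʳ {x} 1≤x (ℕ.s≤s h) = *-monoˡ x (ℚ.≤-trans 0≤1 1≤x) (^-monoʳ 1≤x h)

  reciprocal : ∀ {p} → 0ℚ < p → ∃[ q ] 0ℚ < q × p * q ≡ 1ℚ
  reciprocal {p} 0<p = ℚ.1/_ p {{nz}} , ℚ.positive⁻¹ _ {{ℚ.1/pos⇒pos p {{ℚ.positive 0<p}}}} , ℚ.*-inverseʳ p {{nz}}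
    where nz = ℚ.pos⇒nonZero p {{ℚ.positive 0<p}}

  -- Stands for √((m - t)² ± 1), t = pred-t + 1, as a function of m.
  record Root : Set where
    constructor root±
    field
      pred-t : ℕ
      sign   : Sign

    t : ℕ
    t = suc pred-t

    -- With x = t / m the radicand (m - t)² ± 1 is m² ((1 - x)² + δ x²), where δ = ± 1 / t².
    δ : ℚ
    δ = σ sign * (inv pred-t * inv pred-t)

    -- √((m - t)² ± 1) = m - t + ½ Σₚ coord p / mᵖ⁺¹
    coord : ℕ → ℚ
    coord p = σ sign * (ι t ^ p * g δ p)

  open Root using (coord)

  inv≤1 : ∀ m → inv m ≤ 1ℚ
  inv≤1 m = subst (inv m ≤_) (trans (inv≡ 0) refl) (inv-mono {0} {m} ℕ.z≤n)

  ∣δ∣≤inv : ∀ r → ∣ Root.δ r ∣ ≤ inv (Root.pred-t r)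
  ∣δ∣≤inv r = begin
    ∣ Root.δ r ∣           ≡⟨ ℚ.∣p*q∣≡∣p∣*∣q∣ (σ s) (τ * τ) ⟩
    ∣ σ s ∣ * ∣ τ * τ ∣    ≡⟨ cong₂ _*_ (∣σ∣ s) (ℚ.0≤p⇒∣p∣≡p (*-nonNeg 0≤τ 0≤τ)) ⟩
    1ℚ * (τ * τ)           ≡⟨ ℚ.*-identityˡ (τ * τ) ⟩
    τ * τ                  ≤⟨ *-monoˡ τ 0≤τ (inv≤1 (Root.pred-t r)) ⟩
    τ * 1ℚ                 ≡⟨ ℚ.*-identityʳ τ ⟩
    τ                      ∎
    where
    open ℚ.≤-Reasoning
    s = Root.sign r
    τ = inv (Root.pred-t r)
    0≤τ = inv-nonNeg (Root.pred-t r)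

  ∣δ∣≤1 : ∀ r → ∣ Root.δ r ∣ ≤ 1ℚ
  ∣δ∣≤1 r = ℚ.≤-trans (∣δ∣≤inv r) (inv≤1 (Root.pred-t r))

  coord-bound : ∀ p → ∃[ K ] 0ℚ ≤ K × (∀ r → ∣ coord r p ∣ ≤ ι (Root.t r) ^ p * K)
  coord-bound p = 1ℚ + K , +-nonNeg 0≤1 0≤K , bound
    where
    K = proj₁ (g-near-1 p)
    0≤K = proj₁ (proj₂ (g-near-1 p))
    bound : ∀ r → ∣ coord r p ∣ ≤ ι (Root.t r) ^ p * (1ℚ + K)
    bound r = begin
      ∣ σ s * (T * γ) ∣       ≡⟨ ℚ.∣p*q∣≡∣p∣*∣q∣ (σ s) (T * γ) ⟩
      ∣ σ s ∣ * ∣ T * γ ∣     ≡⟨ cong₂ _*_ (∣σ∣ s) (ℚ.∣p*q∣≡∣p∣*∣q∣ T γ) ⟩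
      1ℚ * (∣ T ∣ * ∣ γ ∣)    ≡⟨ ℚ.*-identityˡ _ ⟩
      ∣ T ∣ * ∣ γ ∣           ≡⟨ cong (_* ∣ γ ∣) (ℚ.0≤p⇒∣p∣≡p 0≤T) ⟩
      T * ∣ γ ∣               ≤⟨ *-monoˡ T 0≤T γ≤ ⟩
      T * (1ℚ + K)            ∎
      where
      open ℚ.≤-Reasoning
      s = Root.sign r
      T = ι (Root.t r) ^ p
      γ = g (Root.δ r) p
      0≤T : 0ℚ ≤ T
      0≤T = ^-nonNeg (ι-nonNeg (Root.t r)) p
      near : ∣ γ - 1ℚ ∣ ≤ 1ℚ * K
      near = ℚ.≤-trans (proj₂ (proj₂ (g-near-1 p)) (∣δ∣≤1 r)) (*-monoʳ K 0≤K (∣δ∣≤1 r))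
      γ≤ : ∣ γ ∣ ≤ 1ℚ + K
      γ≤ = begin
        ∣ γ ∣                   ≡⟨ cong ∣_∣ (solve 1 (λ g → g := con 1ℚ :+ (g :- con 1ℚ)) refl γ) ⟩
        ∣ 1ℚ + (γ - 1ℚ) ∣       ≤⟨ ℚ.∣p+q∣≤∣p∣+∣q∣ 1ℚ (γ - 1ℚ) ⟩
        1ℚ + ∣ γ - 1ℚ ∣         ≤⟨ ℚ.+-monoʳ-≤ 1ℚ near ⟩
        1ℚ + 1ℚ * K             ≡⟨ cong (1ℚ +_) (ℚ.*-identityˡ K) ⟩
        1ℚ + K                  ∎

  -- Positive spanning by coefficient vectors

  sumTo : ℕ → (ℕ → ℚ) → ℚ
  sumTo zero    f = 0ℚ
  sumTo (suc e) f = sumTo e f + f e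

  sumTo-nonNeg : ∀ e {f} → (∀ p → 0ℚ ≤ f p) → 0ℚ ≤ sumTo e f
  sumTo-nonNeg zero    h = ℚ.≤-refl
  sumTo-nonNeg (suc e) h = +-nonNeg (sumTo-nonNeg e h) (h e)

  sumTo-scaled-≤ : ∀ e x y {f h} → (∀ {p} → p ℕ.< e → x * f p ≤ y * h p) →
                   x * sumTo e f ≤ y * sumTo e h
  sumTo-scaled-≤ zero    x y le = ℚ.≤-reflexive (trans (ℚ.*-zeroʳ x) (sym (ℚ.*-zeroʳ y)))
  sumTo-scaled-≤ (suc e) x y {f} {h} le =
    subst₂ _≤_ (sym (ℚ.*-distribˡ-+ x (sumTo e f) (f e))) (sym (ℚ.*-distribˡ-+ y (sumTo e h) (h e)))
      (ℚ.+-mono-≤ (sumTo-scaled-≤ e x y {f} {h} (λ {p} p<e → le {p} (ℕ.m≤n⇒m≤1+n p<e))) (le {e} ℕ.≤-refl))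

  dot : ∀ {n} → (Fin n → ℚ) → (Fin n → Root) → ℕ → ℚ
  dot w V p = sum λ i → w i * coord (V i) p

  dot-0 : ∀ {n} (V : Fin n → Root) p → dot (λ _ → 0ℚ) V p ≡ 0ℚ
  dot-0 {zero}  V p = refl
  dot-0 {suc n} V p = cong₂ _+_ (ℚ.*-zeroˡ (coord (V zero) p)) (dot-0 (λ i → V (suc i)) p)

  dot-* : ∀ {n} c w (V : Fin n → Root) p → dot (λ i → c * w i) V p ≡ c * dot w V p
  dot-* {zero}  c w V p = sym (ℚ.*-zeroʳ c)
  dot-* {suc n} c w V p = trans (cong (c * w zero * coord (V zero) p +_) (dot-* c (λ i → w (suc i)) (λ i → V (suc i)) p))
    (solve 4 (λ c w v d → c :* w :* v :+ c :* d := c :* (w :* v :+ d)) refl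
      c (w zero) (coord (V zero) p) (dot (λ i → w (suc i)) (λ i → V (suc i)) p))

  dot-+ : ∀ {n} w w′ (V : Fin n → Root) p → dot (λ i → w i + w′ i) V p ≡ dot w V p + dot w′ V p
  dot-+ {zero}  w w′ V p = refl
  dot-+ {suc n} w w′ V p = trans
    (cong ((w zero + w′ zero) * coord (V zero) p +_) (dot-+ (λ i → w (suc i)) (λ i → w′ (suc i)) (λ i → V (suc i)) p))
    (solve 5 (λ w w′ v d d′ → (w :+ w′) :* v :+ (d :+ d′) := (w :* v :+ d) :+ (w′ :* v :+ d′)) refl
      (w zero) (w′ zero) (coord (V zero) p)
      (dot (λ i → w (suc i)) (λ i → V (suc i)) p) (dot (λ i → w′ (suc i)) (λ i → V (suc i)) p))

  -- The factor `A` in `bounded` is the same for every target `τ`. This matters because the target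
  -- will be the negated vector of a further root, whose t is chosen only once `A` is known.
  record Combination {n} (V : Fin n → Root) (A : ℕ → ℚ) (e : ℕ) (τ : ℕ → ℚ) : Set where
    field
      weight  : Fin n → ℚ
      nonNeg  : ∀ i → 0ℚ ≤ weight i
      exact   : ∀ {p} → p ℕ.< e → dot weight V p ≡ τ p
      bounded : ∀ p → ∣ dot weight V p ∣ ≤ A p * sumTo e (λ q → ∣ τ q ∣)

  -- A controls the coordinates p ≥ e of the combination that hits the target τ below e.
  record Spanning (n e : ℕ) : Set where
    field
      V    : Fin n → Root
      A    : ℕ → ℚ
      A≥0  : ∀ p → 0ℚ ≤ A p
      span : ∀ τ → Combination V A e τ

  -- Moves coordinate `e` in one direction without disturbing the lower ones. Since weights cannot
  -- be negative, a ray of each sign is needed to correct that coordinate.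
  record Ray {n} (V : Fin n → Root) (e : ℕ) (s : Sign) : Set where
    field
      weight : Fin n → ℚ
      nonNeg : ∀ i → 0ℚ ≤ weight i
      low    : ∀ {p} → p ℕ.< e → dot weight V p ≡ 0ℚ
      top    : dot weight V e ≡ σ s

  -- For large t, coordinate e of a root, of size tᵉ, outweighs what the correction
  -- of its lower coordinates, of size tᵉ⁻¹ in total, contributes there.
  ray : ∀ {n e} (S : Spanning n e) s → ∃[ r ] Ray (r ∷ᶠ Spanning.V S) e s
  ray {n} {e} S s = r , record { weight = w′ ; nonNeg = w′≥0 ; low = z-low ; top = z-top }
    where
    open Spanning S
    K Ĝ AĜ T τ : ℚ
    K = proj₁ (g-near-1 e)
    0≤K : 0ℚ ≤ K
    0≤K = proj₁ (proj₂ (g-near-1 e))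
    near : ∀ {δ} → ∣ δ ∣ ≤ 1ℚ → ∣ g δ e - 1ℚ ∣ ≤ ∣ δ ∣ * K
    near = proj₂ (proj₂ (g-near-1 e))
    Ĝ = sumTo e λ p → proj₁ (coord-bound p)
    AĜ = A e * Ĝ
    t′ : ℕ
    -- T ≥ 1 + 2 K + 2 AĜ gives T - K - AĜ ≥ 1 + K + AĜ > 0. Here K / T bounds the deviation of g
    -- from 1, and T ^ e * AĜ / T bounds the correction at coordinate e.
    t′ = proj₁ (archimedean-ι (K + K + (1ℚ + (AĜ + (1ℚ + AĜ)))))
    r : Root
    r = root± t′ s
    T = ι (Root.t r)
    τ = inv t′
    0≤T : 0ℚ ≤ T
    0≤T = ι-nonNeg (Root.t r)
    1≤T : 1ℚ ≤ T
    1≤T = ι-≥1 (ℕ.s≤s ℕ.z≤n)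
    0≤Ĝ : 0ℚ ≤ Ĝ
    0≤Ĝ = sumTo-nonNeg e λ p → proj₁ (proj₂ (coord-bound p))
    0≤AĜ : 0ℚ ≤ AĜ
    0≤AĜ = *-nonNeg (A≥0 e) 0≤Ĝ
    large′ : K + K + (1ℚ + (AĜ + (1ℚ + AĜ))) ≤ T
    large′ = ℚ.≤-trans (proj₂ (archimedean-ι (K + K + (1ℚ + (AĜ + (1ℚ + AĜ)))))) (ι-mono (ℕ.n≤1+n t′))
    u : ℕ → ℚ
    u = coord r
    -- The old roots cancel the lower coordinates of the new one; what they do to coordinate e is
    -- the unwanted term D.
    module C = Combination (span (λ p → ℚ.- u p))
    w : Fin n → ℚ
    w = C.weight
    D : ℚ
    D = dot w V e
    z : ℕ → ℚ
    z p = u p + dot w V p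
    total : ℚ
    total = sumTo e λ q → ∣ ℚ.- u q ∣
    -- Coordinates below e are smaller than T ^ e by at least one factor T. That factor is kept on
    -- the left, so that no power T ^ (e - 1) is needed and e = 0 is included.
    lower-total : T * total ≤ T ^ e * Ĝ
    lower-total = sumTo-scaled-≤ e T (T ^ e) λ {p} p<e → begin
      T * ∣ ℚ.- u p ∣          ≡⟨ cong (T *_) (ℚ.∣-p∣≡∣p∣ (u p)) ⟩
      T * ∣ u p ∣              ≤⟨ *-monoˡ T 0≤T (proj₂ (proj₂ (coord-bound p)) r) ⟩
      T * (T ^ p * G p)        ≡⟨ ℚ.*-assoc T (T ^ p) (G p) ⟨
      T ^ suc p * G p          ≤⟨ *-monoʳ (G p) (proj₁ (proj₂ (coord-bound p))) (^-monoʳ 1≤T p<e) ⟩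
      T ^ e * G p              ∎
      where
      open ℚ.≤-Reasoning
      G = λ p → proj₁ (coord-bound p)
    lower-top : T * ∣ D ∣ ≤ T ^ e * AĜ
    lower-top = begin
      T * ∣ D ∣                ≤⟨ *-monoˡ T 0≤T (C.bounded e) ⟩
      T * (A e * total)        ≡⟨ solve 3 (λ t a b → t :* (a :* b) := a :* (t :* b)) refl T (A e) total ⟩
      A e * (T * total)        ≤⟨ *-monoˡ (A e) (A≥0 e) lower-total ⟩
      A e * (T ^ e * Ĝ)        ≡⟨ solve 3 (λ a t b → a :* (t :* b) := t :* (a :* b)) refl (A e) (T ^ e) Ĝ ⟩
      T ^ e * AĜ               ∎
      where open ℚ.≤-Reasoning
    g-lower : 1ℚ - τ * K ≤ g (Root.δ r) e
    g-lower = ∣-∣-lower {g (Root.δ r) e} {1ℚ} {τ * K} (ℚ.≤-trans (near (∣δ∣≤1 r)) (*-monoʳ K 0≤K (∣δ∣≤inv r)))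
    -- The surviving top coordinate, with its expected sign taken out. Once κ > 0 is known, dividing
    -- by κ normalises the top to ± 1 and keeps the weights nonnegative.
    κ : ℚ
    κ = σ s * z e
    -σD≤ : ℚ.- (σ s * D) ≤ ∣ D ∣
    -σD≤ = ℚ.≤-trans (-p≤∣p∣ (σ s * D)) (ℚ.≤-reflexive
      (trans (ℚ.∣p*q∣≡∣p∣*∣q∣ (σ s) D) (trans (cong (_* ∣ D ∣) (∣σ∣ s)) (ℚ.*-identityˡ ∣ D ∣))))
    κ-lower : T ^ e * (1ℚ - τ * K) - ∣ D ∣ ≤ κ
    κ-lower = begin
      T ^ e * (1ℚ - τ * K) - ∣ D ∣             ≤⟨ ℚ.+-mono-≤ (*-monoˡ (T ^ e) (^-nonNeg 0≤T e) g-lower) (ℚ.neg-antimono-≤ -σD≤) ⟩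
      T ^ e * γ + ℚ.- (ℚ.- (σ s * D))          ≡⟨ solve 3 (λ x j d → x :+ (:- (:- (j :* d))) := con 1ℚ :* x :+ j :* d) refl (T ^ e * γ) (σ s) D ⟩
      1ℚ * (T ^ e * γ) + σ s * D               ≡⟨ cong (λ o → o * (T ^ e * γ) + σ s * D) (σ*σ s) ⟨
      σ s * σ s * (T ^ e * γ) + σ s * D        ≡⟨ solve 3 (λ x j d → j :* j :* x :+ j :* d := j :* (j :* x :+ d)) refl (T ^ e * γ) (σ s) D ⟩
      κ                                        ∎
      where
      open ℚ.≤-Reasoning
      γ = g (Root.δ r) e
    1≤Tκ : T ^ e * (1ℚ + K + AĜ) ≤ T * κ
    1≤Tκ = begin
      T ^ e * (1ℚ + K + AĜ)
        ≤⟨ *-monoˡ (T ^ e) (^-nonNeg 0≤T e) (≤-by 0≤slack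
             (solve 3 (λ t k a → t :- k :- a := con 1ℚ :+ k :+ a :+ (t :- (k :+ k :+ (con 1ℚ :+ (a :+ a)))))
               refl T K AĜ)) ⟩
      T ^ e * (T - K - AĜ)
        ≡⟨ solve 4 (λ y t k a → y :* (t :- k :- a) := y :* (t :- con 1ℚ :* k) :- y :* a) refl (T ^ e) T K AĜ ⟩
      T ^ e * (T - 1ℚ * K) - T ^ e * AĜ
        ≤⟨ ℚ.+-monoʳ-≤ (T ^ e * (T - 1ℚ * K)) (ℚ.neg-antimono-≤ lower-top) ⟩
      T ^ e * (T - 1ℚ * K) - T * ∣ D ∣
        ≡⟨ cong (λ o → T ^ e * (T - o * K) - T * ∣ D ∣) (ι*inv t′) ⟨
      T ^ e * (T - T * τ * K) - T * ∣ D ∣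
        ≡⟨ solve 5 (λ y t i k d → y :* (t :- t :* i :* k) :- t :* d := t :* (y :* (con 1ℚ :- i :* k) :- d))
             refl (T ^ e) T τ K ∣ D ∣ ⟩
      T * (T ^ e * (1ℚ - τ * K) - ∣ D ∣)
        ≤⟨ *-monoˡ T 0≤T κ-lower ⟩
      T * κ ∎
      where
      open ℚ.≤-Reasoning
      0≤slack : 0ℚ ≤ T - (K + K + (1ℚ + (AĜ + AĜ)))
      0≤slack = ≤⇒0≤- (ℚ.≤-trans (≤-by 0≤1 (solve 2 (λ k a → k :+ k :+ (con 1ℚ :+ (a :+ (con 1ℚ :+ a)))
        := k :+ k :+ (con 1ℚ :+ (a :+ a)) :+ con 1ℚ) refl K AĜ)) large′)
    0<κ : 0ℚ < κ
    0<κ = subst (0ℚ <_)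
      (trans (solve 3 (λ i t k → i :* (t :* k) := t :* i :* k) refl τ T κ)
        (trans (cong (_* κ) (ι*inv t′)) (ℚ.*-identityˡ κ)))
      (*-pos (inv-pos t′) (ℚ.<-≤-trans
        (*-pos (^-pos (ℚ.<-≤-trans 0<1 1≤T) e)
          (ℚ.<-≤-trans 0<1 (≤-by (+-nonNeg 0≤K 0≤AĜ) (ℚ.+-assoc 1ℚ K AĜ)))) 1≤Tκ))
    κ⁻¹ = proj₁ (reciprocal 0<κ)
    0≤κ⁻¹ : 0ℚ ≤ κ⁻¹
    0≤κ⁻¹ = ℚ.<⇒≤ (proj₁ (proj₂ (reciprocal 0<κ)))
    w′ : Fin (suc n) → ℚ
    w′ = κ⁻¹ ∷ᶠ λ i → κ⁻¹ * w i
    w′≥0 : ∀ i → 0ℚ ≤ w′ i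
    w′≥0 zero    = 0≤κ⁻¹
    w′≥0 (suc i) = *-nonNeg 0≤κ⁻¹ (C.nonNeg i)
    dot-w′ : ∀ p → dot w′ (r ∷ᶠ V) p ≡ κ⁻¹ * z p
    dot-w′ p = trans (cong (κ⁻¹ * u p +_) (dot-* κ⁻¹ w V p))
      (sym (ℚ.*-distribˡ-+ κ⁻¹ (u p) (dot w V p)))
    z-low : ∀ {p} → p ℕ.< e → dot w′ (r ∷ᶠ V) p ≡ 0ℚ
    z-low {p} p<e = trans (dot-w′ p) (trans
      (cong (λ d → κ⁻¹ * (u p + d)) (C.exact p<e))
      (solve 2 (λ k u → k :* (u :+ (:- u)) := con 0ℚ) refl κ⁻¹ (u p)))
    z-top : dot w′ (r ∷ᶠ V) e ≡ σ s
    z-top = begin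
      dot w′ (r ∷ᶠ V) e            ≡⟨ dot-w′ e ⟩
      κ⁻¹ * z e                   ≡⟨ solve 2 (λ k z → k :* z := con 1ℚ :* k :* z) refl κ⁻¹ (z e) ⟩
      1ℚ * κ⁻¹ * z e              ≡⟨ cong (λ o → o * κ⁻¹ * z e) (σ*σ s) ⟨
      σ s * σ s * κ⁻¹ * z e       ≡⟨ solve 3 (λ j k z → j :* j :* k :* z := j :* ((j :* z) :* k)) refl (σ s) κ⁻¹ (z e) ⟩
      σ s * (κ * κ⁻¹)             ≡⟨ cong (σ s *_) (proj₂ (proj₂ (reciprocal 0<κ))) ⟩
      σ s * 1ℚ                    ≡⟨ ℚ.*-identityʳ (σ s) ⟩
      σ s                         ∎
      where open ≡-Reasoning

  sign-split : ∀ x → ∃[ s ] ∣ x ∣ * σ s ≡ x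
  sign-split x with ℚ.∣p∣≡p∨∣p∣≡-p x
  ... | inj₁ eq = Sign.+ , trans (ℚ.*-identityʳ ∣ x ∣) eq
  ... | inj₂ eq = Sign.- , trans (cong (_* ℚ.- 1ℚ) eq) (solve 1 (λ x → (:- x) :* (:- con 1ℚ) := x) refl x)

  -- The old combination hits the target below e and misses it at e by some ρ. Adding ∣ρ∣ times the
  -- ray with the sign of ρ repairs coordinate e and leaves the lower ones alone. The new root of
  -- the opposite sign gets weight zero.
  spanning-extend : ∀ {n e} (S : Spanning n e) (r : Sign → Root) →
                    (∀ s → Ray (r s ∷ᶠ Spanning.V S) e s) → Spanning (suc (suc n)) (suc e)
  spanning-extend {n} {e} S r R = record { V = V′ ; A = A′ ; A≥0 = A′≥0 ; span = span′ }
    where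
    open Spanning S
    V′ : Fin (suc (suc n)) → Root
    V′ = r Sign.+ ∷ᶠ r Sign.- ∷ᶠ V
    embed : Sign → (Fin (suc n) → ℚ) → Fin (suc (suc n)) → ℚ
    embed Sign.+ w = w zero ∷ᶠ 0ℚ ∷ᶠ λ i → w (suc i)
    embed Sign.- w = 0ℚ ∷ᶠ w
    ζ : Sign → Fin (suc (suc n)) → ℚ
    ζ s = embed s (Ray.weight (R s))
    embed≥0 : ∀ s {w} → (∀ i → 0ℚ ≤ w i) → ∀ i → 0ℚ ≤ embed s w i
    embed≥0 Sign.+ h zero          = h zero
    embed≥0 Sign.+ h (suc zero)    = ℚ.≤-refl
    embed≥0 Sign.+ h (suc (suc i)) = h (suc i)
    embed≥0 Sign.- h zero          = ℚ.≤-refl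
    embed≥0 Sign.- h (suc i)       = h i
    dot-embed : ∀ s w p → dot (embed s w) V′ p ≡ dot w (r s ∷ᶠ V) p
    dot-embed Sign.+ w p = solve 3 (λ x v d → x :+ (con 0ℚ :* v :+ d) := x :+ d) refl
      (w zero * coord (r Sign.+) p) (coord (r Sign.-) p) (dot (λ i → w (suc i)) V p)
    dot-embed Sign.- w p = solve 2 (λ v d → con 0ℚ :* v :+ d := d) refl
      (coord (r Sign.+) p) (dot w (r Sign.- ∷ᶠ V) p)
    Z : Sign → ℕ → ℚ
    Z s p = dot (ζ s) V′ p
    Z-low : ∀ s {p} → p ℕ.< e → Z s p ≡ 0ℚ
    Z-low s {p} p<e = trans (dot-embed s _ p) (Ray.low (R s) p<e)
    Z-top : ∀ s → Z s e ≡ σ s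
    Z-top s = trans (dot-embed s _ e) (Ray.top (R s))
    Ẑ A′ : ℕ → ℚ
    Ẑ p = ∣ Z Sign.+ p ∣ + ∣ Z Sign.- p ∣
    Ẑ≥0 : ∀ p → 0ℚ ≤ Ẑ p
    Ẑ≥0 p = +-nonNeg (ℚ.0≤∣p∣ (Z Sign.+ p)) (ℚ.0≤∣p∣ (Z Sign.- p))
    Z≤Ẑ : ∀ s p → ∣ Z s p ∣ ≤ Ẑ p
    Z≤Ẑ Sign.+ p = ≤-by (ℚ.0≤∣p∣ (Z Sign.- p)) refl
    Z≤Ẑ Sign.- p = ≤-by (ℚ.0≤∣p∣ (Z Sign.+ p)) (ℚ.+-comm ∣ Z Sign.+ p ∣ ∣ Z Sign.- p ∣)
    -- The defect satisfies ∣ρ∣ ≤ ∣τ e∣ + A e N, at most 1 + A e times the enlarged norm of the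
    -- target, and a ray contributes at most Ẑ p at coordinate p.
    A′ p = A p + (1ℚ + A e) * Ẑ p
    A′≥0 : ∀ p → 0ℚ ≤ A′ p
    A′≥0 p = +-nonNeg (A≥0 p) (*-nonNeg (+-nonNeg 0≤1 (A≥0 e)) (Ẑ≥0 p))
    span′ : ∀ τ → Combination V′ A′ (suc e) τ
    span′ τ = record { weight = w′ ; nonNeg = w′≥0 ; exact = exact ; bounded = bound }
      where
      module C = Combination (span τ)
      w : Fin n → ℚ
      w = C.weight
      ρ : ℚ
      ρ = τ e - dot w V e
      s : Sign
      s = proj₁ (sign-split ρ)
      w₀ w′ : Fin (suc (suc n)) → ℚ
      w₀ = 0ℚ ∷ᶠ 0ℚ ∷ᶠ w
      w′ i = w₀ i + ∣ ρ ∣ * ζ s i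
      w₀≥0 : ∀ i → 0ℚ ≤ w₀ i
      w₀≥0 zero          = ℚ.≤-refl
      w₀≥0 (suc zero)    = ℚ.≤-refl
      w₀≥0 (suc (suc i)) = C.nonNeg i
      w′≥0 : ∀ i → 0ℚ ≤ w′ i
      w′≥0 i = +-nonNeg (w₀≥0 i) (*-nonNeg (ℚ.0≤∣p∣ ρ)
        (embed≥0 s (Ray.nonNeg (R s)) i))
      dot-w′ : ∀ p → dot w′ V′ p ≡ dot w V p + ∣ ρ ∣ * Z s p
      dot-w′ p = trans (dot-+ w₀ (λ i → ∣ ρ ∣ * ζ s i) V′ p) (cong₂ _+_
        (solve 3 (λ a b d → con 0ℚ :* a :+ (con 0ℚ :* b :+ d) := d) refl
          (coord (r Sign.+) p) (coord (r Sign.-) p) (dot w V p))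
        (dot-* ∣ ρ ∣ (ζ s) V′ p))
      exact : ∀ {p} → p ℕ.< suc e → dot w′ V′ p ≡ τ p
      exact {p} p<1+e with ℕ.m≤n⇒m<n∨m≡n (ℕ.≤-pred p<1+e)
      ... | inj₁ p<e = trans (dot-w′ p) (trans
        (cong₂ (λ x y → x + ∣ ρ ∣ * y) (C.exact p<e) (Z-low s p<e))
        (solve 2 (λ t r → t :+ r :* con 0ℚ := t) refl (τ p) ∣ ρ ∣))
      ... | inj₂ refl = trans (dot-w′ e) (trans
        (cong (dot w V e +_) (trans (cong (∣ ρ ∣ *_) (Z-top s)) (proj₂ (sign-split ρ))))
        (solve 2 (λ t d → d :+ (t :- d) := t) refl (τ e) (dot w V e)))
      bound : ∀ p → ∣ dot w′ V′ p ∣ ≤ A′ p * sumTo (suc e) (λ q → ∣ τ q ∣)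
      bound p = begin
        ∣ dot w′ V′ p ∣                      ≡⟨ cong ∣_∣ (dot-w′ p) ⟩
        ∣ dot w V p + ∣ ρ ∣ * Z s p ∣        ≤⟨ ∣+∣≤ {dot w V p} {∣ ρ ∣ * Z s p} (C.bounded p)
                                                 (∣*∣≤ {∣ ρ ∣} {Z s p} (ℚ.≤-trans (ℚ.≤-reflexive (ℚ.∣∣p∣∣≡∣p∣ ρ)) ρ≤) (Z≤Ẑ s p)) ⟩
        A p * N + (∣ τ e ∣ + A e * N) * Ẑ p  ≤⟨ ≤-by 0≤slack (solve 5 (λ a b z n t →
                                                 (a :+ (con 1ℚ :+ b) :* z) :* (n :+ t) :=
                                                 a :* n :+ (t :+ b :* n) :* z :+ (a :* t :+ b :* t :* z :+ n :* z))
                                                 refl (A p) (A e) (Ẑ p) N ∣ τ e ∣) ⟩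
        A′ p * (N + ∣ τ e ∣)                 ∎
        where
        open ℚ.≤-Reasoning
        N = sumTo e (λ q → ∣ τ q ∣)
        0≤N : 0ℚ ≤ N
        0≤N = sumTo-nonNeg e (λ q → ℚ.0≤∣p∣ (τ q))
        ρ≤ : ∣ ρ ∣ ≤ ∣ τ e ∣ + A e * N
        ρ≤ = ∣-∣≤ {τ e} {dot w V e} ℚ.≤-refl (C.bounded e)
        0≤τₑ = ℚ.0≤∣p∣ (τ e)
        0≤slack : 0ℚ ≤ A p * ∣ τ e ∣ + A e * ∣ τ e ∣ * Ẑ p + N * Ẑ p
        0≤slack = +-nonNeg (+-nonNeg (*-nonNeg (A≥0 p) 0≤τₑ) (*-nonNeg (*-nonNeg (A≥0 e) 0≤τₑ) (Ẑ≥0 p)))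
          (*-nonNeg 0≤N (Ẑ≥0 p))

  spanning-suc : ∀ {n e} → Spanning n e → Spanning (suc (suc n)) (suc e)
  spanning-suc S = spanning-extend S (λ s → proj₁ (ray S s)) (λ s → proj₂ (ray S s))

  spanning-0 : ∀ {n} → (Fin n → Root) → Spanning n 0
  spanning-0 V = record
    { V = V ; A = λ _ → 0ℚ ; A≥0 = λ _ → ℚ.≤-refl
    ; span = λ τ → record
        { weight = λ _ → 0ℚ ; nonNeg = λ _ → ℚ.≤-refl ; exact = λ ()
        ; bounded = λ p → ℚ.≤-reflexive (cong ∣_∣ (dot-0 V p)) } }

  -- An odd n starts from one spare root, which keeps weight zero throughout. This lets the number
  -- of roots have either parity.
  spanning : ∀ n → ∃[ e ] n ℕ.≤ suc (2 ℕ.* e) × Spanning n e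
  spanning zero          = 0 , ℕ.z≤n , spanning-0 []ᶠ
  spanning (suc zero)    = 0 , ℕ.≤-refl , spanning-0 (root± 0 Sign.+ ∷ᶠ []ᶠ)
  spanning (suc (suc n)) with spanning n
  ... | e , n≤ , S = suc e , ℕ.≤-trans (ℕ.s≤s (ℕ.s≤s n≤)) (ℕ.≤-reflexive (cong suc (sym (ℕ.*-suc 2 e)))) , spanning-suc S

  -- Approximating real square roots and their sums by rationals

  -- The limit of x lies in [q - e, q + e], and approx x M leaves that interval by O(1 / M) at most.
  record Near (x : ℝ) (q e : ℚ) : Set where
    constructor near
    field
      rate       : ℚ
      rate≥0     : 0ℚ ≤ rate
      approx-near : ∀ M → ∣ approx x M - q ∣ ≤ e + rate * inv M

  Near-weaken : ∀ {x q e q′ e′} → ∣ q - q′ ∣ + e ≤ e′ → Near x q e → Near x q′ e′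
  Near-weaken {x} {q} {e} {q′} {e′} h (near W 0≤W f) = near W 0≤W λ M → begin
    ∣ approx x M - q′ ∣                        ≡⟨ cong ∣_∣ (solve 3 (λ a q r → a :- r := (q :- r) :+ (a :- q)) refl (approx x M) q q′) ⟩
    ∣ (q - q′) + (approx x M - q) ∣            ≤⟨ ℚ.∣p+q∣≤∣p∣+∣q∣ (q - q′) (approx x M - q) ⟩
    ∣ q - q′ ∣ + ∣ approx x M - q ∣            ≤⟨ ℚ.+-monoʳ-≤ ∣ q - q′ ∣ (f M) ⟩
    ∣ q - q′ ∣ + (e + W * inv M)               ≡⟨ ℚ.+-assoc ∣ q - q′ ∣ e (W * inv M) ⟨
    ∣ q - q′ ∣ + e + W * inv M                 ≤⟨ ℚ.+-monoˡ-≤ (W * inv M) h ⟩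
    e′ + W * inv M                             ∎
    where open ℚ.≤-Reasoning

  Near-Σ : ∀ {k} (f : Fin k → ℝ) q e → (∀ i → Near (f i) (q i) (e i)) → Near (Σᵣ f) (sum q) (sum e)
  Near-Σ {zero}  f q e h = near 0ℚ ℚ.≤-refl λ M → ℚ.≤-reflexive
    (solve 1 (λ i → con 0ℚ := con 0ℚ :+ con 0ℚ :* i) refl (inv M))
  Near-Σ {suc k} f q e h = near (W₁ + W₂) (+-nonNeg 0≤W₁ 0≤W₂) λ M →
    let x = approx (f zero) M
        y = approx (Σᵣ (f ∘ suc)) M
    in begin
    ∣ (x + y) - (q zero + q₂) ∣                          ≡⟨ cong ∣_∣ (solve 4 (λ x y a b → (x :+ y) :- (a :+ b) := (x :- a) :+ (y :- b)) refl x y (q zero) q₂) ⟩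
    ∣ (x - q zero) + (y - q₂) ∣                          ≤⟨ ℚ.∣p+q∣≤∣p∣+∣q∣ (x - q zero) (y - q₂) ⟩
    ∣ x - q zero ∣ + ∣ y - q₂ ∣                          ≤⟨ ℚ.+-mono-≤ (h₁ M) (h₂ M) ⟩
    (e zero + W₁ * inv M) + (e₂ + W₂ * inv M)            ≡⟨ solve 5 (λ a b c d i → (a :+ c :* i) :+ (b :+ d :* i) := (a :+ b) :+ (c :+ d) :* i) refl (e zero) e₂ W₁ W₂ (inv M) ⟩
    (e zero + e₂) + (W₁ + W₂) * inv M                    ∎
    where
    open ℚ.≤-Reasoning
    q₂ e₂ : ℚ
    q₂ = sum (q ∘ suc)
    e₂ = sum (e ∘ suc)
    open Near (h zero) renaming (rate to W₁; rate≥0 to 0≤W₁; approx-near to h₁)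
    open Near (Near-Σ (f ∘ suc) (q ∘ suc) (e ∘ suc) (h ∘ suc)) renaming (rate to W₂; rate≥0 to 0≤W₂; approx-near to h₂)

  -- If y ≤ x, then x + y ≥ 1 gives x - y ≤ (x + y)(x - y) = x² - y².
  square-compare : ∀ {x y e} → 0ℚ ≤ x → 0ℚ ≤ y → 1ℚ ≤ x + y → 0ℚ ≤ e → x * x ≤ y * y + e → x ≤ y + e
  square-compare {x} {y} {e} 0≤x 0≤y 1≤x+y 0≤e h with ℚ.≤-total x y
  ... | inj₁ x≤y = ℚ.≤-trans x≤y (≤-by 0≤e refl)
  ... | inj₂ y≤x = begin
    x                          ≡⟨ solve 2 (λ x y → x := y :+ con 1ℚ :* (x :- y)) refl x y ⟩
    y + 1ℚ * (x - y)           ≤⟨ ℚ.+-monoʳ-≤ y (*-monoʳ (x - y) (≤⇒0≤- y≤x) 1≤x+y) ⟩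
    y + (x + y) * (x - y)      ≡⟨ solve 2 (λ x y → y :+ (x :+ y) :* (x :- y) := y :+ (x :* x :- y :* y)) refl x y ⟩
    y + (x * x - y * y)        ≤⟨ ℚ.+-monoʳ-≤ y (p≤q+r⇒p-q≤r {x * x} {y * y} {e} h) ⟩
    y + e                      ∎
    where open ℚ.≤-Reasoning

  ι-sq : ∀ n → ι (n ℕ.^ 2) ≡ ι n * ι n
  ι-sq n = trans (cong (λ k → ι (n ℕ.* k)) (ℕ.*-identityʳ n)) (ι-* n n)

  -- Both √a and T are compared through their squares. The factor 1 / (√a + T) that would sharpen
  -- the error is replaced by 1. Rounding the root down to a multiple of 1 / (M + 1) accounts for
  -- the rate.
  root-near : ∀ a {T} → 1ℚ ≤ T → Near (√ a) T ∣ ι a - T * T ∣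
  root-near a {T} 1≤T = near 1ℚ 0≤1 λ M → bound M
    where
    0≤T : 0ℚ ≤ T
    0≤T = ℚ.≤-trans 0≤1 1≤T
    e : ℚ
    e = ∣ ι a - T * T ∣
    0≤e : 0ℚ ≤ e
    0≤e = ℚ.0≤∣p∣ (ι a - T * T)
    bound : ∀ M → ∣ approx (√ a) M - T ∣ ≤ e + 1ℚ * inv M
    bound M = subst (λ ρ → ∣ ρ - T ∣ ≤ e + 1ℚ * i) (sym (/≡ι*inv r M))
      (subst (λ j → ∣ ρ - T ∣ ≤ e + j) (sym (ℚ.*-identityˡ i)) (∣-∣-split upper lower))
      where
      open ℚ.≤-Reasoning
      r : ℕ
      r = rootNumerator 2 a M
      i ρ N : ℚ
      i = inv M
      ρ = ι r * i
      N = ι (suc M)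
      0≤i : 0ℚ ≤ i
      0≤i = inv-nonNeg M
      0≤ρ : 0ℚ ≤ ρ
      0≤ρ = *-nonNeg (ι-nonNeg r) 0≤i
      clear : ι (a ℕ.* suc M ℕ.^ 2) * (i * i) ≡ ι a
      clear = begin-equality
        ι (a ℕ.* suc M ℕ.^ 2) * (i * i)     ≡⟨ cong (_* (i * i)) (trans (ι-* a (suc M ℕ.^ 2)) (cong (ι a *_) (ι-sq (suc M)))) ⟩
        ι a * (N * N) * (i * i)             ≡⟨ solve 3 (λ a n i → a :* (n :* n) :* (i :* i) := a :* ((n :* i) :* (n :* i))) refl (ι a) N i ⟩
        ι a * ((N * i) * (N * i))           ≡⟨ cong (λ o → ι a * (o * o)) (ι*inv M) ⟩
        ι a * (1ℚ * 1ℚ)                     ≡⟨ ℚ.*-identityʳ (ι a) ⟩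
        ι a                                 ∎
      clear-sq : ∀ n → ι (n ℕ.^ 2) * (i * i) ≡ (ι n * i) * (ι n * i)
      clear-sq n = trans (cong (_* (i * i)) (ι-sq n))
        (solve 2 (λ n i → n :* n :* (i :* i) := (n :* i) :* (n :* i)) refl (ι n) i)
      scaled : ∀ {x y} → x ℕ.≤ y → ι x * (i * i) ≤ ι y * (i * i)
      scaled h = *-monoʳ (i * i) (*-nonNeg 0≤i 0≤i) (ι-mono h)
      ρ²≤a : ρ * ρ ≤ ι a
      ρ²≤a = subst₂ _≤_ (clear-sq r) clear (scaled
        (subst (ℕ._≤ a ℕ.* suc M ℕ.^ 2) (ℕ.*-identityʳ (r ℕ.^ 2)) (floorRoot-lower 2 (a ℕ.* suc M ℕ.^ 2) 1)))
      a≤[ρ+i]² : ι a ≤ (ρ + i) * (ρ + i)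
      a≤[ρ+i]² = subst₂ _≤_ clear
        (trans (clear-sq (suc r)) (cong (λ x → x * x) (trans (cong (_* i) (ι-suc r))
          (solve 2 (λ r i → (con 1ℚ :+ r) :* i := r :* i :+ i) refl (ι r) i))))
        (scaled (ℕ.<⇒≤ (subst (a ℕ.* suc M ℕ.^ 2 ℕ.<_) (ℕ.*-identityʳ (suc r ℕ.^ 2))
          (floorRoot-upper 2 (a ℕ.* suc M ℕ.^ 2) 1))))
      upper : ρ ≤ T + (e + i)
      upper = begin
        ρ             ≤⟨ square-compare 0≤ρ 0≤T (ℚ.≤-trans 1≤T (≤-by 0≤ρ (ℚ.+-comm ρ T))) 0≤e
                           (ℚ.≤-trans ρ²≤a (∣-∣-upper {ι a} {T * T} ℚ.≤-refl)) ⟩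
        T + e         ≤⟨ ≤-by 0≤i (sym (ℚ.+-assoc T e i)) ⟩
        T + (e + i)   ∎
      lower : T ≤ ρ + (e + i)
      lower = begin
        T             ≤⟨ square-compare 0≤T (+-nonNeg 0≤ρ 0≤i) (ℚ.≤-trans 1≤T (≤-by (+-nonNeg 0≤ρ 0≤i) refl)) 0≤e
                           (ℚ.≤-trans (∣-∣-upper {T * T} {ι a} (ℚ.≤-reflexive (∣p-q∣-comm (T * T) (ι a))))
                             (ℚ.+-monoˡ-≤ e a≤[ρ+i]²)) ⟩
        ρ + i + e     ≡⟨ solve 3 (λ r i e → r :+ i :+ e := r :+ (e :+ i)) refl ρ i e ⟩
        ρ + (e + i)   ∎

  -- Comparing the root of an integer with its truncated expansion

  radicand : ℕ → Sign → ℕ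
  radicand l Sign.+ = l ℕ.* l ℕ.+ 1
  radicand l Sign.- = l ℕ.* l ℕ.∸ 1

  ι-radicand : ∀ {l} → 1 ℕ.≤ l → ∀ s → ι (radicand l s) ≡ ι l * ι l + σ s
  ι-radicand {l} 1≤l Sign.+ = trans (ι-+ (l ℕ.* l) 1) (cong₂ _+_ (ι-* l l) ι-1)
  ι-radicand {l} 1≤l Sign.- = begin
    ι (l ℕ.* l ℕ.∸ 1)                         ≡⟨ solve 1 (λ x → x := x :+ con 1ℚ :- con 1ℚ) refl (ι (l ℕ.* l ℕ.∸ 1)) ⟩
    ι (l ℕ.* l ℕ.∸ 1) + 1ℚ - 1ℚ               ≡⟨ cong (λ o → ι (l ℕ.* l ℕ.∸ 1) + o - 1ℚ) ι-1 ⟨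
    ι (l ℕ.* l ℕ.∸ 1) + ι 1 - 1ℚ              ≡⟨ cong (_- 1ℚ) (ι-+ (l ℕ.* l ℕ.∸ 1) 1) ⟨
    ι (l ℕ.* l ℕ.∸ 1 ℕ.+ 1) - 1ℚ              ≡⟨ cong (λ n → ι n - 1ℚ) (ℕ.m∸n+n≡m (ℕ.*-mono-≤ 1≤l 1≤l)) ⟩
    ι (l ℕ.* l) - 1ℚ                          ≡⟨ cong (_- 1ℚ) (ι-* l l) ⟩
    ι l * ι l - 1ℚ                            ∎
    where open ≡-Reasoning

  -- The lower bound needs l ≥ 2 because of l² - 1. The upper bound is l² + 1 ≤ (l + 1)², and l + t
  -- will be m.
  radicand-bounds : ∀ {l t} → 2 ℕ.≤ l → 1 ℕ.≤ t → ∀ s → 1 ℕ.≤ radicand l s ×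
                    radicand l s ℕ.≤ (l ℕ.+ t) ℕ.* (l ℕ.+ t)
  radicand-bounds {l} {t} 2≤l 1≤t s = lower s , upper s
    where
    module N = ℕSolver.+-*-Solver
    l+1≤ : l ℕ.* l ℕ.+ 1 ℕ.≤ (l ℕ.+ t) ℕ.* (l ℕ.+ t)
    l+1≤ = ℕ.≤-trans (ℕ.≤-trans (ℕ.m≤m+n (l ℕ.* l ℕ.+ 1) (l ℕ.+ l)) (ℕ.≤-reflexive
        (N.solve 1 (λ l → l N.:* l N.:+ N.con 1 N.:+ (l N.:+ l) N.:= (l N.:+ N.con 1) N.:* (l N.:+ N.con 1)) refl l)))
      (ℕ.*-mono-≤ (ℕ.+-monoʳ-≤ l 1≤t) (ℕ.+-monoʳ-≤ l 1≤t))
    lower : ∀ s → 1 ℕ.≤ radicand l s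
    lower Sign.+ = ℕ.m≤n+m 1 (l ℕ.* l)
    lower Sign.- = ℕ.∸-monoˡ-≤ 1 (ℕ.≤-trans 2≤l (ℕ.≤-trans (ℕ.≤-reflexive (sym (ℕ.*-identityʳ l)))
      (ℕ.*-monoʳ-≤ l (ℕ.≤-trans (ℕ.n≤1+n 1) 2≤l))))
    upper : ∀ s → radicand l s ℕ.≤ (l ℕ.+ t) ℕ.* (l ℕ.+ t)
    upper Sign.+ = l+1≤
    upper Sign.- = ℕ.≤-trans (ℕ.m∸n≤m (l ℕ.* l) 1) (ℕ.≤-trans (ℕ.m≤m+n (l ℕ.* l) 1) l+1≤)

  -- The partial sum σ (g₀ + g₁ x + … ) at x = t / m, with u = 1 / m.
  abstract
    partialSum : Root → ℚ → ℕ → ℚ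
    partialSum r u p = σ (Root.sign r) * eval (h≈ (Root.δ r) p) (ι (Root.t r) * u)

    partialSum≡ : ∀ r u p → partialSum r u p ≡ σ (Root.sign r) * eval (h≈ (Root.δ r) p) (ι (Root.t r) * u)
    partialSum≡ r u p = refl

  partialSum-suc : ∀ r u p → partialSum r u (suc p) ≡ partialSum r u p + u ^ p * coord r p
  partialSum-suc r u p = begin
    partialSum r u (suc p)                   ≡⟨ partialSum≡ r u (suc p) ⟩
    s * eval (h≈ d (suc p)) (T * u)          ≡⟨ cong (s *_) (eval-h≈ d p (T * u)) ⟩
    s * (h + g d p * (T * u) ^ p)            ≡⟨ cong (λ z → s * (h + g d p * z)) (^-distrib-* T u p) ⟩
    s * (h + g d p * (T ^ p * u ^ p))        ≡⟨ solve 5 (λ s h g t u → s :* (h :+ g :* (t :* u)) := s :* h :+ u :* (s :* (t :* g))) refl s h (g d p) (T ^ p) (u ^ p) ⟩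
    s * h + u ^ p * coord r p                ≡⟨ cong (_+ u ^ p * coord r p) (partialSum≡ r u p) ⟨
    partialSum r u p + u ^ p * coord r p     ∎
    where
    open ≡-Reasoning
    s d T h : ℚ
    s = σ (Root.sign r)
    d = Root.δ r
    T = ι (Root.t r)
    h = eval (h≈ d p) (T * u)

  -- Expanding the square of T = l + ½ u s h leaves s (1 - l u h - ¼ s u² h²). Since l u = 1 - x and
  -- s u² = δ x², the bracket is exactly the residue of the equation that defines h.
  expansion-residue : ∀ r {m u l} p → m * u ≡ 1ℚ → l + ι (Root.t r) ≡ m →
    let s = σ (Root.sign r)
        x = ι (Root.t r) * u
        T = l + ½ * u * partialSum r u p
    in (l * l + s) - T * T ≡ s * (x ^ p * (1ℚ + Root.δ r * eval (r≈ (Root.δ r) p) x))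
  expansion-residue r {m} {u} {l} p mu l+t = begin
    (l * l + s) - T * T
      ≡⟨ cong (λ z → (l * l + s) - (l + ½ * u * z) * (l + ½ * u * z)) (partialSum≡ r u p) ⟩
    (l * l + s) - (l + ½ * u * (s * h)) * (l + ½ * u * (s * h))
      ≡⟨ solve 5 (λ l s q u h → (l :* l :+ s) :- (l :+ q :* u :* (s :* h)) :* (l :+ q :* u :* (s :* h))
           := s :* (con 1ℚ :- (q :+ q) :* (l :* u) :* h :- q :* q :* s :* (u :* u) :* (h :* h))) refl l s ½ u h ⟩
    s * (1ℚ - 1ℚ * (l * u) * h - ¼ * s * (u * u) * (h * h))
      ≡⟨ cong₂ (λ y z → s * (1ℚ - 1ℚ * y * h - z * (h * h))) lu quad ⟩
    s * (1ℚ - 1ℚ * (1ℚ - x) * h - ¼ * d * (x * x) * (h * h))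
      ≡⟨ cong (s *_) (solve 3 (λ y h z → con 1ℚ :- con 1ℚ :* y :* h :- z :* (h :* h)
           := con 1ℚ :- (y :* h :+ z :* (h :* h))) refl (1ℚ - x) h (¼ * d * (x * x))) ⟩
    s * (1ℚ - ((1ℚ - x) * h + ¼ * d * (x * x) * (h * h)))
      ≡⟨ cong (λ o → s * (o - ((1ℚ - x) * h + ¼ * d * (x * x) * (h * h)))) (h≈-residue d p x) ⟩
    s * ((1ℚ - x) * h + ¼ * d * (x * x) * (h * h) + X - ((1ℚ - x) * h + ¼ * d * (x * x) * (h * h)))
      ≡⟨ cong (s *_) (solve 2 (λ a b → a :+ b :- a := b) refl ((1ℚ - x) * h + ¼ * d * (x * x) * (h * h)) X) ⟩
    s * X ∎
    where
    open ≡-Reasoning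
    s t τ d x h T X : ℚ
    s = σ (Root.sign r)
    t = ι (Root.t r)
    τ = inv (Root.pred-t r)
    d = Root.δ r
    x = t * u
    h = eval (h≈ d p) x
    T = l + ½ * u * partialSum r u p
    X = x ^ p * (1ℚ + d * eval (r≈ d p) x)
    lu : l * u ≡ 1ℚ - x
    lu = trans (solve 3 (λ l t u → l :* u := (l :+ t) :* u :- t :* u) refl l t u)
      (cong (_- x) (trans (cong (_* u) l+t) mu))
    quad : ¼ * s * (u * u) ≡ ¼ * d * (x * x)
    quad = trans (solve 3 (λ q s u → q :* s :* (u :* u) := q :* s :* (u :* u) :* (con 1ℚ :* con 1ℚ)) refl ¼ s u)
      (trans (cong (λ o → ¼ * s * (u * u) * (o * o)) (sym (ι*inv (Root.pred-t r))))
        (solve 5 (λ q s u t i → q :* s :* (u :* u) :* ((t :* i) :* (t :* i))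
          := q :* (s :* (i :* i)) :* ((t :* u) :* (t :* u))) refl ¼ s u t τ))

  abstract
    seriesBound : ℕ → ℚ
    seriesBound p = proj₁ (h≈-r≈-bound p)

    seriesBound≥0 : ∀ p → 0ℚ ≤ seriesBound p
    seriesBound≥0 p = proj₁ (proj₂ (h≈-r≈-bound p))

    series-bounded : ∀ p {δ} → ∣ δ ∣ ≤ 1ℚ → norm (h≈ δ p) ≤ seriesBound p × norm (r≈ δ p) ≤ seriesBound p
    series-bounded p = proj₂ (proj₂ (h≈-r≈-bound p))

  -- Times uᵖ, this bounds the difference between ω² (l² ± 1) and (ω T)², T being the truncation
  -- with p terms.
  errorConstant : Root → ℕ → ℕ → ℚ
  errorConstant r p ω = ι ω * ι ω * (ι (Root.t r) ^ p * (1ℚ + seriesBound p))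

  errorConstant≥0 : ∀ r p ω → 0ℚ ≤ errorConstant r p ω
  errorConstant≥0 r p ω = *-nonNeg (*-nonNeg (ι-nonNeg ω) (ι-nonNeg ω))
    (*-nonNeg (^-nonNeg (ι-nonNeg (Root.t r)) p) (+-nonNeg 0≤1 (seriesBound≥0 p)))

  -- The integer part `N` is left unspecified, because only the offset `x` matters for the distance
  -- to the nearest integer.
  NearRoot : ℚ → ℚ → ℕ → Set
  NearRoot x y B = Σ[ a ∈ ℕ ] Σ[ N ∈ ℕ ] (1 ℕ.≤ a × a ℕ.≤ B) × Near (√ a) (ι N + x) y

  NearRoot-near : ∀ {x y B} (R : NearRoot x y B) → Near (√ (proj₁ R)) (ι (proj₁ (proj₂ R)) + x) y
  NearRoot-near (_ , _ , _ , h) = h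

  NearRoot-bounds : ∀ {x y B} (R : NearRoot x y B) → 1 ℕ.≤ proj₁ R × proj₁ R ℕ.≤ B
  NearRoot-bounds (_ , _ , h , _) = h

  -- The threshold on m gives l = m - t ≥ 2 + b. Thus l² ± 1 is positive, and T ≥ 1 because its
  -- correction to l is at most `seriesBound p`, hence at most b.
  module _ (r : Root) (p m′ b : ℕ) (K≤b : seriesBound p ≤ ι b)
           (large : 2 ℕ.+ b ℕ.+ Root.t r ℕ.≤ suc m′) where

    private
      m l : ℕ
      m = suc m′
      l = m ℕ.∸ Root.t r

      u x s d h L T K : ℚ
      u = inv m′
      x = ι (Root.t r) * u
      s = σ (Root.sign r)
      d = Root.δ r
      h = partialSum r u p
      L = ι l
      T = L + ½ * u * h
      K = seriesBound p

      0≤u : 0ℚ ≤ u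
      0≤u = inv-nonNeg m′

      t≤m : Root.t r ℕ.≤ m
      t≤m = ℕ.≤-trans (ℕ.m≤n+m (Root.t r) (2 ℕ.+ b)) large

      2+b≤l : 2 ℕ.+ b ℕ.≤ l
      2+b≤l = ℕ.≤-trans (ℕ.≤-reflexive (sym (ℕ.m+n∸n≡m (2 ℕ.+ b) (Root.t r))))
        (ℕ.∸-monoˡ-≤ (Root.t r) large)

      0≤x : 0ℚ ≤ x
      0≤x = *-nonNeg (ι-nonNeg (Root.t r)) 0≤u

      ∣x∣≤1 : ∣ x ∣ ≤ 1ℚ
      ∣x∣≤1 = subst₂ _≤_ (sym (ℚ.0≤p⇒∣p∣≡p 0≤x)) (ι*inv m′) (*-monoʳ u 0≤u (ι-mono t≤m))

      bounds : norm (h≈ d p) ≤ K × norm (r≈ d p) ≤ K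
      bounds = series-bounded p (∣δ∣≤1 r)

      ∣h∣≤K : ∣ h ∣ ≤ K
      ∣h∣≤K = begin
        ∣ h ∣                           ≡⟨ cong ∣_∣ (partialSum≡ r u p) ⟩
        ∣ s * eval (h≈ d p) x ∣         ≡⟨ ℚ.∣p*q∣≡∣p∣*∣q∣ s (eval (h≈ d p) x) ⟩
        ∣ s ∣ * ∣ eval (h≈ d p) x ∣     ≡⟨ trans (cong (_* ∣ eval (h≈ d p) x ∣) (∣σ∣ (Root.sign r))) (ℚ.*-identityˡ _) ⟩
        ∣ eval (h≈ d p) x ∣             ≤⟨ eval-bound (h≈ d p) ∣x∣≤1 ⟩
        norm (h≈ d p)                   ≤⟨ proj₁ bounds ⟩
        K                               ∎
        where open ℚ.≤-Reasoning

      ∣½uh∣≤K : ∣ ½ * u * h ∣ ≤ K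
      ∣½uh∣≤K = begin
        ∣ ½ * u * h ∣                   ≡⟨ ℚ.∣p*q∣≡∣p∣*∣q∣ (½ * u) h ⟩
        ∣ ½ * u ∣ * ∣ h ∣               ≡⟨ cong (_* ∣ h ∣) (ℚ.0≤p⇒∣p∣≡p (*-nonNeg 0≤½ 0≤u)) ⟩
        ½ * u * ∣ h ∣                   ≤⟨ *-monoʳ ∣ h ∣ (ℚ.0≤∣p∣ h) (*-monoˡ ½ 0≤½ (inv≤1 m′)) ⟩
        ½ * 1ℚ * ∣ h ∣                  ≤⟨ ≤-by (*-nonNeg 0≤½ (ℚ.0≤∣p∣ h))
                                            (solve 1 (λ y → y := con ½ :* con 1ℚ :* y :+ con ½ :* y) refl ∣ h ∣) ⟩
        ∣ h ∣                           ≤⟨ ∣h∣≤K ⟩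
        K                               ∎
        where open ℚ.≤-Reasoning

      1≤T : 1ℚ ≤ T
      1≤T = begin
        1ℚ                              ≤⟨ ≤-by (≤⇒0≤- K≤b) (solve 2 (λ b k → con 1ℚ :+ b :- k := con 1ℚ :+ (b :- k)) refl (ι b) K) ⟩
        1ℚ + ι b - K                    ≡⟨ cong (_- K) (ι-suc b) ⟨
        ι (suc b) - K                   ≤⟨ ℚ.+-mono-≤ (ι-mono (ℕ.≤-trans (ℕ.n≤1+n (suc b)) 2+b≤l))
                                            (ℚ.neg-antimono-≤ (ℚ.≤-trans (-p≤∣p∣ (½ * u * h)) ∣½uh∣≤K)) ⟩
        L + ℚ.- (ℚ.- (½ * u * h))       ≡⟨ solve 2 (λ l y → l :+ (:- (:- y)) := l :+ y) refl L (½ * u * h) ⟩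
        T                               ∎
        where open ℚ.≤-Reasoning

      residue : ∣ (L * L + s) - T * T ∣ ≤ ι (Root.t r) ^ p * u ^ p * (1ℚ + K)
      residue = begin
        ∣ (L * L + s) - T * T ∣         ≡⟨ cong ∣_∣ (expansion-residue r {l = L} p (ι*inv m′)
                                            (trans (sym (ι-+ l (Root.t r))) (cong ι (ℕ.m∸n+n≡m t≤m)))) ⟩
        ∣ s * (x ^ p * y) ∣             ≡⟨ ℚ.∣p*q∣≡∣p∣*∣q∣ s (x ^ p * y) ⟩
        ∣ s ∣ * ∣ x ^ p * y ∣           ≡⟨ trans (cong (_* ∣ x ^ p * y ∣) (∣σ∣ (Root.sign r))) (ℚ.*-identityˡ _) ⟩
        ∣ x ^ p * y ∣                   ≡⟨ ℚ.∣p*q∣≡∣p∣*∣q∣ (x ^ p) y ⟩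
        ∣ x ^ p ∣ * ∣ y ∣               ≡⟨ cong (_* ∣ y ∣) (ℚ.0≤p⇒∣p∣≡p (^-nonNeg 0≤x p)) ⟩
        x ^ p * ∣ y ∣                   ≤⟨ *-monoˡ (x ^ p) (^-nonNeg 0≤x p) ∣y∣≤ ⟩
        x ^ p * (1ℚ + K)                ≡⟨ cong (_* (1ℚ + K)) (^-distrib-* (ι (Root.t r)) u p) ⟩
        ι (Root.t r) ^ p * u ^ p * (1ℚ + K) ∎
        where
        open ℚ.≤-Reasoning
        R y : ℚ
        R = eval (r≈ d p) x
        y = 1ℚ + d * R
        ∣y∣≤ : ∣ y ∣ ≤ 1ℚ + K
        ∣y∣≤ = begin
          ∣ 1ℚ + d * R ∣                ≤⟨ ℚ.∣p+q∣≤∣p∣+∣q∣ 1ℚ (d * R) ⟩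
          1ℚ + ∣ d * R ∣                ≡⟨ cong (1ℚ +_) (ℚ.∣p*q∣≡∣p∣*∣q∣ d R) ⟩
          1ℚ + ∣ d ∣ * ∣ R ∣            ≤⟨ ℚ.+-monoʳ-≤ 1ℚ (*-monoʳ ∣ R ∣ (ℚ.0≤∣p∣ R) (∣δ∣≤1 r)) ⟩
          1ℚ + 1ℚ * ∣ R ∣               ≡⟨ cong (1ℚ +_) (ℚ.*-identityˡ ∣ R ∣) ⟩
          1ℚ + ∣ R ∣                    ≤⟨ ℚ.+-monoʳ-≤ 1ℚ (ℚ.≤-trans (eval-bound (r≈ d p) ∣x∣≤1) (proj₂ bounds)) ⟩
          1ℚ + K                        ∎

    -- ω √a = √(ω² a), but a zero weight gives √1, as radicands must be positive.
    nearRoot : ∀ ω W → ω ℕ.≤ W → 1 ℕ.≤ W →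
               NearRoot (ι ω * (½ * u * h)) (u ^ p * errorConstant r p ω) ((W ℕ.* m) ℕ.* (W ℕ.* m))
    nearRoot zero W _ 1≤W = 1 , 1 , (ℕ.≤-refl , ℕ.*-mono-≤ {1} {W ℕ.* m} {1} 1≤Wm 1≤Wm) ,
      Near-weaken error (root-near 1 {1ℚ} ℚ.≤-refl)
      where
      open ℚ.≤-Reasoning
      1≤Wm : 1 ℕ.≤ W ℕ.* m
      1≤Wm = ℕ.*-mono-≤ {1} {W} {1} 1≤W (ℕ.s≤s ℕ.z≤n)
      error : ∣ 1ℚ - (ι 1 + ι 0 * (½ * u * h)) ∣ + ∣ ι 1 - 1ℚ * 1ℚ ∣ ≤ u ^ p * errorConstant r p 0
      error = begin
        ∣ 1ℚ - (ι 1 + ι 0 * (½ * u * h)) ∣ + ∣ ι 1 - 1ℚ * 1ℚ ∣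
          ≡⟨ cong₂ (λ o z → ∣ 1ℚ - (o + z * (½ * u * h)) ∣ + ∣ o - 1ℚ * 1ℚ ∣) ι-1 ι-0 ⟩
        ∣ 1ℚ - (1ℚ + 0ℚ * (½ * u * h)) ∣ + ∣ 1ℚ - 1ℚ * 1ℚ ∣
          ≡⟨ cong (λ z → ∣ z ∣ + ∣ 1ℚ - 1ℚ * 1ℚ ∣) {1ℚ - (1ℚ + 0ℚ * (½ * u * h))} {0ℚ}
               (solve 1 (λ y → con 1ℚ :- (con 1ℚ :+ con 0ℚ :* y) := con 0ℚ) refl (½ * u * h)) ⟩
        ∣ 0ℚ ∣ + ∣ 1ℚ - 1ℚ * 1ℚ ∣
          ≤⟨ *-nonNeg (^-nonNeg 0≤u p) (errorConstant≥0 r p 0) ⟩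
        u ^ p * errorConstant r p 0 ∎
    nearRoot ω@(suc _) W ω≤W 1≤W = a , ω ℕ.* l ,
      ( ℕ.*-mono-≤ {1} {ω ℕ.* ω} {1} (ℕ.s≤s ℕ.z≤n) (proj₁ rad)
      , ℕ.≤-trans (ℕ.*-mono-≤ (ℕ.*-mono-≤ ω≤W ω≤W)
          (ℕ.≤-trans (proj₂ rad) (ℕ.≤-reflexive (cong (λ n → n ℕ.* n) (ℕ.m∸n+n≡m t≤m)))))
          (ℕ.≤-reflexive (ℕ.[m*n]*[o*p]≡[m*o]*[n*p] W W m m))) ,
      subst (λ q → Near (√ a) q (u ^ p * errorConstant r p ω)) split
        (Near-weaken error (root-near a 1≤ωT))
      where
      open ℚ.≤-Reasoning
      a : ℕ
      a = ω ℕ.* ω ℕ.* radicand l (Root.sign r)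
      2≤l : 2 ℕ.≤ l
      2≤l = ℕ.≤-trans (ℕ.m≤m+n 2 b) 2+b≤l
      rad = radicand-bounds {l} {Root.t r} 2≤l (ℕ.s≤s ℕ.z≤n) (Root.sign r)
      1≤ωT : 1ℚ ≤ ι ω * T
      1≤ωT = *-mono-≤-nonNeg 0≤1 (ℚ.≤-trans 0≤1 1≤T) (ι-≥1 (ℕ.s≤s ℕ.z≤n)) 1≤T
      split : ι ω * T ≡ ι (ω ℕ.* l) + ι ω * (½ * u * h)
      split = trans (ℚ.*-distribˡ-+ (ι ω) L (½ * u * h)) (cong (_+ ι ω * (½ * u * h)) (sym (ι-* ω l)))
      ι-a : ι a ≡ ι ω * ι ω * (L * L + s)
      ι-a = trans (ι-* (ω ℕ.* ω) (radicand l (Root.sign r)))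
        (cong₂ _*_ (ι-* ω ω) (ι-radicand (ℕ.≤-trans (ℕ.n≤1+n 1) 2≤l) (Root.sign r)))
      0≤ω² : 0ℚ ≤ ι ω * ι ω
      0≤ω² = *-nonNeg (ι-nonNeg ω) (ι-nonNeg ω)
      error : ∣ ι ω * T - ι ω * T ∣ + ∣ ι a - (ι ω * T) * (ι ω * T) ∣ ≤ u ^ p * errorConstant r p ω
      error = begin
        ∣ ι ω * T - ι ω * T ∣ + ∣ ι a - (ι ω * T) * (ι ω * T) ∣
          ≡⟨ cong₂ _+_ (cong ∣_∣ (ℚ.+-inverseʳ (ι ω * T))) (cong (λ z → ∣ z - (ι ω * T) * (ι ω * T) ∣) ι-a) ⟩
        0ℚ + ∣ ι ω * ι ω * (L * L + s) - (ι ω * T) * (ι ω * T) ∣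
          ≡⟨ ℚ.+-identityˡ _ ⟩
        ∣ ι ω * ι ω * (L * L + s) - (ι ω * T) * (ι ω * T) ∣
          ≡⟨ cong ∣_∣ (solve 3 (λ w y t → w :* w :* y :- (w :* t) :* (w :* t) := w :* w :* (y :- t :* t)) refl (ι ω) (L * L + s) T) ⟩
        ∣ ι ω * ι ω * ((L * L + s) - T * T) ∣
          ≡⟨ trans (ℚ.∣p*q∣≡∣p∣*∣q∣ (ι ω * ι ω) _) (cong (_* ∣ (L * L + s) - T * T ∣) (ℚ.0≤p⇒∣p∣≡p 0≤ω²)) ⟩
        ι ω * ι ω * ∣ (L * L + s) - T * T ∣
          ≤⟨ *-monoˡ (ι ω * ι ω) 0≤ω² residue ⟩
        ι ω * ι ω * (ι (Root.t r) ^ p * u ^ p * (1ℚ + K))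
          ≡⟨ solve 4 (λ w t u k → w :* (t :* u :* k) := u :* (w :* (t :* k))) refl (ι ω * ι ω) (ι (Root.t r) ^ p) (u ^ p) (1ℚ + K) ⟩
        u ^ p * errorConstant r p ω ∎

  -- Integral weights and sums slightly above an integer

  sum-partialSum : ∀ {n} (w : Fin n → ℚ) V u P →
    sum (λ i → w i * partialSum (V i) u P) ≡ sumTo P (λ p → u ^ p * dot w V p)
  sum-partialSum w V u zero = begin
    sum (λ i → w i * partialSum (V i) u 0)    ≡⟨ sum-cong-≗ (λ i → trans (cong (w i *_) (partialSum≡ (V i) u 0))
                                                   (solve 2 (λ w s → w :* (s :* con 0ℚ) := con 0ℚ :* w) refl (w i) (σ (Root.sign (V i))))) ⟩
    sum (λ i → 0ℚ * w i)                      ≡⟨ *-distribˡ-sum 0ℚ w ⟨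
    0ℚ * sum w                                ≡⟨ ℚ.*-zeroˡ (sum w) ⟩
    0ℚ                                        ∎
    where open ≡-Reasoning
  sum-partialSum w V u (suc P) = begin
    sum (λ i → w i * partialSum (V i) u (suc P))
      ≡⟨ sum-cong-≗ (λ i → trans (cong (w i *_) (partialSum-suc (V i) u P))
           (solve 4 (λ w s y c → w :* (s :+ y :* c) := w :* s :+ y :* (w :* c)) refl
             (w i) (partialSum (V i) u P) (u ^ P) (coord (V i) P))) ⟩
    sum (λ i → w i * partialSum (V i) u P + u ^ P * (w i * coord (V i) P))
      ≡⟨ ∑-distrib-+ (λ i → w i * partialSum (V i) u P) (λ i → u ^ P * (w i * coord (V i) P)) ⟩
    sum (λ i → w i * partialSum (V i) u P) + sum (λ i → u ^ P * (w i * coord (V i) P))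
      ≡⟨ cong₂ _+_ (sum-partialSum w V u P) (sym (*-distribˡ-sum (u ^ P) (λ i → w i * coord (V i) P))) ⟩
    sumTo P (λ p → u ^ p * dot w V p) + u ^ P * dot w V P ∎
    where open ≡-Reasoning

  sumTo-0 : ∀ e {f} → (∀ {p} → p ℕ.< e → f p ≡ 0ℚ) → sumTo e f ≡ 0ℚ
  sumTo-0 zero    h = refl
  sumTo-0 (suc e) h = cong₂ _+_ (sumTo-0 e (λ p<e → h (ℕ.m≤n⇒m≤1+n p<e))) (h ℕ.≤-refl)

  sum-ι : ∀ {n} (f : Fin n → ℕ) → ∃[ N ] sum (λ i → ι (f i)) ≡ ι N
  sum-ι {zero}  f = 0 , sym ι-0
  sum-ι {suc n} f with sum-ι (f ∘ suc)
  ... | N , eq = f zero ℕ.+ N , trans (cong (ι (f zero) +_) eq) (sym (ι-+ (f zero) N))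

  Σ-NearRoot : ∀ {k} (x y : Fin k → ℚ) {B} → (∀ i → NearRoot (x i) (y i) B) →
    Σ[ a ∈ (Fin k → ℕ) ] Σ[ N ∈ ℕ ] (∀ i → 1 ℕ.≤ a i × a i ℕ.≤ B) ×
      Near (Σᵣ (λ i → √ (a i))) (ι N + sum x) (sum y)
  Σ-NearRoot {k} x y term =
    (λ i → proj₁ (term i)) , N , (λ i → NearRoot-bounds (term i)) ,
    subst (λ q → Near (Σᵣ (λ i → √ (proj₁ (term i)))) q (sum y)) eq
      (Near-Σ (λ i → √ (proj₁ (term i))) (λ i → ι (n i) + x i) y (λ i → NearRoot-near (term i)))
    where
    n : Fin k → ℕ
    n i = proj₁ (proj₂ (term i))
    N : ℕ
    N = proj₁ (sum-ι n)
    eq : sum (λ i → ι (n i) + x i) ≡ ι N + sum x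
    eq = trans (∑-distrib-+ (λ i → ι (n i)) x) (cong (_+ sum x) (proj₂ (sum-ι n)))

  upperBound : ∀ {n} (f : Fin n → ℕ) → ∃[ B ] (∀ i → f i ℕ.≤ B)
  upperBound {zero}  f = 0 , λ ()
  upperBound {suc n} f with upperBound (f ∘ suc)
  ... | B , f≤B = f zero ℕ.+ B , λ where
    zero    → ℕ.m≤m+n (f zero) B
    (suc i) → ℕ.≤-trans (f≤B i) (ℕ.m≤n+m B (f zero))

  numerator-over-denominator : ∀ p → 0ℚ ≤ p → ∃[ d ] ∃[ n ] ι (suc d) * p ≡ ι n
  numerator-over-denominator p@(mkℚ (ℤ.+ n) d _) 0≤p = d , n , (begin
    ι (suc d) * p                     ≡⟨ cong (ι (suc d) *_) (trans (sym (ℚ.↥p/↧p≡p p)) (/≡ι*inv n d)) ⟩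
    ι (suc d) * (ι n * inv d)         ≡⟨ solve 3 (λ d n i → d :* (n :* i) := (d :* i) :* n) refl (ι (suc d)) (ι n) (inv d) ⟩
    (ι (suc d) * inv d) * ι n         ≡⟨ trans (cong (_* ι n) (ι*inv d)) (ℚ.*-identityˡ (ι n)) ⟩
    ι n                               ∎)
    where open ≡-Reasoning
  numerator-over-denominator (mkℚ ℤ.-[1+ n ] d _) 0≤p with ℚ.drop-*≤* 0≤p
  ... | ()

  commonDenominator : ∀ {n} (w : Fin n → ℚ) → (∀ i → 0ℚ ≤ w i) →
    ∃[ Q ] Σ[ ω ∈ (Fin n → ℕ) ] 1 ℕ.≤ Q × (∀ i → ι (ω i) ≡ ι Q * w i)
  commonDenominator {zero}  w h = 1 , (λ ()) , ℕ.≤-refl , λ ()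
  commonDenominator {suc n} w h
    with numerator-over-denominator (w zero) (h zero) | commonDenominator (w ∘ suc) (h ∘ suc)
  ... | d , a , eq | Q , ω , 1≤Q , eqs =
    suc d ℕ.* Q , (a ℕ.* Q ∷ᶠ λ i → suc d ℕ.* ω i) , ℕ.*-mono-≤ {1} {suc d} (ℕ.s≤s ℕ.z≤n) 1≤Q , λ where
      zero    → trans (ι-* a Q) (trans (cong (_* ι Q) (sym eq)) (trans
        (solve 3 (λ d w q → d :* w :* q := d :* q :* w) refl (ι (suc d)) (w zero) (ι Q))
        (cong (_* w zero) (sym (ι-* (suc d) Q)))))
      (suc i) → trans (ι-* (suc d) (ω i)) (trans (cong (ι (suc d) *_) (eqs i)) (trans
        (sym (ℚ.*-assoc (ι (suc d)) (ι Q) (w (suc i))))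
        (cong (_* w (suc i)) (sym (ι-* (suc d) Q)))))

  -- `κ` is the coefficient of the main term m^(-e-1), `C` that of the error term m^(-e-2), `W` a
  -- bound for the integral weights, and `m₀` the point from which the expansions are valid.
  record Constants (k : ℕ) : Set where
    field
      e W m₀ : ℕ
      κ C    : ℚ
      k≤     : k ℕ.≤ 2 ℕ.* suc e
      1≤W    : 1 ℕ.≤ W
      0<κ    : 0ℚ < κ
      0≤C    : 0ℚ ≤ C

  SmallSum : ∀ {k} → Constants k → ℕ → Set
  SmallSum {k} constants m′ =
    Σ[ a ∈ (Fin k → ℕ) ] Σ[ N ∈ ℕ ] (∀ i → 1 ℕ.≤ a i × a i ℕ.≤ (W ℕ.* suc m′) ℕ.* (W ℕ.* suc m′)) ×
      Near (Σᵣ (λ i → √ (a i))) (ι N + inv m′ ^ suc e * κ) (inv m′ ^ suc e * (inv m′ * C))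
    where open Constants constants

  SmallSums : ℕ → Set
  SmallSums k = Σ[ c ∈ Constants k ] (∀ m′ → Constants.m₀ c ℕ.≤ suc m′ → SmallSum c m′)

  smallSums-ray : ∀ {k e} (V : Fin k → Root) → k ℕ.≤ 2 ℕ.* suc e → Ray V e Sign.+ → SmallSums k
  smallSums-ray {k} {e} V k≤ R = constants , sums
    where
    module R = Ray R
    P : ℕ
    -- The truncation error is known only as O(uᴾ), since comparing squares gains no factor 1 / m.
    -- To be smaller than the main term of order u^(e+1), it needs P = e + 2. The extra coordinate e
    -- + 1, called D below, joins the error.
    P = suc (suc e)
    denominator = commonDenominator R.weight R.nonNeg
    Q b B W m₀ : ℕ
    Q = proj₁ denominator
    ω : Fin k → ℕ
    ω = proj₁ (proj₂ denominator)
    1≤Q : 1 ℕ.≤ Q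
    1≤Q = proj₁ (proj₂ (proj₂ denominator))
    w : Fin k → ℚ
    w i = ι (ω i)
    dot-w : ∀ p → dot w V p ≡ ι Q * dot R.weight V p
    dot-w p = trans (sum-cong-≗ (λ i → cong (_* coord (V i) p) (proj₂ (proj₂ (proj₂ denominator)) i)))
      (dot-* (ι Q) R.weight V p)
    b = proj₁ (archimedean-ι (seriesBound P))
    B = proj₁ (upperBound λ i → Root.t (V i))
    W = suc (proj₁ (upperBound ω))
    m₀ = 2 ℕ.+ b ℕ.+ B
    D κ C C′ : ℚ
    D = dot w V (suc e)
    -- Clearing denominators turns the top coordinate 1 of the ray into Q; the factor ½ is that of
    -- the expansion of a root.
    κ = ½ * ι Q
    C′ = sum λ i → errorConstant (V i) P (ω i)
    C = C′ + ½ * ∣ D ∣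
    sum-nonNeg : ∀ {n} {f : Fin n → ℚ} → (∀ i → 0ℚ ≤ f i) → 0ℚ ≤ sum f
    sum-nonNeg {zero}  h = ℚ.≤-refl
    sum-nonNeg {suc n} h = +-nonNeg (h zero) (sum-nonNeg (h ∘ suc))
    0≤C′ : 0ℚ ≤ C′
    0≤C′ = sum-nonNeg λ i → errorConstant≥0 (V i) P (ω i)
    constants : Constants k
    constants = record
      { e = e ; W = W ; m₀ = m₀ ; κ = κ ; C = C ; k≤ = k≤ ; 1≤W = ℕ.s≤s ℕ.z≤n
      ; 0<κ = *-pos (ℚ.positive⁻¹ ½) (ℚ.<-≤-trans 0<1 (ι-≥1 1≤Q))
      ; 0≤C = +-nonNeg 0≤C′ (*-nonNeg 0≤½ (ℚ.0≤∣p∣ D)) }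
    sums : ∀ m′ → m₀ ℕ.≤ suc m′ → SmallSum constants m′
    sums m′ m₀≤m = weaken (Σ-NearRoot x errors term)
      where
      open ℚ.≤-Reasoning
      u U : ℚ
      u = inv m′
      U = u ^ e
      0≤u : 0ℚ ≤ u
      0≤u = inv-nonNeg m′
      x errors : Fin k → ℚ
      x i = w i * (½ * u * partialSum (V i) u P)
      errors i = u ^ P * errorConstant (V i) P (ω i)
      B² : ℕ
      B² = (W ℕ.* suc m′) ℕ.* (W ℕ.* suc m′)
      term : ∀ i → NearRoot (x i) (errors i) B²
      term i = nearRoot (V i) P m′ b (proj₂ (archimedean-ι (seriesBound P)))
        (ℕ.≤-trans (ℕ.+-monoʳ-≤ (2 ℕ.+ b) (proj₂ (upperBound λ i → Root.t (V i)) i)) m₀≤m)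
        (ω i) W (ℕ.≤-trans (proj₂ (upperBound ω) i) (ℕ.n≤1+n _)) (ℕ.s≤s ℕ.z≤n)
      main : sum x ≡ ½ * u * (U * ι Q + u * U * D)
      main = begin-equality
        sum x
          ≡⟨ sum-cong-≗ (λ i →
               solve 3 (λ w c s → w :* (c :* s) := c :* (w :* s)) refl (w i) (½ * u) (partialSum (V i) u P)) ⟩
        sum (λ i → ½ * u * (w i * partialSum (V i) u P))
          ≡⟨ *-distribˡ-sum (½ * u) (λ i → w i * partialSum (V i) u P) ⟨
        ½ * u * sum (λ i → w i * partialSum (V i) u P)
          ≡⟨ cong (½ * u *_) (sum-partialSum w V u P) ⟩
        ½ * u * (sumTo e (λ p → u ^ p * dot w V p) + U * dot w V e + u * U * D)
          ≡⟨ cong₂ (λ y z → ½ * u * (y + U * z + u * U * D)) low top ⟩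
        ½ * u * (0ℚ + U * ι Q + u * U * D)
          ≡⟨ cong (λ z → ½ * u * (z + u * U * D)) (ℚ.+-identityˡ (U * ι Q)) ⟩
        ½ * u * (U * ι Q + u * U * D) ∎
        where
        low : sumTo e (λ p → u ^ p * dot w V p) ≡ 0ℚ
        low = sumTo-0 e λ {p} p<e → trans (cong (u ^ p *_) (trans (dot-w p) (cong (ι Q *_) (R.low p<e))))
          (solve 2 (λ u q → u :* (q :* con 0ℚ) := con 0ℚ) refl (u ^ p) (ι Q))
        top : dot w V e ≡ ι Q
        top = trans (dot-w e) (trans (cong (ι Q *_) R.top) (ℚ.*-identityʳ (ι Q)))
      error : ∀ N → ∣ (ι N + sum x) - (ι N + u * U * κ) ∣ + sum errors ≤ u * U * (u * C)
      error N = begin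
        ∣ (ι N + sum x) - (ι N + u * U * κ) ∣ + sum errors
          ≡⟨ cong₂ _+_ (cong ∣_∣ (trans (cong (λ z → (ι N + z) - (ι N + u * U * κ)) main)
               (solve 6 (λ n h u y q d → (n :+ h :* u :* (y :* q :+ u :* y :* d)) :- (n :+ u :* y :* (h :* q))
                 := (u :* (u :* y) :* h) :* d) refl (ι N) ½ u U (ι Q) D)))
               (sym (*-distribˡ-sum (u ^ P) (λ i → errorConstant (V i) P (ω i)))) ⟩
        ∣ u * (u * U) * ½ * D ∣ + u * (u * U) * C′
          ≡⟨ cong (_+ u * (u * U) * C′) (trans (ℚ.∣p*q∣≡∣p∣*∣q∣ (u * (u * U) * ½) D)
               (cong (_* ∣ D ∣) (ℚ.0≤p⇒∣p∣≡p (*-nonNeg (^-nonNeg 0≤u P) 0≤½)))) ⟩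
        u * (u * U) * ½ * ∣ D ∣ + u * (u * U) * C′
          ≡⟨ solve 5 (λ u y h d c → u :* (u :* y) :* h :* d :+ u :* (u :* y) :* c
               := u :* y :* (u :* (c :+ h :* d))) refl u U ½ ∣ D ∣ C′ ⟩
        u * U * (u * C) ∎
      weaken : Σ[ a ∈ (Fin k → ℕ) ] Σ[ N ∈ ℕ ] (∀ i → 1 ℕ.≤ a i × a i ℕ.≤ B²) ×
                 Near (Σᵣ (λ i → √ (a i))) (ι N + sum x) (sum errors) →
               SmallSum constants m′
      weaken (a , N , bounds , near-sum) = a , N , bounds ,
        Near-weaken {q = ι N + sum x} {sum errors} {ι N + u * U * κ} {u * U * (u * C)} (error N) near-sum

  smallSums : ∀ k → .{{_ : NonZero k}} → SmallSums k
  smallSums (suc n) = let e , n≤ , S = spanning n ; _ , R = ray S Sign.+ in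
    smallSums-ray _ (ℕ.≤-trans (ℕ.s≤s n≤) (ℕ.≤-reflexive (sym (ℕ.*-suc 2 e)))) R

  -- Distance to the nearest integer, and lower bounds for powers of n

  -- Every integer is at most N or at least N + 1, and the two hypotheses keep y at distance η from
  -- either side.
  ‖‖-lower : ∀ N {η y} → fromℤ N + η ≤ y → y ≤ fromℤ N + (1ℚ - η) → η ≤ ‖ y ‖ℚ
  ‖‖-lower N {η} {y} above below with ‖ y ‖ℚ-attained
  ... | i , eq = subst (η ≤_) (sym eq) (distance i)
    where
    open ℚ.≤-Reasoning
    distance : ∀ i → η ≤ ∣ y - fromℤ i ∣
    distance i with i ℤ.≤? N
    ... | yes i≤N = begin
      η                          ≡⟨ solve 2 (λ e n → e := n :+ e :- n) refl η (fromℤ N) ⟩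
      fromℤ N + η - fromℤ N      ≤⟨ ℚ.+-mono-≤ above (ℚ.neg-antimono-≤ (fromℤ-mono-≤ i≤N)) ⟩
      y - fromℤ i                ≤⟨ p≤∣p∣ (y - fromℤ i) ⟩
      ∣ y - fromℤ i ∣            ∎
    ... | no i≰N = begin
      η                                        ≡⟨ solve 2 (λ e n → e := con 1ℚ :+ n :- (n :+ (con 1ℚ :- e))) refl η (fromℤ N) ⟩
      1ℚ + fromℤ N - (fromℤ N + (1ℚ - η))      ≤⟨ ℚ.+-mono-≤ N+1≤i (ℚ.neg-antimono-≤ below) ⟩
      fromℤ i - y                              ≤⟨ p≤∣p∣ (fromℤ i - y) ⟩
      ∣ fromℤ i - y ∣                          ≡⟨ ∣p-q∣-comm (fromℤ i) y ⟩
      ∣ y - fromℤ i ∣                          ∎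
      where
      N+1≤i : 1ℚ + fromℤ N ≤ fromℤ i
      N+1≤i = subst (_≤ fromℤ i) (fromℤ-+ (ℤ.+ 1) N) (fromℤ-mono-≤ (ℤ.i<j⇒suc[i]≤j (ℤ.≰⇒> i≰N)))

  -- Half of the gap q - e is given up to the approximation error. With ε = (q - e) / 2, the offset
  -- is at most q + e + ε = 2 q - ε ≤ 1 - ε, so q ≤ ½ also keeps the sum away from N + 1.
  ‖‖-positive : ∀ {S} N {q e} → e < q → q ≤ ½ → Near S (ι N + q) e → 0ᵣ <ᵣ ‖ S ‖
  ‖‖-positive {S} N {q} {e} e<q q≤½ (near W 0≤W f) = ε , 0<ε , M₀ , λ {M} M₀≤M →
    subst (_≤ ‖ approx S M ‖ℚ) (sym (ℚ.+-identityˡ ε)) (‖‖-lower (ℤ.+ N)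
      (subst (λ n → n + ε ≤ approx S M) (ι≡ N) (above M (small M₀≤M)))
      (subst (λ n → approx S M ≤ n + (1ℚ - ε)) (ι≡ N) (below M (small M₀≤M))))
    where
    open ℚ.≤-Reasoning
    ε : ℚ
    ε = (q - e) * ½
    0<ε : 0ℚ < ε
    0<ε = half-pos (subst (_< q - e) (ℚ.+-inverseʳ e) (ℚ.+-monoˡ-< (ℚ.- e) e<q))
    ε+ε : ε + ε ≡ q - e
    ε+ε = half+half (q - e)
    M₀ : ℕ
    M₀ = proj₁ (archimedean-inv W 0≤W 0<ε)
    small : ∀ {M} → M₀ ℕ.≤ M → W * inv M ≤ ε
    small = proj₂ (archimedean-inv W 0≤W 0<ε)
    above : ∀ M → W * inv M ≤ ε → ι N + ε ≤ approx S M
    above M h = begin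
      ι N + ε                            ≡⟨ solve 2 (λ n x → n :+ x := n :+ (x :+ x) :- x) refl (ι N) ε ⟩
      ι N + (ε + ε) - ε                  ≡⟨ cong (λ z → ι N + z - ε) ε+ε ⟩
      ι N + (q - e) - ε                  ≤⟨ ℚ.+-monoʳ-≤ (ι N + (q - e)) (ℚ.neg-antimono-≤ h) ⟩
      ι N + (q - e) - W * inv M          ≡⟨ solve 4 (λ n q e w → n :+ (q :- e) :- w := (n :+ q) :- (e :+ w)) refl (ι N) q e (W * inv M) ⟩
      (ι N + q) - (e + W * inv M)        ≤⟨ ∣-∣-lower {approx S M} {ι N + q} {e + W * inv M} (f M) ⟩
      approx S M                         ∎
    below : ∀ M → W * inv M ≤ ε → approx S M ≤ ι N + (1ℚ - ε)
    below M h = begin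
      approx S M                         ≤⟨ ∣-∣-upper {approx S M} {ι N + q} {e + W * inv M} (f M) ⟩
      ι N + q + (e + W * inv M)          ≤⟨ ℚ.+-monoʳ-≤ (ι N + q) (ℚ.+-monoʳ-≤ e h) ⟩
      ι N + q + (e + ε)                  ≡⟨ solve 4 (λ n q e x → n :+ q :+ (e :+ x) := n :+ (q :+ e :+ (x :+ x) :- x)) refl (ι N) q e ε ⟩
      ι N + (q + e + (ε + ε) - ε)        ≡⟨ cong (λ z → ι N + (q + e + z - ε)) ε+ε ⟩
      ι N + (q + e + (q - e) - ε)        ≡⟨ solve 4 (λ n q e x → n :+ (q :+ e :+ (q :- e) :- x) := n :+ (q :+ q :- x)) refl (ι N) q e ε ⟩
      ι N + (q + q - ε)                  ≤⟨ ℚ.+-monoʳ-≤ (ι N) (ℚ.+-monoˡ-≤ (ℚ.- ε) (ℚ.+-mono-≤ q≤½ q≤½)) ⟩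
      ι N + (1ℚ - ε)                     ∎

  ‖‖-upper : ∀ {S} N {q e} → 0ℚ ≤ q → (h : Near S (ι N + q) e) → ∀ M →
             ‖ approx S M ‖ℚ ≤ q + e + Near.rate h * inv M
  ‖‖-upper {S} N {q} {e} 0≤q (near W 0≤W f) M = begin
    ‖ y ‖ℚ                                     ≤⟨ ‖ y ‖ℚ≤ (ℤ.+ N) ⟩
    ∣ y - fromℤ (ℤ.+ N) ∣                      ≡⟨ cong (λ n → ∣ y - n ∣) (ι≡ N) ⟨
    ∣ y - ι N ∣                                ≡⟨ cong ∣_∣ (solve 3 (λ y n q → y :- n := q :+ (y :- (n :+ q))) refl y (ι N) q) ⟩
    ∣ q + (y - (ι N + q)) ∣                    ≤⟨ ℚ.∣p+q∣≤∣p∣+∣q∣ q (y - (ι N + q)) ⟩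
    ∣ q ∣ + ∣ y - (ι N + q) ∣                  ≤⟨ ℚ.+-mono-≤ (ℚ.≤-reflexive (ℚ.0≤p⇒∣p∣≡p 0≤q)) (f M) ⟩
    q + (e + W * inv M)                        ≡⟨ ℚ.+-assoc q e (W * inv M) ⟨
    q + e + W * inv M                          ∎
    where
    open ℚ.≤-Reasoning
    y : ℚ
    y = approx S M

  ι-cancel-≤ : ∀ {m n} → ι m ≤ ι n → m ℕ.≤ n
  ι-cancel-≤ {m} {n} h with m ℕ.≤? n
  ... | yes m≤n = m≤n
  ... | no m≰n = ⊥-elim (ℚ.<-irrefl refl (ℚ.<-≤-trans (<-by 0<1 (trans (ι-suc n) (ℚ.+-comm 1ℚ (ι n))))
    (ℚ.≤-trans (ι-mono (ℕ.≰⇒> m≰n)) h)))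

  negPart-≤ : ∀ r E → ℚ.- r ≤ ½ * ι E → negPart (ℚ.↥ r) ℕ.* 2 ℕ.≤ E ℕ.* ℚ.↧ₙ r
  negPart-≤ (mkℚ (ℤ.+ n) d _) E h = ℕ.z≤n
  negPart-≤ r@(mkℚ ℤ.-[1+ n ] d _) E h = ι-cancel-≤ (begin
    ι (suc n ℕ.* 2)                          ≡⟨ trans (ι-* (suc n) 2) (ℚ.*-comm (ι (suc n)) (ι 2)) ⟩
    ι 2 * ι (suc n)                          ≡⟨ solve 2 (λ t n → t :* n := t :* (con 1ℚ :* n)) refl (ι 2) (ι (suc n)) ⟩
    ι 2 * (1ℚ * ι (suc n))                   ≡⟨ cong (λ o → ι 2 * (o * ι (suc n))) (ι*inv d) ⟨
    ι 2 * (ι (suc d) * inv d * ι (suc n))    ≡⟨ solve 4 (λ t d i n → t :* (d :* i :* n) := t :* (d :* (n :* i))) refl (ι 2) (ι (suc d)) (inv d) (ι (suc n)) ⟩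
    ι 2 * (ι (suc d) * (ι (suc n) * inv d))  ≡⟨ cong (λ z → ι 2 * (ι (suc d) * z)) (trans (sym (/≡ι*inv (suc n) d)) (ℚ.↥p/↧p≡p (ℚ.- r))) ⟩
    ι 2 * (ι (suc d) * ℚ.- r)                ≤⟨ *-monoˡ (ι 2) (ι-nonNeg 2) (*-monoˡ (ι (suc d)) (ι-nonNeg (suc d)) h) ⟩
    ι 2 * (ι (suc d) * (½ * ι E))            ≡⟨ cong (_* (ι (suc d) * (½ * ι E))) (ι≡ 2) ⟩
    (1ℚ + 1ℚ) * (ι (suc d) * (½ * ι E))      ≡⟨ solve 2 (λ d e → (con 1ℚ :+ con 1ℚ) :* (d :* (con ½ :* e)) := e :* d) refl (ι (suc d)) (ι E) ⟩
    ι E * ι (suc d)                          ≡⟨ ι-* E (suc d) ⟨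
    ι (E ℕ.* suc d)                          ∎)
    where open ℚ.≤-Reasoning

  -- n ^ r ≥ Y ^ (- E) if n ≤ Y² and r ≥ - E / 2.
  powNumerator-lower : ∀ n .{{_ : NonZero n}} r E Y M → n ℕ.≤ Y ℕ.* Y → ℚ.- r ≤ ½ * ι E →
    suc M ℕ.≤ suc (powNumerator n r M) ℕ.* Y ℕ.^ E
  powNumerator-lower n r E Y M n≤Y² -r≤ = ^-cancel-≤ (q ℕ.* 2) {{ℕ.m*n≢0 q 2}} (begin
    N ℕ.^ (q ℕ.* 2)                                    ≡⟨ ℕ.^-*-assoc N q 2 ⟨
    (N ℕ.^ q) ℕ.^ 2                                    ≤⟨ ℕ.^-monoˡ-≤ 2 (ℕ.≤-trans (ℕ.m≤n*m (N ℕ.^ q) (n ℕ.^ posPart (ℚ.↥ r)) {{ℕ.m^n≢0 n (posPart (ℚ.↥ r))}})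
                                                            (ℕ.<⇒≤ (floorRoot-upper q _ (n ℕ.^ s) {{ℕ.m^n≢0 n s}}))) ⟩
    (j ℕ.^ q ℕ.* n ℕ.^ s) ℕ.^ 2                        ≡⟨ trans (^-distribʳ-* 2 (j ℕ.^ q) (n ℕ.^ s)) (cong₂ ℕ._*_ (ℕ.^-*-assoc j q 2) (ℕ.^-*-assoc n s 2)) ⟩
    j ℕ.^ (q ℕ.* 2) ℕ.* n ℕ.^ (s ℕ.* 2)                ≤⟨ ℕ.*-monoʳ-≤ (j ℕ.^ (q ℕ.* 2)) (ℕ.^-monoʳ-≤ n (negPart-≤ r E -r≤)) ⟩
    j ℕ.^ (q ℕ.* 2) ℕ.* n ℕ.^ (E ℕ.* q)                ≤⟨ ℕ.*-monoʳ-≤ (j ℕ.^ (q ℕ.* 2)) (ℕ.^-monoˡ-≤ (E ℕ.* q) n≤Y²) ⟩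
    j ℕ.^ (q ℕ.* 2) ℕ.* (Y ℕ.* Y) ℕ.^ (E ℕ.* q)        ≡⟨ cong (j ℕ.^ (q ℕ.* 2) ℕ.*_) Y²^ ⟩
    j ℕ.^ (q ℕ.* 2) ℕ.* (Y ℕ.^ E) ℕ.^ (q ℕ.* 2)        ≡⟨ ^-distribʳ-* (q ℕ.* 2) j (Y ℕ.^ E) ⟨
    (j ℕ.* Y ℕ.^ E) ℕ.^ (q ℕ.* 2)                      ∎)
    where
    open ℕ.≤-Reasoning
    q s N j : ℕ
    q = ℚ.↧ₙ r
    s = negPart (ℚ.↥ r)
    N = suc M
    j = suc (powNumerator n r M)
    Y²^ : (Y ℕ.* Y) ℕ.^ (E ℕ.* q) ≡ (Y ℕ.^ E) ℕ.^ (q ℕ.* 2)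
    Y²^ = begin-equality
      (Y ℕ.* Y) ℕ.^ (E ℕ.* q)        ≡⟨ cong (λ z → (Y ℕ.* z) ℕ.^ (E ℕ.* q)) (ℕ.*-identityʳ Y) ⟨
      (Y ℕ.^ 2) ℕ.^ (E ℕ.* q)        ≡⟨ ℕ.^-*-assoc Y 2 (E ℕ.* q) ⟩
      Y ℕ.^ (2 ℕ.* (E ℕ.* q))        ≡⟨ cong (Y ℕ.^_) (trans (ℕ.*-comm 2 (E ℕ.* q)) (ℕ.*-assoc E q 2)) ⟩
      Y ℕ.^ (E ℕ.* (q ℕ.* 2))        ≡⟨ ℕ.^-*-assoc Y E (q ℕ.* 2) ⟨
      (Y ℕ.^ E) ℕ.^ (q ℕ.* 2)        ∎

  -- From k ≤ k³ follows k M³ ≤ (k M)³. This crude k^(1/3) ≤ k is enough, as the construction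
  -- reaches an exponent linear in k.
  ∛-bound : ∀ k M → approx (∛ k) M ≤ ι k
  ∛-bound k M = subst (approx (∛ k) M ≤_) (sym (ι≡ k)) (/-mono-≤ ρ M k 0
    (subst (ℕ._≤ k ℕ.* suc M) (sym (ℕ.*-identityʳ ρ)) (^-cancel-≤ 3 (begin
      ρ ℕ.^ 3                      ≡⟨ ℕ.*-identityʳ (ρ ℕ.^ 3) ⟨
      ρ ℕ.^ 3 ℕ.* 1                ≤⟨ floorRoot-lower 3 (k ℕ.* suc M ℕ.^ 3) 1 ⟩
      k ℕ.* suc M ℕ.^ 3            ≤⟨ ℕ.*-monoˡ-≤ (suc M ℕ.^ 3) (m≤m^q k 3) ⟩
      k ℕ.^ 3 ℕ.* suc M ℕ.^ 3      ≡⟨ ^-distribʳ-* 3 k (suc M) ⟨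
      (k ℕ.* suc M) ℕ.^ 3          ∎))))
    where
    open ℕ.≤-Reasoning
    ρ : ℕ
    ρ = rootNumerator 3 k M

  ι-^ : ∀ n p → ι (n ℕ.^ p) ≡ ι n ^ p
  ι-^ n zero    = ι-1
  ι-^ n (suc p) = trans (ι-* n (n ℕ.^ p)) (cong (ι n *_) (ι-^ n p))

  0<¼ : 0ℚ < ¼
  0<¼ = half-pos (ℚ.positive⁻¹ ½)

  -- For n ≤ (D m)², n^(-k^(1/3)/4) ≥ n^(-E/2) ≥ (D m)^(-E). The summand `inv M` makes up for
  -- rounding the power down to a multiple of 1 / (M + 1).
  pow-lower : ∀ n .{{_ : NonZero n}} {k E} D m′ M → k ℕ.≤ 2 ℕ.* E → n ℕ.≤ (D ℕ.* suc m′) ℕ.* (D ℕ.* suc m′) →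
    inv m′ ^ E ≤ ι D ^ E * (approx (n ^ᵣ (-ᵣ (fromℚ ¼ *ᵣ ∛ k))) M + inv M)
  pow-lower n {k} {E} D m′ M k≤2E n≤ = begin
    U                                        ≡⟨ solve 1 (λ u → u := con 1ℚ :* u) refl U ⟩
    1ℚ * U                                   ≡⟨ cong (_* U) (ι*inv M) ⟨
    ι (suc M) * i * U                        ≤⟨ *-monoʳ U 0≤U (*-monoʳ i (inv-nonNeg M) (ι-mono
                                                  (powNumerator-lower n r E Y M n≤ -r≤))) ⟩
    ι (suc j ℕ.* Y ℕ.^ E) * i * U            ≡⟨ cong (λ z → z * i * U) (trans (ι-* (suc j) (Y ℕ.^ E))
                                                  (cong₂ _*_ (ι-suc j) (trans (ι-^ Y E) (trans (cong (_^ E) (ι-* D (suc m′)))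
                                                    (^-distrib-* (ι D) (ι (suc m′)) E))))) ⟩
    (1ℚ + ι j) * (ι D ^ E * ι (suc m′) ^ E) * i * U
      ≡⟨ solve 5 (λ j d m i u → (con 1ℚ :+ j) :* (d :* m) :* i :* u := d :* (j :* i :+ i) :* (m :* u)) refl
           (ι j) (ι D ^ E) (ι (suc m′) ^ E) i U ⟩
    ι D ^ E * (ι j * i + i) * (ι (suc m′) ^ E * U)
      ≡⟨ cong (ι D ^ E * (ι j * i + i) *_) (trans (sym (^-distrib-* (ι (suc m′)) (inv m′) E))
           (trans (cong (_^ E) (ι*inv m′)) (1^ E))) ⟩
    ι D ^ E * (ι j * i + i) * 1ℚ             ≡⟨ ℚ.*-identityʳ _ ⟩
    ι D ^ E * (ι j * i + i)                  ≡⟨ cong (λ z → ι D ^ E * (z + i)) (/≡ι*inv j M) ⟨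
    ι D ^ E * (ℤ.+ j ℚ./ suc M + i)          ∎
    where
    open ℚ.≤-Reasoning
    U i r : ℚ
    U = inv m′ ^ E
    0≤U : 0ℚ ≤ U
    0≤U = ^-nonNeg (inv-nonNeg m′) E
    i = inv M
    r = ℚ.- (¼ * approx (∛ k) M)
    Y j : ℕ
    Y = D ℕ.* suc m′
    j = powNumerator n r M
    -- The constant ¼ is fixed here: a quarter of k ≤ 2 E is at most E / 2, the exponent of n that
    -- corresponds to m^E.
    -r≤ : ℚ.- r ≤ ½ * ι E
    -r≤ = begin
      ℚ.- r                        ≡⟨ solve 1 (λ x → :- (:- x) := x) refl (¼ * approx (∛ k) M) ⟩
      ¼ * approx (∛ k) M           ≤⟨ *-monoˡ ¼ (ℚ.<⇒≤ 0<¼) (ℚ.≤-trans (∛-bound k M) (ι-mono k≤2E)) ⟩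
      ¼ * ι (2 ℕ.* E)              ≡⟨ cong (¼ *_) (trans (ι-* 2 E) (cong (_* ι E) (ι≡ 2))) ⟩
      ¼ * ((1ℚ + 1ℚ) * ι E)        ≡⟨ solve 1 (λ e → con ½ :* con ½ :* ((con 1ℚ :+ con 1ℚ) :* e) := con ½ :* e) refl (ι E) ⟩
      ½ * ι E                      ∎

  -- Matching m to a given n

  -- The sum lies within `e` of N + q. Here e < q ≤ ½ yields a positive distance, and q + e ≤ ε
  -- yields the upper bound.
  NearInteger : (k n : ℕ) → ℚ → Set
  NearInteger k n ε =
    Σ[ a ∈ (Fin k → ℕ) ] Σ[ N ∈ ℕ ] Σ[ q ∈ ℚ ] Σ[ e ∈ ℚ ]
      (∀ i → 1 ℕ.≤ a i × a i ℕ.≤ n) ×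
      (e < q × 0ℚ ≤ q × q ≤ ½ × q + e ≤ ε) ×
      Near (Σᵣ (λ i → √ (a i))) (ι N + q) e

  -- Rounding of the power and approximation of S cost together (c + rate) / (M + 1), which falls
  -- below any tolerance that `_≤ᵣ_` grants.
  ≤ᵣ-from-Near : ∀ {S} N {q e} c p → 0ℚ ≤ q → 0ℚ ≤ c → Near S (ι N + q) e →
    (∀ M → q + e ≤ c * (approx p M + inv M)) → ‖ S ‖ ≤ᵣ fromℚ c *ᵣ p
  ≤ᵣ-from-Near {S} N {q} {e} c p 0≤q 0≤c h le {ε} 0<ε = M₀ , λ {M} M₀≤M → begin
    ‖ approx S M ‖ℚ                                       ≤⟨ ‖‖-upper N 0≤q h M ⟩
    q + e + W * inv M                                     ≤⟨ ℚ.+-monoˡ-≤ (W * inv M) (le M) ⟩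
    c * (approx p M + inv M) + W * inv M                  ≡⟨ solve 4 (λ c p i w → c :* (p :+ i) :+ w :* i := c :* p :+ (c :+ w) :* i) refl c (approx p M) (inv M) W ⟩
    c * approx p M + (c + W) * inv M                      ≤⟨ ℚ.+-monoʳ-≤ (c * approx p M) (proj₂ rate-small M₀≤M) ⟩
    c * approx p M + ε                                    ∎
    where
    open ℚ.≤-Reasoning
    W : ℚ
    W = Near.rate h
    rate-small : ∃[ M₀ ] (∀ {M} → M₀ ℕ.≤ M → (c + W) * inv M ≤ ε)
    rate-small = archimedean-inv (c + W) (+-nonNeg 0≤c (Near.rate≥0 h)) 0<ε
    M₀ : ℕ
    M₀ = proj₁ rate-small

  -- The witness is √2 + (k - 1), which takes care of the n below a bound depending on k.
  trivial-sum : ∀ k .{{_ : NonZero k}} n {ε} → 2 ℕ.≤ n → ½ ≤ ε → NearInteger k n ε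
  trivial-sum (suc k) n {ε} 2≤n ½≤ε = finish (Σ-NearRoot x y term)
    where
    -- 7/5 approximates √2, and 2 - (7/5)² = 1/25. The offset 2/5 exceeds this error, and their sum
    -- 11/25 is below ½.
    2/5 1/25 7/5 : ℚ
    2/5 = ℤ.+ 2 ℚ./ 5
    1/25 = ℤ.+ 1 ℚ./ 25
    7/5 = ℤ.+ 7 ℚ./ 5
    x y : Fin (suc k) → ℚ
    x = 2/5 ∷ᶠ λ _ → 0ℚ
    y = 1/25 ∷ᶠ λ _ → 0ℚ
    1≤n : 1 ℕ.≤ n
    1≤n = ℕ.≤-trans (ℕ.n≤1+n 1) 2≤n
    near-√2 : Near (√ 2) (ι 1 + 2/5) 1/25
    near-√2 = Near-weaken (ℚ.≤-reflexive
      (cong₂ (λ o t → ∣ 7/5 - (o + 2/5) ∣ + ∣ t - 7/5 * 7/5 ∣) ι-1 (ι≡ 2)))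
      (root-near 2 {7/5} (from-yes (1ℚ ℚ.≤? 7/5)))
    near-√1 : Near (√ 1) (ι 1 + 0ℚ) 0ℚ
    near-√1 = Near-weaken (ℚ.≤-reflexive
      (cong (λ o → ∣ 1ℚ - (o + 0ℚ) ∣ + ∣ o - 1ℚ * 1ℚ ∣) ι-1)) (root-near 1 {1ℚ} ℚ.≤-refl)
    term : ∀ i → NearRoot (x i) (y i) n
    term zero    = 2 , 1 , (ℕ.n≤1+n 1 , 2≤n) , near-√2
    term (suc i) = 1 , 1 , (ℕ.≤-refl , 1≤n) , near-√1
    sum-0 : ∀ n → sum {n} (λ _ → 0ℚ) ≡ 0ℚ
    sum-0 zero    = refl
    sum-0 (suc n) = cong (0ℚ +_) (sum-0 n)
    finish : Σ[ a ∈ (Fin (suc k) → ℕ) ] Σ[ N ∈ ℕ ] (∀ i → 1 ℕ.≤ a i × a i ℕ.≤ n) ×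
               Near (Σᵣ (λ i → √ (a i))) (ι N + sum x) (sum y) →
             NearInteger (suc k) n ε
    finish (a , N , bounds , h) = a , N , 2/5 , 1/25 , bounds ,
      ( from-yes (1/25 ℚ.<? 2/5) , from-yes (0ℚ ℚ.≤? 2/5) , from-yes (2/5 ℚ.≤? ½)
      , ℚ.≤-trans (from-yes (2/5 + 1/25 ℚ.≤? ½)) ½≤ε ) ,
      subst₂ (λ q e → Near (Σᵣ (λ i → √ (a i))) (ι N + q) e)
        (cong (2/5 +_) (sum-0 k)) (cong (1/25 +_) (sum-0 k)) h

  fromℚ-pos : ∀ {p} → 0ℚ < p → 0ᵣ <ᵣ fromℚ p
  fromℚ-pos {p} 0<p = p , 0<p , 0 , λ _ → ℚ.≤-reflexive (ℚ.+-identityˡ p)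

  module _ (k : ℕ) .{{_ : NonZero k}} (constants : Constants k)
           (sums : ∀ m′ → Constants.m₀ constants ℕ.≤ suc m′ → SmallSum constants m′) where

    private
      open Constants constants

      E D N₁ N₂ m₁ : ℕ
      E = suc e
      -- The largest j with (W j)² ≤ n satisfies n < (W (j + 1))² ≤ (2 W j)² when j ≥ 1.
      D = 2 ℕ.* W

      0≤κ : 0ℚ ≤ κ
      0≤κ = ℚ.<⇒≤ 0<κ

      error-small : ∃[ N ] (∀ {m} → N ℕ.≤ m → C * inv m ≤ κ * ½)
      error-small = archimedean-inv C 0≤C (half-pos 0<κ)

      main-small : ∃[ N ] (∀ {m} → N ℕ.≤ m → κ * inv m ≤ ½)
      main-small = archimedean-inv κ 0≤κ (ℚ.positive⁻¹ ½)

      N₁ = proj₁ error-small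
      N₂ = proj₁ main-small
      -- Beyond N₁ the error is at most half of the main term; beyond N₂ the main term is at most ½.
      m₁ = m₀ ℕ.+ (N₁ ℕ.+ N₂)

      G : ℚ
      -- κ + C serves large n. The last summand makes G (m₁ + 1)^(-E) at least 1, which makes the
      -- bound hold for small n as well.
      G = κ + C + ι (suc m₁) ^ E

      0≤m₁^E : 0ℚ ≤ ι (suc m₁) ^ E
      0≤m₁^E = ^-nonNeg (ι-nonNeg (suc m₁)) E

      0<G : 0ℚ < G
      0<G = ℚ.<-≤-trans 0<κ (≤-by (+-nonNeg 0≤C 0≤m₁^E) (ℚ.+-assoc κ C (ι (suc m₁) ^ E)))

      0≤u^ : ∀ m′ p → 0ℚ ≤ inv m′ ^ p
      0≤u^ m′ = ^-nonNeg (inv-nonNeg m′)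

      0<u^ : ∀ m′ p → 0ℚ < inv m′ ^ p
      0<u^ m′ = ^-pos (inv-pos m′)

      u^≤1 : ∀ m′ p → inv m′ ^ p ≤ 1ℚ
      u^≤1 m′ zero    = ℚ.≤-refl
      u^≤1 m′ (suc p) = *-mono-≤-nonNeg (inv-nonNeg m′) 0≤1 (inv≤1 m′) (u^≤1 m′ p)

      large-n : ∀ n m′ → m₁ ℕ.≤ m′ → (W ℕ.* suc m′) ℕ.* (W ℕ.* suc m′) ℕ.≤ n →
                SmallSum constants m′ → NearInteger k n (G * inv m′ ^ E)
      large-n n m′ m₁≤m′ ≤n (a , N , bounds , h) =
        a , N , U * κ , U * (u * C) , (λ i → proj₁ (bounds i) , ℕ.≤-trans (proj₂ (bounds i)) ≤n) ,
        (e<q , *-nonNeg (0≤u^ m′ E) 0≤κ , q≤½ , q+e≤) , h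
        where
        open ℚ.≤-Reasoning
        u U : ℚ
        u = inv m′
        U = u ^ E
        e<q : U * (u * C) < U * κ
        e<q = ℚ.*-monoʳ-<-pos U {{ℚ.positive (0<u^ m′ E)}} (ℚ.≤-<-trans
          (subst (_≤ κ * ½) (ℚ.*-comm C u) (proj₂ error-small (ℕ.≤-trans (ℕ.≤-trans (ℕ.m≤m+n N₁ N₂) (ℕ.m≤n+m _ m₀)) m₁≤m′)))
          (<-by (half-pos 0<κ) (sym (half+half κ))))
        q≤½ : U * κ ≤ ½
        q≤½ = begin
          u * u ^ e * κ          ≡⟨ solve 3 (λ u v k → u :* v :* k := v :* (k :* u)) refl u (u ^ e) κ ⟩
          u ^ e * (κ * u)        ≤⟨ *-mono-≤-nonNeg (0≤u^ m′ e) 0≤½ (u^≤1 m′ e)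
                                      (proj₂ main-small (ℕ.≤-trans (ℕ.≤-trans (ℕ.m≤n+m N₂ N₁) (ℕ.m≤n+m _ m₀)) m₁≤m′)) ⟩
          1ℚ * ½                 ≡⟨⟩
          ½                      ∎
        q+e≤ : U * κ + U * (u * C) ≤ G * U
        q+e≤ = begin
          U * κ + U * (u * C)    ≤⟨ ℚ.+-monoʳ-≤ (U * κ) (*-monoˡ U (0≤u^ m′ E) (*-monoʳ C 0≤C (inv≤1 m′))) ⟩
          U * κ + U * (1ℚ * C)   ≤⟨ ≤-by (*-nonNeg 0≤m₁^E (0≤u^ m′ E))
                                      (solve 4 (λ k c x u → (k :+ c :+ x) :* u := u :* k :+ u :* (con 1ℚ :* c) :+ x :* u)
                                        refl κ C (ι (suc m₁) ^ E) U) ⟩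
          G * U                  ∎

      ½≤G*u^ : ½ ≤ G * inv m₁ ^ E
      ½≤G*u^ = begin
        ½                                  ≤⟨ from-yes (½ ℚ.≤? 1ℚ) ⟩
        1ℚ                                 ≡⟨ trans (cong (_^ E) (ι*inv m₁)) (1^ E) ⟨
        (ι (suc m₁) * inv m₁) ^ E          ≡⟨ ^-distrib-* (ι (suc m₁)) (inv m₁) E ⟩
        ι (suc m₁) ^ E * inv m₁ ^ E        ≤⟨ *-monoʳ (inv m₁ ^ E) (0≤u^ m₁ E) (≤-by {ι (suc m₁) ^ E} (+-nonNeg 0≤κ 0≤C) (ℚ.+-comm (κ + C) (ι (suc m₁) ^ E))) ⟩
        G * inv m₁ ^ E                     ∎
        where open ℚ.≤-Reasoning

      n≤[Dm]² : ∀ {n j m} → suc j ℕ.≤ 2 ℕ.* m → n ℕ.< suc j ℕ.^ 2 ℕ.* (W ℕ.* W) → n ℕ.≤ (D ℕ.* m) ℕ.* (D ℕ.* m)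
      n≤[Dm]² {n} {j} {m} j<2m n< = begin
        n                                      ≤⟨ ℕ.<⇒≤ n< ⟩
        suc j ℕ.^ 2 ℕ.* (W ℕ.* W)              ≤⟨ ℕ.*-monoˡ-≤ (W ℕ.* W) (ℕ.^-monoˡ-≤ 2 j<2m) ⟩
        (2 ℕ.* m) ℕ.^ 2 ℕ.* (W ℕ.* W)          ≡⟨ solveℕ 2 (λ m w → (con′ 2 ⊗ m) ⊗ ((con′ 2 ⊗ m) ⊗ con′ 1) ⊗ (w ⊗ w)
                                                    ≈ (con′ 2 ⊗ w ⊗ m) ⊗ (con′ 2 ⊗ w ⊗ m)) refl m W ⟩
        (D ℕ.* m) ℕ.* (D ℕ.* m)                ∎
        where
        open ℕ.≤-Reasoning
        open ℕSolver.+-*-Solver renaming (solve to solveℕ; con to con′; _:*_ to _⊗_; _:=_ to _≈_)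
          using ()

      -- If j exceeds m₁, m = j makes all radicands at most n, and the expansion applies. Otherwise
      -- n is bounded in terms of m₁, and the sum containing √2 is used with m = m₁ + 1.
      scale-n : ∀ n → 2 ℕ.≤ n → ∀ j → Dec (suc m₁ ℕ.≤ j) → j ℕ.^ 2 ℕ.* (W ℕ.* W) ℕ.≤ n → n ℕ.< suc j ℕ.^ 2 ℕ.* (W ℕ.* W) →
                Σ[ m′ ∈ ℕ ] n ℕ.≤ (D ℕ.* suc m′) ℕ.* (D ℕ.* suc m′) × NearInteger k n (G * inv m′ ^ E)
      scale-n n 2≤n (suc m′) (yes (ℕ.s≤s m₁≤m′)) ≤n n< = m′ ,
        n≤[Dm]² (ℕ.s≤s (ℕ.≤-trans (ℕ.m≤m+n (suc m′) 0) (ℕ.m≤n+m _ m′))) n< ,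
        large-n n m′ m₁≤m′ (ℕ.≤-trans (ℕ.≤-reflexive square) ≤n)
          (sums m′ (ℕ.≤-trans (ℕ.m≤m+n m₀ _) (ℕ.≤-trans m₁≤m′ (ℕ.n≤1+n m′))))
        where
        square : (W ℕ.* suc m′) ℕ.* (W ℕ.* suc m′) ≡ suc m′ ℕ.^ 2 ℕ.* (W ℕ.* W)
        square = ℕSolver.+-*-Solver.solve 2 (λ m w → (w ⊗ m) ⊗ (w ⊗ m) ≈ m ⊗ (m ⊗ con′ 1) ⊗ (w ⊗ w)) refl (suc m′) W
          where open ℕSolver.+-*-Solver renaming (con to con′; _:*_ to _⊗_; _:=_ to _≈_) using ()
      scale-n n 2≤n j (no m₁≮j) ≤n n< = m₁ ,
        n≤[Dm]² (ℕ.≤-trans (ℕ.≰⇒> m₁≮j) (ℕ.m≤m+n (suc m₁) _)) n< ,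
        trivial-sum k n 2≤n ½≤G*u^

      D^E : ℚ
      D^E = ι D ^ E

      0<D : 0ℚ < ι D
      0<D = ℚ.<-≤-trans 0<1 (ι-≥1 (ℕ.≤-trans 1≤W (ℕ.m≤m+n W _)))

      c : ℚ
      c = D^E * G

      0<c : 0ℚ < c
      0<c = *-pos (^-pos 0<D E) 0<G

      conclude : ∀ n .{{_ : NonZero n}} →
        Σ[ m′ ∈ ℕ ] n ℕ.≤ (D ℕ.* suc m′) ℕ.* (D ℕ.* suc m′) × NearInteger k n (G * inv m′ ^ E) →
        Σ[ a ∈ (Fin k → ℕ) ] ((i : Fin k) → 1 ℕ.≤ a i × a i ℕ.≤ n) ×
          0ᵣ <ᵣ ‖ Σᵣ (λ i → √ (a i)) ‖ ×
          ‖ Σᵣ (λ i → √ (a i)) ‖ ≤ᵣ fromℚ c *ᵣ n ^ᵣ (-ᵣ (fromℚ ¼ *ᵣ ∛ k))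
      conclude n (m′ , n≤ , a , N , q , e , bounds , (e<q , 0≤q , q≤½ , q+e≤) , h) =
        a , bounds , ‖‖-positive N e<q q≤½ h ,
        ≤ᵣ-from-Near N c (n ^ᵣ (-ᵣ (fromℚ ¼ *ᵣ ∛ k))) 0≤q (ℚ.<⇒≤ 0<c) h λ M → begin
          q + e                                   ≤⟨ q+e≤ ⟩
          G * inv m′ ^ E                          ≤⟨ *-monoˡ G (ℚ.<⇒≤ 0<G) (pow-lower n {k} {E} D m′ M k≤ n≤) ⟩
          G * (D^E * (p M + inv M))               ≡⟨ solve 3 (λ g d z → g :* (d :* z) := d :* g :* z) refl G D^E (p M + inv M) ⟩
          c * (p M + inv M)                       ∎
        where
        open ℚ.≤-Reasoning
        p : ℕ → ℚ
        p = approx (n ^ᵣ (-ᵣ (fromℚ ¼ *ᵣ ∛ k)))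

    close-sums : Σ[ cₖ ∈ ℝ ] 0ᵣ <ᵣ cₖ ×
      ((n : ℕ) .{{_ : NonZero n}} → 2 ℕ.≤ n →
        Σ[ a ∈ (Fin k → ℕ) ] ((i : Fin k) → 1 ℕ.≤ a i × a i ℕ.≤ n) ×
          0ᵣ <ᵣ ‖ Σᵣ (λ i → √ (a i)) ‖ ×
          ‖ Σᵣ (λ i → √ (a i)) ‖ ≤ᵣ cₖ *ᵣ n ^ᵣ (-ᵣ (fromℚ ¼ *ᵣ ∛ k)))
    close-sums = fromℚ c , fromℚ-pos 0<c , λ n 2≤n → conclude n
      (scale-n n 2≤n (j n) (suc m₁ ℕ.≤? j n) (floorRoot-lower 2 n (W ℕ.* W)) (floorRoot-upper 2 n (W ℕ.* W) {{W²≢0}}))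
      where
      j : ℕ → ℕ
      -- The largest j with (W j)² ≤ n, hence the largest m for which the bound (W m)² on the
      -- radicands stays within n.
      j n = floorRoot 2 n (W ℕ.* W)
      W²≢0 : NonZero (W ℕ.* W)
      W²≢0 = ℕ.>-nonZero (ℕ.*-mono-≤ 1≤W 1≤W)

open SquareRootSums using (¼; 0<¼; fromℚ-pos; smallSums; close-sums)

open import Data.Nat using (_≤_)

mainTheorem1 : Σ[ c ∈ ℝ ] 0ᵣ <ᵣ c ×
    ((k : ℕ) .{{_ : NonZero k}} →
    Σ[ cₖ ∈ ℝ ] 0ᵣ <ᵣ cₖ ×
    ((n : ℕ) .{{_ : NonZero n}} → 2 ≤ n →
    Σ[ a ∈ (Fin k → ℕ) ] ((i : Fin k) → 1 ≤ a i × a i ≤ n) ×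
    0ᵣ <ᵣ ‖ Σᵣ (λ i → √ (a i)) ‖ ×
    ‖ Σᵣ (λ i → √ (a i)) ‖ ≤ᵣ cₖ *ᵣ n ^ᵣ (-ᵣ (c *ᵣ ∛ k))))
mainTheorem1 = fromℚ ¼ , fromℚ-pos 0<¼ , λ k → close-sums k (proj₁ (smallSums k)) (proj₂ (smallSums k))
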